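{- Let $k,c\ge1$ be integers and $d>0$. For any instance of $k$-choice Generalized Balls into Bins in which every bin has degree $d_v\le d$, the Proportional Greedy algorithm with capacity $c$ guarantees $$\mathbf{E}\sum_{v\in V}\min\{L_v,c\}\;\ge\;\frac{\mathbf{E}_{j\sim\mathrm{Poisson}(dk)}\min\{j,ck\}}{dk}\cdot\sum_{v\in V}d_v ,$$ i.e. it guarantees the amortized bound $g(d_v)=\frac{\mathbf{E}_{j\sim\mathrm{Poisson}(dk)}\min\{j,ck\}}{dk}\cdot d_v$ for the maximization problem with function $f(L)=\min\{L,c\}$.
   Context: $k$-choice Generalized Balls into Bins: there is a finite set $V$ of bins and the set $E=\binom{V}{k}$ of (types of) $k$-choice balls. Balls of type $e\in E$ arrive by a Poisson process with rate $\lambda_e\ge0$ over the time horizon $[0,1]$, independently for different $e$. Each arriving ball $e$ must immediately and irrevocably be allocated to one of the $k$ bins $v\in e$. The (normalized) degree of bin $v$ is $d_v=\frac1k\sum_{e\ni v}\lambda_e$. $L_v$ is the final load of $v$ (number of balls allocated to $v$ at the end). An algorithm guarantees an amortized bound $g$ for the maximization problem with function $f$ if $\mathbf{E}\sum_v f(L_v)\ge\sum_v g(d_v)$. Proportional Greedy algorithm with capacity $c$: let $r_v(t)=\max\{c-L_v(t),0\}$ be the remaining capacity of bin $v$ at time $t$, where $L_v(t)$ is the current load. When a ball $e$ arrives at time $t$, allocate it to an incident bin $v\in e$ with probability proportional to $r_v(t)$ (arbitrarily if all $r_v(t)$, $v\in e$, are zero). -}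

module Defs where

open import Algebra.Bundles using (CommutativeRing; Semiring)
import Algebra.Definitions.RawSemiring as RawSemiringDefs
import Algebra.Properties.Ring as RingProperties
import Algebra.Properties.CommutativeSemigroup as CommutativeSemigroupProperties
import Algebra.Properties.Semiring.Mult as SemiringMult
open import Data.Bool.Properties using () renaming (_≟_ to _≟ᵇ_)
open import Data.Empty using (⊥-elim)
open import Data.Fin using (Fin; zero; suc; inject₁; fromℕ)
open import Data.Fin.Properties using () renaming (_≟_ to _≟ᶠ_)
open import Data.Fin.Subset using (Subset; inside; outside; _∈_; ∣_∣)
open import Data.Fin.Subset.Properties using (_∈?_)
open import Data.List using (List; []; _∷_; _++_; foldr; filter; length; map; sum; allFin)
open import Data.List.Relation.Unary.All using (All)
import Data.List.Relation.Unary.Sorted.TotalOrder as SortedBy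
open import Data.Nat as ℕ using (ℕ; zero; suc; _∸_; _!)
open import Data.Nat.Properties as ℕₚ using ()
open import Data.Product using (Σ-syntax; ∃; _×_; _,_; proj₁; proj₂)
open import Data.Sum using (inj₁; inj₂)
open import Data.Vec using ([]; _∷_)
open import Data.Vec.Properties using (≡-dec)
open import Level using (0ℓ)
open import Relation.Binary using (IsDecTotalOrder; TotalOrder; Poset)
import Relation.Binary.Construct.NonStrictToStrict as Strict
import Relation.Binary.Reasoning.PartialOrder as PosetReasoning
open import Relation.Binary.PropositionalEquality as ≡ using (_≡_)
open import Relation.Nullary using (¬_; Dec)
open import Relation.Nullary.Decidable using (_×-dec_; ¬?)
open import Relation.Unary using (Pred; _≐_; _⊥′_; U; ∁; ⋃; ⋂)

record OrderedField : Set₁ where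
  field
    commutativeRing : CommutativeRing 0ℓ 0ℓ

  open CommutativeRing commutativeRing public
    hiding (_-_; zero)
    renaming (Carrier to ℝ)

  infix 4 _≤_
  infix 9 _⁻¹
  infixl 7 _/_
  infixl 6 _-_

  field
    _≤_             : ℝ → ℝ → Set
    isDecTotalOrder : IsDecTotalOrder _≈_ _≤_
    +-monoˡ-≤       : ∀ z {x y} → x ≤ y → x + z ≤ y + z
    *-nonNeg        : ∀ {x y} → 0# ≤ x → 0# ≤ y → 0# ≤ x * y
    0≉1             : ¬ 0# ≈ 1#
    -- The value of 0# ⁻¹ is unconstrained.
    _⁻¹             : ℝ → ℝ
    ⁻¹-inverseʳ     : ∀ {x} → ¬ x ≈ 0# → x * x ⁻¹ ≈ 1#

  open IsDecTotalOrder isDecTotalOrder public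
    using (_≤?_; isTotalOrder)
    renaming (refl to ≤-refl; reflexive to ≤-reflexive; trans to ≤-trans;
              antisym to ≤-antisym; total to ≤-total; isPartialOrder to ≤-isPartialOrder)
  open Strict _≈_ _≤_ public using (_<_)
  open RawSemiringDefs (Semiring.rawSemiring semiring) public using (_^_; product) renaming (_×_ to _·_)

  totalOrder : TotalOrder 0ℓ 0ℓ 0ℓ
  totalOrder = record { isTotalOrder = isTotalOrder }

  poset : Poset 0ℓ 0ℓ 0ℓ
  poset = record { isPartialOrder = ≤-isPartialOrder }

  _-_ _/_ : ℝ → ℝ → ℝ
  x - y = x + (- y)
  x / y = x * y ⁻¹

  ⌜_⌝ : ℕ → ℝ
  ⌜ n ⌝ = n · 1#

  Converges : (ℕ → ℝ) → ℝ → Set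
  Converges s l = ∀ ε → 0# < ε → ∃ λ N → ∀ n → N ℕ.≤ n → (s n ≤ l + ε) × (l ≤ s n + ε)

  Cauchy : (ℕ → ℝ) → Set
  Cauchy s = ∀ ε → 0# < ε → ∃ λ N → ∀ m n → N ℕ.≤ m → N ℕ.≤ n → s m ≤ s n + ε

  partialSum : (ℕ → ℝ) → ℕ → ℝ
  partialSum f zero    = 0#
  partialSum f (suc n) = partialSum f n + f n

  HasSum : (ℕ → ℝ) → ℝ → Set
  HasSum f = Converges (partialSum f)

  ∑[_] ∏[_] : {A : Set} → List A → (A → ℝ) → ℝ
  ∑[ xs ] f = foldr (λ x s → f x + s) 0# xs
  ∏[ xs ] f = foldr (λ x p → f x * p) 1# xs

-- The real numbers, given by their second-order axioms: an Archimedean,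
-- Cauchy-complete, totally ordered field.  These axioms determine ℝ up to
-- isomorphism.  The order is decidable, as it is in classical mathematics.
record CompleteOrderedField : Set₁ where
  field
    orderedField : OrderedField

  open OrderedField orderedField public

  field
    archimedean : ∀ x → ∃ λ n → x ≤ ⌜ n ⌝
    complete    : ∀ s → Cauchy s → ∃ (Converges s)

module Exponential (R : CompleteOrderedField) where
  open CompleteOrderedField R

  expTerm : ℝ → ℕ → ℝ
  expTerm x j = x ^ j / ⌜ j ! ⌝

  module Convergence where
    open PosetReasoning poset
    open RingProperties ring using (-‿distribˡ-*; -‿distribʳ-*; -‿involutive)
    module +P = CommutativeSemigroupProperties +-commutativeSemigroup
    module *P = CommutativeSemigroupProperties *-commutativeSemigroup
    open SemiringMult semiring using (×1-homo-*)

    +-mono : ∀ {a b c d} → a ≤ b → c ≤ d → a + c ≤ b + d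
    +-mono {a} {b} {c} {d} a≤b c≤d = begin
      a + c ≤⟨ +-monoˡ-≤ c a≤b ⟩
      b + c ≈⟨ +-comm b c ⟩
      c + b ≤⟨ +-monoˡ-≤ b c≤d ⟩
      d + b ≈⟨ +-comm d b ⟩
      b + d ∎

    ≤⇒0≤- : ∀ {x y} → x ≤ y → 0# ≤ y - x
    ≤⇒0≤- {x} {y} x≤y = begin
      0#    ≈⟨ -‿inverseʳ x ⟨
      x - x ≤⟨ +-monoˡ-≤ (- x) x≤y ⟩
      y - x ∎

    0≤-⇒≤ : ∀ {x y} → 0# ≤ y - x → x ≤ y
    0≤-⇒≤ {x} {y} 0≤y-x = begin
      x               ≈⟨ +-identityˡ x ⟨
      0# + x          ≤⟨ +-monoˡ-≤ x 0≤y-x ⟩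
      (y - x) + x     ≈⟨ +-assoc y (- x) x ⟩
      y + (- x + x)   ≈⟨ +-congˡ (-‿inverseˡ x) ⟩
      y + 0#          ≈⟨ +-identityʳ y ⟩
      y               ∎

    0≤⇒-≤0 : ∀ {x} → 0# ≤ x → - x ≤ 0#
    0≤⇒-≤0 {x} 0≤x = begin
      - x      ≈⟨ +-identityˡ (- x) ⟨
      0# - x   ≤⟨ +-monoˡ-≤ (- x) 0≤x ⟩
      x - x    ≈⟨ -‿inverseʳ x ⟩
      0#       ∎

    ≤0⇒0≤- : ∀ {x} → x ≤ 0# → 0# ≤ - x
    ≤0⇒0≤- {x} x≤0 = ≤-trans (≤⇒0≤- x≤0) (≤-reflexive (+-identityˡ (- x)))

    *-monoˡ : ∀ {z x y} → 0# ≤ z → x ≤ y → z * x ≤ z * y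
    *-monoˡ {z} {x} {y} 0≤z x≤y = 0≤-⇒≤ (begin
      0#                  ≤⟨ *-nonNeg 0≤z (≤⇒0≤- x≤y) ⟩
      z * (y - x)         ≈⟨ distribˡ z y (- x) ⟩
      z * y + z * (- x)   ≈⟨ +-congˡ (-‿distribʳ-* z x) ⟨
      z * y - z * x       ∎)

    *-mono : ∀ {a b x y} → 0# ≤ x → x ≤ y → a ≤ b → 0# ≤ b → x * a ≤ y * b
    *-mono {a} {b} {x} {y} 0≤x x≤y a≤b 0≤b = begin
      x * a ≤⟨ *-monoˡ 0≤x a≤b ⟩
      x * b ≈⟨ *-comm x b ⟩
      b * x ≤⟨ *-monoˡ 0≤b x≤y ⟩
      b * y ≈⟨ *-comm b y ⟩
      y * b ∎

    0≤1 : 0# ≤ 1#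
    0≤1 with ≤-total 0# 1#
    ... | inj₁ p = p
    ... | inj₂ p = begin
      0#              ≤⟨ *-nonNeg (≤0⇒0≤- p) (≤0⇒0≤- p) ⟩
      - 1# * - 1#     ≈⟨ -‿distribˡ-* 1# (- 1#) ⟨
      - (1# * - 1#)   ≈⟨ -‿cong (*-identityˡ (- 1#)) ⟩
      - - 1#          ≈⟨ -‿involutive 1# ⟩
      1#              ∎

    1≰0 : ¬ 1# ≤ 0#
    1≰0 p = 0≉1 (≤-antisym 0≤1 p)

    0≤⌜⌝ : ∀ n → 0# ≤ ⌜ n ⌝
    0≤⌜⌝ zero    = ≤-refl
    0≤⌜⌝ (suc n) = ≤-trans (≤-reflexive (sym (+-identityˡ 0#))) (+-mono 0≤1 (0≤⌜⌝ n))

    ⌜⌝-mono : ∀ {m n} → m ℕ.≤ n → ⌜ m ⌝ ≤ ⌜ n ⌝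
    ⌜⌝-mono {n = n} ℕ.z≤n = 0≤⌜⌝ n
    ⌜⌝-mono (ℕ.s≤s p)     = +-mono ≤-refl (⌜⌝-mono p)

    ⌜⌝≉0 : ∀ n → 1 ℕ.≤ n → ¬ ⌜ n ⌝ ≈ 0#
    ⌜⌝≉0 n 1≤n eq = 1≰0 (begin
      1#        ≈⟨ +-identityʳ 1# ⟨
      ⌜ 1 ⌝     ≤⟨ ⌜⌝-mono 1≤n ⟩
      ⌜ n ⌝     ≈⟨ eq ⟩
      0#        ∎)

    ⁻¹-inverseˡ : ∀ {x} → ¬ x ≈ 0# → x ⁻¹ * x ≈ 1#
    ⁻¹-inverseˡ x≉0 = trans (*-comm _ _) (⁻¹-inverseʳ x≉0)

    ⁻¹-unique : ∀ {a b} → ¬ a ≈ 0# → a * b ≈ 1# → a ⁻¹ ≈ b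
    ⁻¹-unique {a} {b} a≉0 ab≈1 = begin-equality
      a ⁻¹           ≈⟨ *-identityʳ (a ⁻¹) ⟨
      a ⁻¹ * 1#      ≈⟨ *-congˡ ab≈1 ⟨
      a ⁻¹ * (a * b) ≈⟨ *-assoc (a ⁻¹) a b ⟨
      a ⁻¹ * a * b   ≈⟨ *-congʳ (⁻¹-inverseˡ a≉0) ⟩
      1# * b         ≈⟨ *-identityˡ b ⟩
      b              ∎

    0≤⁻¹ : ∀ {x} → 0# ≤ x → ¬ x ≈ 0# → 0# ≤ x ⁻¹
    0≤⁻¹ {x} 0≤x x≉0 with ≤-total 0# (x ⁻¹)
    ... | inj₁ p = p
    ... | inj₂ p = ⊥-elim (1≰0 (0≤-⇒≤ (begin
      0#               ≤⟨ *-nonNeg 0≤x (≤0⇒0≤- p) ⟩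
      x * - x ⁻¹       ≈⟨ -‿distribʳ-* x (x ⁻¹) ⟨
      - (x * x ⁻¹)     ≈⟨ -‿cong (⁻¹-inverseʳ x≉0) ⟩
      - 1#             ≈⟨ +-identityˡ (- 1#) ⟨
      0# - 1#          ∎)))

    step : ℝ → ℕ → ℝ
    step x j = x / ⌜ suc j ⌝

    expTerm-suc : ∀ x j → expTerm x (suc j) ≈ step x j * expTerm x j
    expTerm-suc x j = begin-equality
      (x * x ^ j) * ⌜ suc j ! ⌝ ⁻¹             ≈⟨ *-congˡ (⁻¹-unique (⌜⌝≉0 (suc j !) (ℕₚ.1≤n! (suc j))) inverse) ⟩
      (x * x ^ j) * (a ⁻¹ * b ⁻¹)              ≈⟨ *P.interchange x (x ^ j) (a ⁻¹) (b ⁻¹) ⟩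
      step x j * expTerm x j                   ∎
      where
      a b : ℝ
      a = ⌜ suc j ⌝
      b = ⌜ j ! ⌝
      inverse : ⌜ suc j ! ⌝ * (a ⁻¹ * b ⁻¹) ≈ 1#
      inverse = begin-equality
        ⌜ suc j ! ⌝ * (a ⁻¹ * b ⁻¹)   ≈⟨ *-congʳ (×1-homo-* (suc j) (j !)) ⟩
        (a * b) * (a ⁻¹ * b ⁻¹)       ≈⟨ *P.interchange a b (a ⁻¹) (b ⁻¹) ⟩
        (a * a ⁻¹) * (b * b ⁻¹)       ≈⟨ *-cong (⁻¹-inverseʳ (⌜⌝≉0 (suc j) (ℕ.s≤s ℕ.z≤n))) (⁻¹-inverseʳ (⌜⌝≉0 (j !) (ℕₚ.1≤n! j))) ⟩
        1# * 1#                       ≈⟨ *-identityˡ 1# ⟩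
        1#                            ∎

    0≤⌜suc⌝⁻¹ : ∀ j → 0# ≤ ⌜ suc j ⌝ ⁻¹
    0≤⌜suc⌝⁻¹ j = 0≤⁻¹ (0≤⌜⌝ (suc j)) (⌜⌝≉0 (suc j) (ℕ.s≤s ℕ.z≤n))

    Bounded : ℝ → ℝ → Set
    Bounded x y = (x ≤ y) × (- x ≤ y)

    absolute : ∀ x → ∃ λ y → (0# ≤ y) × Bounded x y
    absolute x with ≤-total 0# x
    ... | inj₁ 0≤x = x , 0≤x , ≤-refl , ≤-trans (0≤⇒-≤0 0≤x) 0≤x
    ... | inj₂ x≤0 = - x , ≤0⇒0≤- x≤0 , ≤-trans x≤0 (≤0⇒0≤- x≤0) , ≤-refl

    bounded-≈ : ∀ {x x′ y y′} → x ≈ x′ → y ≈ y′ → Bounded x′ y′ → Bounded x y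
    bounded-≈ {x} {x′} {y} {y′} p q (u , l) =
      (begin x ≈⟨ p ⟩ x′ ≤⟨ u ⟩ y′ ≈⟨ q ⟨ y ∎) ,
      (begin - x ≈⟨ -‿cong p ⟩ - x′ ≤⟨ l ⟩ y′ ≈⟨ q ⟨ y ∎)

    bounded-* : ∀ {x y a b} → 0# ≤ b → Bounded x y → Bounded a b → Bounded (x * a) (y * b)
    bounded-* {x} {y} {a} {b} 0≤b (x≤y , -x≤y) (a≤b , -a≤b) with ≤-total 0# x
    ... | inj₁ 0≤x = *-mono 0≤x x≤y a≤b 0≤b , (begin
      - (x * a)  ≈⟨ -‿distribʳ-* x a ⟩
      x * - a    ≤⟨ *-mono 0≤x x≤y -a≤b 0≤b ⟩
      y * b      ∎)
    ... | inj₂ x≤0 = (begin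
      x * a         ≈⟨ -‿involutive (x * a) ⟨
      - - (x * a)   ≈⟨ -‿cong (-‿distribˡ-* x a) ⟩
      - (- x * a)   ≈⟨ -‿distribʳ-* (- x) a ⟩
      - x * - a     ≤⟨ *-mono (≤0⇒0≤- x≤0) -x≤y -a≤b 0≤b ⟩
      y * b         ∎) , (begin
      - (x * a)     ≈⟨ -‿distribˡ-* x a ⟩
      - x * a       ≤⟨ *-mono (≤0⇒0≤- x≤0) -x≤y a≤b 0≤b ⟩
      y * b         ∎)

    bounded-nonNeg : ∀ {x} → 0# ≤ x → Bounded x x
    bounded-nonNeg 0≤x = ≤-refl , ≤-trans (0≤⇒-≤0 0≤x) 0≤x

    0≤expTerm : ∀ {y} → 0# ≤ y → ∀ j → 0# ≤ expTerm y j
    0≤expTerm 0≤y zero    = *-nonNeg 0≤1 (0≤⁻¹ (0≤⌜⌝ 1) (⌜⌝≉0 1 (ℕ.s≤s ℕ.z≤n)))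
    0≤expTerm 0≤y (suc j) = ≤-trans
      (*-nonNeg (*-nonNeg 0≤y (0≤⌜suc⌝⁻¹ j)) (0≤expTerm 0≤y j))
      (≤-reflexive (sym (expTerm-suc _ j)))

    bounded-expTerm : ∀ {x y} → 0# ≤ y → Bounded x y → ∀ j → Bounded (expTerm x j) (expTerm y j)
    bounded-expTerm 0≤y b zero    = bounded-nonNeg (0≤expTerm 0≤y zero)
    bounded-expTerm 0≤y b (suc j) = bounded-≈ (expTerm-suc _ j) (expTerm-suc _ j)
      (bounded-* (0≤expTerm 0≤y j) (bounded-* (0≤⌜suc⌝⁻¹ j) b (bounded-nonNeg (0≤⌜suc⌝⁻¹ j)))
        (bounded-expTerm 0≤y b j))

    -- With y = |x| and N ≥ 2y, the terms y^j/j! at least halve at each step from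
    -- j = N on, so the tail of the series from M ≥ N is at most 2y^M/M!.
    module Tail (x y : ℝ) (0≤y : 0# ≤ y) (x±y : Bounded x y) where
      A S : ℕ → ℝ
      A = expTerm y
      S = partialSum (expTerm x)

      0≤A : ∀ j → 0# ≤ A j
      0≤A = 0≤expTerm 0≤y

      N : ℕ
      N = proj₁ (archimedean (y + y))

      halving : ∀ j → N ℕ.≤ j → A (suc j) + A (suc j) ≤ A j
      halving j N≤j = begin
        A (suc j) + A (suc j)               ≈⟨ +-cong (expTerm-suc y j) (expTerm-suc y j) ⟩
        step y j * A j + step y j * A j     ≈⟨ distribʳ (A j) (step y j) (step y j) ⟨
        (step y j + step y j) * A j         ≈⟨ *-congʳ (distribʳ (⌜ suc j ⌝ ⁻¹) y y) ⟨
        (y + y) * ⌜ suc j ⌝ ⁻¹ * A j        ≈⟨ *-comm _ (A j) ⟩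
        A j * ((y + y) * ⌜ suc j ⌝ ⁻¹)      ≤⟨ *-monoˡ (0≤A j) ratio≤1 ⟩
        A j * 1#                            ≈⟨ *-identityʳ (A j) ⟩
        A j                                 ∎
        where
        ratio≤1 : (y + y) * ⌜ suc j ⌝ ⁻¹ ≤ 1#
        ratio≤1 = begin
          (y + y) * ⌜ suc j ⌝ ⁻¹      ≈⟨ *-comm _ _ ⟩
          ⌜ suc j ⌝ ⁻¹ * (y + y)      ≤⟨ *-monoˡ (0≤⌜suc⌝⁻¹ j) (proj₂ (archimedean (y + y))) ⟩
          ⌜ suc j ⌝ ⁻¹ * ⌜ N ⌝        ≤⟨ *-monoˡ (0≤⌜suc⌝⁻¹ j) (⌜⌝-mono (ℕₚ.m≤n⇒m≤1+n N≤j)) ⟩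
          ⌜ suc j ⌝ ⁻¹ * ⌜ suc j ⌝    ≈⟨ ⁻¹-inverseˡ (⌜⌝≉0 (suc j) (ℕ.s≤s ℕ.z≤n)) ⟩
          1#                          ∎

      decay : ∀ p → ⌜ suc p ⌝ * A (p ℕ.+ N) ≤ A N
      decay zero    = ≤-reflexive (trans (*-congʳ (+-identityʳ 1#)) (*-identityˡ (A N)))
      decay (suc p) = begin
        ⌜ suc (suc p) ⌝ * A⁺           ≈⟨ *-comm _ _ ⟩
        A⁺ * ⌜ suc (suc p) ⌝           ≤⟨ *-monoˡ (0≤A (suc (p ℕ.+ N))) (+-mono ≤-refl (≤-trans (≤-reflexive (sym (+-identityˡ _))) (+-monoˡ-≤ _ (0≤⌜⌝ p)))) ⟩
        A⁺ * (1# + (⌜ p ⌝ + ⌜ suc p ⌝)) ≈⟨ *-congˡ (+-assoc _ _ _) ⟨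
        A⁺ * (⌜ suc p ⌝ + ⌜ suc p ⌝)   ≈⟨ *-comm _ _ ⟩
        (⌜ suc p ⌝ + ⌜ suc p ⌝) * A⁺   ≈⟨ distribʳ A⁺ _ _ ⟩
        ⌜ suc p ⌝ * A⁺ + ⌜ suc p ⌝ * A⁺ ≈⟨ distribˡ _ A⁺ A⁺ ⟨
        ⌜ suc p ⌝ * (A⁺ + A⁺)          ≤⟨ *-monoˡ (0≤⌜⌝ (suc p)) (halving (p ℕ.+ N) (ℕₚ.m≤n+m N p)) ⟩
        ⌜ suc p ⌝ * A (p ℕ.+ N)        ≤⟨ decay p ⟩
        A N                            ∎
        where
        A⁺ : ℝ
        A⁺ = A (suc (p ℕ.+ N))

      2A : ℕ → ℝ
      2A j = A j + A j

      module From (M : ℕ) (N≤M : N ℕ.≤ M) where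
        upper : ∀ p → S (p ℕ.+ M) + 2A (p ℕ.+ M) ≤ S M + 2A M
        upper zero    = ≤-refl
        upper (suc p) = ≤-trans (begin
          (S j + expTerm x j) + 2A (suc j)   ≤⟨ +-mono (+-mono ≤-refl (proj₁ (bounded-expTerm 0≤y x±y j))) (halving j N≤j) ⟩
          (S j + A j) + A j                  ≈⟨ +-assoc _ _ _ ⟩
          S j + 2A j                         ∎) (upper p)
          where
          j : ℕ
          j = p ℕ.+ M
          N≤j : N ℕ.≤ j
          N≤j = ℕₚ.≤-trans N≤M (ℕₚ.m≤n+m M p)

        lower : ∀ p → S M + 2A (p ℕ.+ M) ≤ S (p ℕ.+ M) + 2A M
        lower zero    = ≤-refl
        lower (suc p) = begin
          S M + 2A (suc j)                     ≤⟨ +-mono ≤-refl (halving j N≤j) ⟩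
          S M + A j                            ≈⟨ +-identityʳ _ ⟨
          (S M + A j) + 0#                     ≤⟨ +-mono ≤-refl 0≤A+t ⟩
          (S M + A j) + (A j + t)              ≈⟨ +-assoc _ _ _ ⟨
          ((S M + A j) + A j) + t              ≈⟨ +-congʳ (+-assoc _ _ _) ⟩
          (S M + 2A j) + t                     ≤⟨ +-monoˡ-≤ t (lower p) ⟩
          (S j + 2A M) + t                     ≈⟨ +P.xy∙z≈xz∙y _ _ _ ⟩
          (S j + t) + 2A M                     ∎
          where
          j : ℕ
          j = p ℕ.+ M
          t : ℝ
          t = expTerm x j
          N≤j : N ℕ.≤ j
          N≤j = ℕₚ.≤-trans N≤M (ℕₚ.m≤n+m M p)
          0≤A+t : 0# ≤ A j + t
          0≤A+t = begin
            0#         ≈⟨ -‿inverseˡ t ⟨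
            - t + t    ≤⟨ +-monoˡ-≤ t (proj₂ (bounded-expTerm 0≤y x±y j)) ⟩
            A j + t    ∎

        0≤2A : ∀ j → 0# ≤ 2A j
        0≤2A j = ≤-trans (≤-reflexive (sym (+-identityˡ 0#))) (+-mono (0≤A j) (0≤A j))

        ≤+2A : ∀ z j → z ≤ z + 2A j
        ≤+2A z j = ≤-trans (≤-reflexive (sym (+-identityʳ z))) (+-mono ≤-refl (0≤2A j))

        close : ∀ p q → S (p ℕ.+ M) ≤ S (q ℕ.+ M) + (2A M + 2A M)
        close p q = begin
          S (p ℕ.+ M)                     ≤⟨ ≤-trans (≤+2A _ (p ℕ.+ M)) (upper p) ⟩
          S M + 2A M                      ≤⟨ +-monoˡ-≤ _ (≤-trans (≤+2A _ (q ℕ.+ M)) (lower q)) ⟩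
          (S (q ℕ.+ M) + 2A M) + 2A M     ≈⟨ +-assoc _ _ _ ⟩
          S (q ℕ.+ M) + (2A M + 2A M)     ∎

      small : ∀ ε → 0# < ε → ∃ λ p → 2A (p ℕ.+ N) + 2A (p ℕ.+ N) ≤ ε
      small ε (0≤ε , 0≉ε) = p , (begin
        4a (p ℕ.+ N)                                ≈⟨ *-identityˡ _ ⟨
        1# * 4a (p ℕ.+ N)                           ≈⟨ *-congʳ (⁻¹-inverseˡ (⌜⌝≉0 (suc p) (ℕ.s≤s ℕ.z≤n))) ⟨
        ⌜ suc p ⌝ ⁻¹ * ⌜ suc p ⌝ * 4a (p ℕ.+ N)     ≈⟨ *-assoc _ _ _ ⟩
        ⌜ suc p ⌝ ⁻¹ * (⌜ suc p ⌝ * 4a (p ℕ.+ N))   ≤⟨ *-monoˡ (0≤⌜suc⌝⁻¹ p) scaled ⟩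
        ⌜ suc p ⌝ ⁻¹ * (⌜ suc p ⌝ * ε)              ≈⟨ *-assoc _ _ _ ⟨
        ⌜ suc p ⌝ ⁻¹ * ⌜ suc p ⌝ * ε                ≈⟨ *-congʳ (⁻¹-inverseˡ (⌜⌝≉0 (suc p) (ℕ.s≤s ℕ.z≤n))) ⟩
        1# * ε                                      ≈⟨ *-identityˡ ε ⟩
        ε                                           ∎)
        where
        4a : ℕ → ℝ
        4a j = 2A j + 2A j
        ε≉0 : ¬ ε ≈ 0#
        ε≉0 eq = 0≉ε (sym eq)
        p : ℕ
        p = proj₁ (archimedean (ε ⁻¹ * 4a N))
        scaled : ⌜ suc p ⌝ * 4a (p ℕ.+ N) ≤ ⌜ suc p ⌝ * ε
        scaled = begin
          ⌜ suc p ⌝ * 4a (p ℕ.+ N)       ≈⟨ trans (distribˡ _ _ _) (+-cong (distribˡ _ _ _) (distribˡ _ _ _)) ⟩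
          (v + v) + (v + v)              ≤⟨ +-mono (+-mono (decay p) (decay p)) (+-mono (decay p) (decay p)) ⟩
          4a N                           ≈⟨ *-identityˡ _ ⟨
          1# * 4a N                      ≈⟨ *-congʳ (⁻¹-inverseʳ ε≉0) ⟨
          ε * ε ⁻¹ * 4a N                ≈⟨ *-assoc _ _ _ ⟩
          ε * (ε ⁻¹ * 4a N)              ≤⟨ *-monoˡ 0≤ε (proj₂ (archimedean (ε ⁻¹ * 4a N))) ⟩
          ε * ⌜ p ⌝                      ≤⟨ *-monoˡ 0≤ε (⌜⌝-mono (ℕₚ.n≤1+n p)) ⟩
          ε * ⌜ suc p ⌝                  ≈⟨ *-comm _ _ ⟩
          ⌜ suc p ⌝ * ε                  ∎
          where
          v : ℝ
          v = ⌜ suc p ⌝ * A (p ℕ.+ N)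

      cauchy : Cauchy S
      cauchy ε 0<ε with small ε 0<ε
      ... | p , 4A≤ε = M , λ m n M≤m M≤n → ≤-trans
        (≡.subst₂ (λ m n → S m ≤ S n + (2A M + 2A M)) (ℕₚ.m∸n+n≡m M≤m) (ℕₚ.m∸n+n≡m M≤n)
          (From.close M (ℕₚ.m≤n+m N p) (m ∸ M) (n ∸ M)))
        (+-mono ≤-refl 4A≤ε)
        where
        M : ℕ
        M = p ℕ.+ N

  abstract
    expTerm-cauchy : ∀ x → Cauchy (partialSum (expTerm x))
    expTerm-cauchy x with Convergence.absolute x
    ... | y , 0≤y , x±y = Convergence.Tail.cauchy x y 0≤y x±y

  exp : ℝ → ℝ
  exp x = proj₁ (complete (partialSum (expTerm x)) (expTerm-cauchy x))

  exp-hasSum : ∀ x → HasSum (expTerm x) (exp x)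
  exp-hasSum x = proj₂ (complete (partialSum (expTerm x)) (expTerm-cauchy x))

  -- Pr[Poisson(x) = j]
  poisson : ℝ → ℕ → ℝ
  poisson x j = exp (- x) * expTerm x j

module Probability (R : CompleteOrderedField) where
  open CompleteOrderedField R
  open Exponential R using (poisson)

  -- Closure under countable intersections is listed separately because it
  -- follows from the other closure properties only classically.
  record ProbabilitySpace : Set₂ where
    field
      Ω               : Set
      Measurable      : Pred Ω 0ℓ → Set₁
      measurable-resp : ∀ {A B} → A ≐ B → Measurable A → Measurable B
      measurable-U    : Measurable U
      measurable-∁    : ∀ {A} → Measurable A → Measurable (∁ A)
      measurable-⋃    : ∀ {A : ℕ → Pred Ω 0ℓ} → (∀ i → Measurable (A i)) → Measurable (⋃ ℕ A)
      measurable-⋂    : ∀ {A : ℕ → Pred Ω 0ℓ} → (∀ i → Measurable (A i)) → Measurable (⋂ ℕ A)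
      ℙ               : ∀ {A} → Measurable A → ℝ
      ℙ-cong          : ∀ {A B} (mA : Measurable A) (mB : Measurable B) → A ≐ B → ℙ mA ≈ ℙ mB
      ℙ-nonNeg        : ∀ {A} (mA : Measurable A) → 0# ≤ ℙ mA
      ℙ-U             : ℙ measurable-U ≈ 1#
      ℙ-⋃             : ∀ {A : ℕ → Pred Ω 0ℓ} (mA : ∀ i → Measurable (A i)) →
                        (∀ {i j} → ¬ i ≡ j → A i ⊥′ A j) →
                        HasSum (λ i → ℙ (mA i)) (ℙ (measurable-⋃ mA))

    HasProbability : Pred Ω 0ℓ → ℝ → Set₁
    HasProbability A p = Σ[ mA ∈ Measurable A ] ℙ mA ≈ p

    -- 𝐄 X = μ, for a random variable X with values in ℕ
    HasExpectation : (Ω → ℕ) → ℝ → Set₁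
    HasExpectation X μ =
      Σ[ mX ∈ (∀ j → Measurable (λ ω → X ω ≡ j)) ] HasSum (λ j → ⌜ j ⌝ * ℙ (mX j)) μ

  -- 𝐄_{j ∼ Poisson(x)} f(j) = μ
  HasPoissonExpectation : ℝ → (ℕ → ℕ) → ℝ → Set
  HasPoissonExpectation x f = HasSum (λ j → ⌜ f j ⌝ * poisson x j)

-- The types of balls: the k-element subsets of a set of n bins.
Ball : ℕ → ℕ → Set
Ball n k = Σ[ e ∈ Subset n ] ∣ e ∣ ≡ k

_∋_ : ∀ {n k} → Ball n k → Fin n → Set
e ∋ v = v ∈ proj₁ e

_∋?_ : ∀ {n k} (e : Ball n k) (v : Fin n) → Dec (e ∋ v)
e ∋? v = v ∈? proj₁ e

_≟ᴮ_ : ∀ {n k} (e f : Ball n k) → Dec (proj₁ e ≡ proj₁ f)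
e ≟ᴮ f = ≡-dec _≟ᵇ_ (proj₁ e) (proj₁ f)

-- Every ball type, listed once.
balls : ∀ n k → List (Ball n k)
balls zero    zero    = ([] , ≡.refl) ∷ []
balls zero    (suc k) = []
balls (suc n) zero    = map (λ (e , p) → outside ∷ e , p) (balls n zero)
balls (suc n) (suc k) =
  map (λ (e , p) → inside ∷ e , ≡.cong suc p) (balls n k) ++
  map (λ (e , p) → outside ∷ e , p) (balls n (suc k))

-- The bins and ball types of a sequence of allocations, in order of arrival.
History : ℕ → ℕ → Set
History n k = List (Ball n k × Fin n)

module _ {n k : ℕ} where

  load : Fin n → History n k → ℕ
  load v h = length (filter (λ (_ , u) → u ≟ᶠ v) h)

  -- c ∸ load is max{c − L , 0}.
  remaining : ℕ → Fin n → History n k → ℕ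
  remaining c v h = c ∸ load v h

  remainingIn : ℕ → Ball n k → History n k → ℕ
  remainingIn c e h = sum (map (λ u → remaining c u h) (filter (e ∋?_) (allFin n)))

module BallsIntoBins (R : CompleteOrderedField) (n k : ℕ) where
  open CompleteOrderedField R
  open Exponential R using (poisson)
  open Probability R

  Rates : Set
  Rates = Ball n k → ℝ

  degree : Rates → Fin n → ℝ
  degree rate v = ⌜ k ⌝ ⁻¹ * ∑[ filter (_∋? v) (balls n k) ] rate

  record Arrival : Set where
    field
      time      : ℝ
      ball      : Ball n k
      bin       : Fin n
      bin∈ball  : ball ∋ bin

  open Arrival

  count : Ball n k → ℝ → ℝ → List Arrival → ℕ
  count e s t as =
    length (filter (λ a → (ball a ≟ᴮ e) ×-dec (¬? (time a ≤? s) ×-dec (time a ≤? t))) as)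

  history : List Arrival → History n k
  history = map (λ a → ball a , bin a)

  -- An execution of some allocation rule on the instance with the given rates.
  -- For a ball type e, N_e(t) = count e 0 t is the number of arrivals in (0, t].
  record Process (𝓟 : ProbabilitySpace) (rate : Rates) : Set₁ where
    open ProbabilitySpace 𝓟
    field
      arrivals   : Ω → List Arrival
      horizon    : ∀ ω → All (λ a → (0# < time a) × (time a ≤ 1#)) (arrivals ω)
      sorted     : ∀ ω → SortedBy.Sorted totalOrder (map time (arrivals ω))
      -- The N_e are independent Poisson processes with the given rates: for all
      -- 0 ≤ t₀ ≤ ⋯ ≤ t_m ≤ 1 the increments N_e(tᵢ₊₁) − N_e(tᵢ), over all e and
      -- i, are mutually independent and Poisson(λ_e (tᵢ₊₁ − tᵢ)) distributed.
      increments : ∀ {m} (t : Fin (suc m) → ℝ) →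
        0# ≤ t zero → (∀ i → t (inject₁ i) ≤ t (suc i)) → t (fromℕ m) ≤ 1# →
        (j : Ball n k → Fin m → ℕ) →
        HasProbability
          (λ ω → ∀ e i → count e (t (inject₁ i)) (t (suc i)) (arrivals ω) ≡ j e i)
          (∏[ balls n k ] λ e → product λ i → poisson (rate e * (t (suc i) - t (inject₁ i))) (j e i))
      -- The history is a random element of a countable discrete space.
      measurable : (S : Pred (History n k) 0ℓ) → Measurable (λ ω → S (history (arrivals ω)))

    finalLoad : Fin n → Ω → ℕ
    finalLoad v ω = load v (history (arrivals ω))

    probability : Pred (History n k) 0ℓ → ℝ
    probability S = ℙ (measurable S)

    -- 𝐄 ∑_v f(L_v) ≥ ∑_v g(d_v)
    AmortizedBound : (ℕ → ℕ) → (ℝ → ℝ) → Set₁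
    AmortizedBound f g = Σ[ μ ∈ ℝ ]
      HasExpectation (λ ω → sum (map (λ v → f (finalLoad v ω)) (allFin n))) μ ×
      (∑[ allFin n ] (λ v → g (degree rate v)) ≤ μ)

  -- The allocations made so far are h, and the balls of types es are yet to come.
  Situation : History n k → List (Ball n k) → Pred (History n k) 0ℓ
  Situation h es full = Σ[ rest ∈ History n k ] (full ≡ h ++ rest) × (map proj₁ rest ≡ es)

  -- Given the allocations h so far and the types of all balls from now on, the
  -- arriving ball e goes to v ∈ e with conditional probability
  -- remaining v / ∑_{u ∈ e} remaining u.  Conditioning on the future ball types
  -- es says that the algorithm's random choice is independent of the future.
  -- Clearing denominators makes this vacuous when all bins of e are full, so
  -- that the choice is then arbitrary.
  ProportionalGreedy : ∀ {𝓟 rate} → ℕ → Process 𝓟 rate → Set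
  ProportionalGreedy c process =
    ∀ h e es v → e ∋ v →
      probability (Situation (h ++ (e , v) ∷ []) es) * ⌜ remainingIn c e h ⌝
        ≈ probability (Situation h (e ∷ es)) * ⌜ remaining c v h ⌝
    where open Process process using (probability)

-- Let Λ be the total rate and x = d k, and write r_e for the remaining capacity of
-- the bins of e. With h_τ(j) = 𝐄 min{Poisson(x τ), j} / x, the expectation of
-- ∑_v min{L_v, c} + ∑_e λ_e h_{1-t}(r_e) is nondecreasing in time t: it starts at
-- Λ h₁(c k) and ends at 𝐄 ∑_v min{L_v, c}, and Λ = ∑_v d_v. For the drift, fix a bin v.
-- Among the balls e ∋ v, both 1 / r_e (governing the rate at which e takes capacity
-- from v) and h_τ(r_e) - h_τ(r_e - 1) (the loss in the potential) decrease with r_e,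
-- as h_τ is concave. By Chebyshev's sum inequality it is therefore enough to bound the
-- loss that the balls inflict on themselves, and ∑_{e ∋ v} λ_e ≤ x suffices for that.
--
-- Time is eliminated by expanding in the number N of events, with rates Λ + x, so
-- that the drift becomes a recursion for the coefficients of power series in t.
-- Only a lower bound on the law of the sequence of ball types is needed,
-- ℙ(e₁, …, e_N) ≥ exp(-Λ) λ_{e₁} ⋯ λ_{e_N} / N!, which comes from grids of [0,1]
-- none of whose cells contains two arrivals.
module Submission where

open import Defs
open import Algebra.Bundles using (CommutativeRing)
import Algebra.Properties.CommutativeSemiring.Exp as CommutativeSemiringExp
import Algebra.Properties.CommutativeSemigroup as CommutativeSemigroupProperties
import Algebra.Properties.Ring as RingProperties
import Algebra.Properties.Semiring.Mult as SemiringMult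
import Algebra.Properties.Semiring.Mult.TCOptimised as SemiringMultTCOptimised
import Algebra.Solver.Ring as RingSolver
open import Algebra.Solver.Ring.AlmostCommutativeRing using (fromCommutativeRing; _-Raw-AlmostCommutative⟶_)
open import Data.Bool using (true; false; if_then_else_)
open import Data.Empty using (⊥; ⊥-elim)
open import Data.Integer as ℤ using (ℤ; +_; -[1+_])
import Data.Integer.Properties as ℤₚ
open import Data.Fin using (Fin; zero; suc; toℕ; inject₁; fromℕ)
import Data.Fin.Properties as Finₚ
open import Data.Fin.Subset using (Subset; inside; outside; ∣_∣)
import Data.Fin.Subset.Properties as Subsetₚ
open import Data.List using (List; []; _∷_; _++_; filter; length; map; sum; allFin; drop; cartesianProductWith; downFrom)
import Data.List.Properties as Listₚ
import Data.Product.Properties as Productₚ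
open import Data.List.Membership.Propositional using (_∈_)
open import Data.List.Membership.Propositional.Properties
  using (∈-allFin; ∈-filter⁺; ∈-filter⁻; ∈-map⁺; ∈-map⁻; ∈-++⁺ˡ; ∈-++⁺ʳ; ∈-++⁻; ∈-cartesianProductWith⁻)
open import Data.List.Relation.Unary.All as All using (All; []; _∷_)
open import Data.List.Relation.Unary.AllPairs using (AllPairs; []; _∷_)
import Data.List.Relation.Unary.AllPairs.Properties as AllPairsₚ
import Data.List.Relation.Unary.Sorted.TotalOrder.Properties as Sortedₚ
open import Data.List.Relation.Unary.Any using (here; there)
open import Data.List.Relation.Unary.Unique.Propositional using (Unique)
import Data.List.Relation.Unary.All.Properties as Allₚ
import Data.List.Relation.Unary.Unique.Propositional.Properties as Uniqueₚ
open import Data.Maybe as Maybe using (Maybe; just; nothing)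
open import Data.Nat as ℕ using (ℕ; zero; suc; _∸_; _⊓_; _!)
import Data.Nat.Properties as ℕₚ
open import Data.Unit using (⊤; tt)
open import Data.Vec using (Vec; []; _∷_; lookup)
import Data.Vec.Properties as Vecₚ
open import Data.Product using (∃; ∃-syntax; _×_; _,_; proj₁; proj₂)
open import Data.Sum using (_⊎_; inj₁; inj₂)
open import Function using (_∘_; case_of_)
open import Level using (0ℓ)
open import Relation.Binary.Consequences using (dec⇒weaklyDec)
open import Relation.Binary.PropositionalEquality as ≡ using (_≡_)
import Relation.Binary.Reasoning.PartialOrder as PosetReasoning
import Relation.Binary.Reasoning.Setoid as SetoidReasoning
open import Relation.Nullary using (¬_; Dec; yes; no; does)
open import Relation.Nullary.Decidable as Dec using (_×-dec_; ¬?)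
open import Relation.Unary using (Pred; Decidable; _⊥′_; ⋃)

-- The function h and the constant of the bound come from the instance with k bins and a single ball
-- type of rate x. That type only meets the capacity that it has consumed itself, and the value is
-- exactly 𝐄 min{Poisson(x), ck}. The potential credits each ball type e with the share λ_e / x of
-- what such a stream would still earn from capacity r_e. The drift is used in backward form: from
-- an arbitrary state with remaining time t, conditioned on the first event, so that all states are
-- treated at once. Multiplication by exp((Λ + x)t) removes the negative diagonal terms of both
-- generators. The derivatives then become combinations of known quantities with nonnegative
-- weights, and an inequality between functions of t can be proved between their coefficients of tᴺ,
-- by induction on N and without calculus. A lower bound on the law of the ball types suffices
-- because the value is nonnegative: discarding the outcomes with two arrivals in one cell, or with
-- more arrivals than a cutoff, can only lower the expectation.

-- The ring solver with integer coefficients, which unlike the one whose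
-- coefficients are the elements of an abstract ring itself can cancel terms.
module IntegerCoefficientSolver (R : CommutativeRing 0ℓ 0ℓ) where
  open CommutativeRing R
  open SemiringMultTCOptimised semiring using (×1-homo-*; ×-homo-+; 1+×) renaming (_×_ to _·_)
  open RingProperties ring using (-‿distribˡ-*; -‿distribʳ-*; -‿involutive; -‿+-comm; -0#≈0#)
  open SetoidReasoning setoid
  open CommutativeSemigroupProperties +-commutativeSemigroup using (interchange)

  -- With the optimised multiple, `1 · 1#` reduces to `1#`, so that `con (+ 0)` and `con (+ 1)` in
  -- the calls of the solver stand for `0#` and `1#` definitionally.
  fromℤ : ℤ → Carrier
  fromℤ (+ n)    = n · 1#
  fromℤ -[1+ n ] = - (suc n · 1#)

  fromℤ-⊖ : ∀ m n → fromℤ (m ℤ.⊖ n) ≈ m · 1# - n · 1#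
  fromℤ-⊖ m       zero    = sym (trans (+-congˡ -0#≈0#) (+-identityʳ _))
  fromℤ-⊖ zero    (suc n) = sym (+-identityˡ _)
  fromℤ-⊖ (suc m) (suc n) = begin
    fromℤ (suc m ℤ.⊖ suc n)               ≡⟨ ≡.cong fromℤ (ℤₚ.[1+m]⊖[1+n]≡m⊖n m n) ⟩
    fromℤ (m ℤ.⊖ n)                       ≈⟨ fromℤ-⊖ m n ⟩
    m · 1# - n · 1#                       ≈⟨ +-identityˡ _ ⟨
    0# + (m · 1# - n · 1#)                ≈⟨ +-congʳ (-‿inverseʳ 1#) ⟨
    (1# - 1#) + (m · 1# - n · 1#)         ≈⟨ interchange 1# (- 1#) (m · 1#) (- (n · 1#)) ⟩
    (1# + m · 1#) + (- 1# - n · 1#)       ≈⟨ +-congˡ (-‿+-comm 1# (n · 1#)) ⟩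
    (1# + m · 1#) - (1# + n · 1#)         ≈⟨ +-cong (1+× m 1#) (-‿cong (1+× n 1#)) ⟨
    suc m · 1# - suc n · 1#               ∎

  fromℤ-neg : ∀ i → fromℤ (ℤ.- i) ≈ - fromℤ i
  fromℤ-neg (+ zero)  = sym -0#≈0#
  fromℤ-neg (+ suc n) = refl
  fromℤ-neg -[1+ n ]  = sym (-‿involutive _)

  fromℤ-+ : ∀ i j → fromℤ (i ℤ.+ j) ≈ fromℤ i + fromℤ j
  fromℤ-+ (+ m)    (+ n)    = ×-homo-+ 1# m n
  fromℤ-+ (+ m)    -[1+ n ] = fromℤ-⊖ m (suc n)
  fromℤ-+ -[1+ m ] (+ n)    = trans (fromℤ-⊖ n (suc m)) (+-comm _ _)
  fromℤ-+ -[1+ m ] -[1+ n ] = begin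
    - (suc (suc (m ℕ.+ n)) · 1#)          ≡⟨ ≡.cong (λ k → - (suc k · 1#)) (ℕₚ.+-suc m n) ⟨
    - ((suc m ℕ.+ suc n) · 1#)            ≈⟨ -‿cong (×-homo-+ 1# (suc m) (suc n)) ⟩
    - (suc m · 1# + suc n · 1#)           ≈⟨ -‿+-comm _ _ ⟨
    - (suc m · 1#) - suc n · 1#           ∎

  fromℤ-pos-* : ∀ m n → fromℤ (+ m ℤ.* + n) ≈ m · 1# * n · 1#
  fromℤ-pos-* m n = trans (reflexive (≡.cong fromℤ (≡.sym (ℤₚ.pos-* m n)))) (×1-homo-* m n)

  fromℤ-+* : ∀ m j → fromℤ (+ m ℤ.* j) ≈ m · 1# * fromℤ j
  fromℤ-+* m (+ n)    = fromℤ-pos-* m n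
  fromℤ-+* m -[1+ n ] = begin
    fromℤ (+ m ℤ.* -[1+ n ])              ≡⟨ ≡.cong fromℤ (ℤₚ.neg-distribʳ-* (+ m) (+ suc n)) ⟨
    fromℤ (ℤ.- (+ m ℤ.* + suc n))         ≈⟨ fromℤ-neg (+ m ℤ.* + suc n) ⟩
    - fromℤ (+ m ℤ.* + suc n)             ≈⟨ -‿cong (fromℤ-pos-* m (suc n)) ⟩
    - (m · 1# * suc n · 1#)               ≈⟨ -‿distribʳ-* _ _ ⟩
    m · 1# * - (suc n · 1#)               ∎

  fromℤ-* : ∀ i j → fromℤ (i ℤ.* j) ≈ fromℤ i * fromℤ j
  fromℤ-* (+ m)    j = fromℤ-+* m j
  fromℤ-* -[1+ m ] j = begin
    fromℤ (-[1+ m ] ℤ.* j)                ≡⟨ ≡.cong fromℤ (ℤₚ.neg-distribˡ-* (+ suc m) j) ⟨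
    fromℤ (ℤ.- (+ suc m ℤ.* j))           ≈⟨ fromℤ-neg (+ suc m ℤ.* j) ⟩
    - fromℤ (+ suc m ℤ.* j)               ≈⟨ -‿cong (fromℤ-+* (suc m) j) ⟩
    - (suc m · 1# * fromℤ j)              ≈⟨ -‿distribˡ-* _ _ ⟩
    - (suc m · 1#) * fromℤ j              ∎

  morphism : ℤ.+-*-rawRing -Raw-AlmostCommutative⟶ fromCommutativeRing R
  morphism = record
    { ⟦_⟧ = fromℤ ; +-homo = fromℤ-+ ; *-homo = fromℤ-* ; -‿homo = fromℤ-neg ; 0-homo = refl ; 1-homo = refl }

  decideCoefficients : ∀ i j → Maybe (fromℤ i ≈ fromℤ j)
  decideCoefficients i j = Maybe.map (λ { ≡.refl → refl }) (dec⇒weaklyDec ℤ._≟_ i j)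

  open RingSolver ℤ.+-*-rawRing (fromCommutativeRing R) morphism decideCoefficients public
    using (solve; _:=_; con; _:+_; _:*_; _:-_; :-_)

-- Finite sums and partial sums

module Sums (R : CompleteOrderedField) where
  open CompleteOrderedField R
  open Exponential.Convergence R using (+-mono; *-monoˡ; 0≤1)
  open IntegerCoefficientSolver commutativeRing
  open SemiringMult semiring using (×-homo-+)
  open PosetReasoning poset

  *-monoʳ : ∀ {z x y} → 0# ≤ z → x ≤ y → x * z ≤ y * z
  *-monoʳ 0≤z x≤y = ≤-trans (≤-reflexive (*-comm _ _)) (≤-trans (*-monoˡ 0≤z x≤y) (≤-reflexive (*-comm _ _)))

  +-nonNeg : ∀ {x y} → 0# ≤ x → 0# ≤ y → 0# ≤ x + y
  +-nonNeg 0≤x 0≤y = ≤-trans (≤-reflexive (sym (+-identityˡ 0#))) (+-mono 0≤x 0≤y)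

  +-cancelʳ-≤ : ∀ z {x y} → x + z ≤ y + z → x ≤ y
  +-cancelʳ-≤ z {x} {y} p = begin
    x             ≈⟨ cancel x z ⟨
    x + z - z     ≤⟨ +-monoˡ-≤ (- z) p ⟩
    y + z - z     ≈⟨ cancel y z ⟩
    y             ∎
    where
    cancel : ∀ a b → a + b - b ≈ a
    cancel = solve 2 (λ a b → a :+ b :- b := a) refl

  ^-nonNeg : ∀ {x} → 0# ≤ x → ∀ n → 0# ≤ x ^ n
  ^-nonNeg 0≤x zero    = 0≤1
  ^-nonNeg 0≤x (suc n) = *-nonNeg 0≤x (^-nonNeg 0≤x n)

  ⌜⌝-cong : ∀ {m n} → m ≡ n → ⌜ m ⌝ ≈ ⌜ n ⌝
  ⌜⌝-cong ≡.refl = refl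

  𝟙 : {P : Set} → Dec P → ℝ
  𝟙 d = if does d then 1# else 0#

  𝟙-nonNeg : {P : Set} (d : Dec P) → 0# ≤ 𝟙 d
  𝟙-nonNeg (yes _) = 0≤1
  𝟙-nonNeg (no _)  = ≤-refl

  module _ {A : Set} where

    ∑-cong : ∀ xs {f g : A → ℝ} → (∀ x → f x ≈ g x) → ∑[ xs ] f ≈ ∑[ xs ] g
    ∑-cong []       f≈g = refl
    ∑-cong (x ∷ xs) f≈g = +-cong (f≈g x) (∑-cong xs f≈g)

    ∑-mono-∈ : ∀ xs {f g : A → ℝ} → (∀ {x} → x ∈ xs → f x ≤ g x) → ∑[ xs ] f ≤ ∑[ xs ] g
    ∑-mono-∈ []       f≤g = ≤-refl
    ∑-mono-∈ (x ∷ xs) f≤g = +-mono (f≤g (here ≡.refl)) (∑-mono-∈ xs (f≤g ∘ there))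

    ∑-mono : ∀ xs {f g : A → ℝ} → (∀ x → f x ≤ g x) → ∑[ xs ] f ≤ ∑[ xs ] g
    ∑-mono xs f≤g = ∑-mono-∈ xs λ {x} _ → f≤g x

    ∑-nonNeg : ∀ xs {f : A → ℝ} → (∀ x → 0# ≤ f x) → 0# ≤ ∑[ xs ] f
    ∑-nonNeg []       0≤f = ≤-refl
    ∑-nonNeg (x ∷ xs) 0≤f = +-nonNeg (0≤f x) (∑-nonNeg xs 0≤f)

    ∑-0 : ∀ (xs : List A) → ∑[ xs ] (λ _ → 0#) ≈ 0#
    ∑-0 []       = refl
    ∑-0 (x ∷ xs) = trans (+-identityˡ _) (∑-0 xs)

    ∑-+ : ∀ xs (f g : A → ℝ) → ∑[ xs ] (λ x → f x + g x) ≈ ∑[ xs ] f + ∑[ xs ] g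
    ∑-+ []       f g = sym (+-identityˡ 0#)
    ∑-+ (x ∷ xs) f g = trans (+-congˡ (∑-+ xs f g)) (interchange _ _ _ _)
      where
      interchange : ∀ a b c d → (a + b) + (c + d) ≈ (a + c) + (b + d)
      interchange = solve 4 (λ a b c d → (a :+ b) :+ (c :+ d) := (a :+ c) :+ (b :+ d)) refl

    ∑-*ˡ : ∀ xs a (f : A → ℝ) → ∑[ xs ] (λ x → a * f x) ≈ a * ∑[ xs ] f
    ∑-*ˡ []       a f = sym (zeroʳ a)
    ∑-*ˡ (x ∷ xs) a f = trans (+-congˡ (∑-*ˡ xs a f)) (sym (distribˡ a _ _))

    ∑-*ʳ : ∀ xs a (f : A → ℝ) → ∑[ xs ] (λ x → f x * a) ≈ ∑[ xs ] f * a
    ∑-*ʳ xs a f = trans (∑-cong xs (λ x → *-comm (f x) a)) (trans (∑-*ˡ xs a f) (*-comm a _))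

    ∑-++ : ∀ xs ys (f : A → ℝ) → ∑[ xs ++ ys ] f ≈ ∑[ xs ] f + ∑[ ys ] f
    ∑-++ []       ys f = sym (+-identityˡ _)
    ∑-++ (x ∷ xs) ys f = trans (+-congˡ (∑-++ xs ys f)) (sym (+-assoc _ _ _))

    ∑-filter : {P : Pred A 0ℓ} (P? : Decidable P) → ∀ xs (f : A → ℝ) →
               ∑[ filter P? xs ] f ≈ ∑[ xs ] (λ x → 𝟙 (P? x) * f x)
    ∑-filter P? []       f = refl
    ∑-filter P? (x ∷ xs) f with P? x
    ... | yes _ = +-cong (sym (*-identityˡ (f x))) (∑-filter P? xs f)
    ... | no _  = trans (∑-filter P? xs f) (sym (trans (+-congʳ (zeroˡ (f x))) (+-identityˡ _)))

    ⌜⌝-sum : ∀ xs (f : A → ℕ) → ⌜ sum (map f xs) ⌝ ≈ ∑[ xs ] (λ x → ⌜ f x ⌝)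
    ⌜⌝-sum []       f = refl
    ⌜⌝-sum (x ∷ xs) f = trans (×-homo-+ 1# (f x) (sum (map f xs))) (+-congˡ (⌜⌝-sum xs f))

  ∑-map : {A B : Set} (h : A → B) → ∀ xs (f : B → ℝ) → ∑[ map h xs ] f ≈ ∑[ xs ] (f ∘ h)
  ∑-map h []       f = refl
  ∑-map h (x ∷ xs) f = +-congˡ (∑-map h xs f)

  ∑-swap : {A B : Set} → ∀ xs ys (f : A → B → ℝ) →
           ∑[ xs ] (λ x → ∑[ ys ] (f x)) ≈ ∑[ ys ] (λ y → ∑[ xs ] (λ x → f x y))
  ∑-swap []       ys f = sym (∑-0 ys)
  ∑-swap (x ∷ xs) ys f = trans (+-congˡ (∑-swap xs ys f)) (sym (∑-+ ys (f x) _))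

  partialSum-cong : ∀ {f g} → (∀ i → f i ≈ g i) → ∀ n → partialSum f n ≈ partialSum g n
  partialSum-cong f≈g zero    = refl
  partialSum-cong f≈g (suc n) = +-cong (partialSum-cong f≈g n) (f≈g n)

  partialSum-mono : ∀ {f g} → (∀ i → f i ≤ g i) → ∀ n → partialSum f n ≤ partialSum g n
  partialSum-mono f≤g zero    = ≤-refl
  partialSum-mono f≤g (suc n) = +-mono (partialSum-mono f≤g n) (f≤g n)

  partialSum-nonNeg : ∀ {f} → (∀ i → 0# ≤ f i) → ∀ n → 0# ≤ partialSum f n
  partialSum-nonNeg 0≤f zero    = ≤-refl
  partialSum-nonNeg 0≤f (suc n) = +-nonNeg (partialSum-nonNeg 0≤f n) (0≤f n)

  partialSum-+ : ∀ f g n → partialSum (λ i → f i + g i) n ≈ partialSum f n + partialSum g n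
  partialSum-+ f g zero    = sym (+-identityˡ 0#)
  partialSum-+ f g (suc n) = trans (+-congʳ (partialSum-+ f g n)) (interchange _ _ _ _)
    where
    interchange : ∀ a b c d → (a + b) + (c + d) ≈ (a + c) + (b + d)
    interchange = solve 4 (λ a b c d → (a :+ b) :+ (c :+ d) := (a :+ c) :+ (b :+ d)) refl

  partialSum-*ˡ : ∀ a f n → partialSum (λ i → a * f i) n ≈ a * partialSum f n
  partialSum-*ˡ a f zero    = sym (zeroʳ a)
  partialSum-*ˡ a f (suc n) = trans (+-congʳ (partialSum-*ˡ a f n)) (sym (distribˡ a _ _))

  partialSum-suc : ∀ f n → partialSum f (suc n) ≈ f 0 + partialSum (f ∘ suc) n
  partialSum-suc f zero    = +-comm _ _
  partialSum-suc f (suc n) = trans (+-congʳ (partialSum-suc f n)) (+-assoc _ _ _)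

  partialSum-≤ : ∀ {f} → (∀ i → 0# ≤ f i) → ∀ {m n} → m ℕ.≤ n → partialSum f m ≤ partialSum f n
  partialSum-≤ {f} 0≤f {zero}  {n}     ℕ.z≤n   = partialSum-nonNeg 0≤f n
  partialSum-≤ {f} 0≤f {suc m} {suc n} (ℕ.s≤s m≤n) = begin
    partialSum f (suc m)               ≈⟨ partialSum-suc f m ⟩
    f 0 + partialSum (f ∘ suc) m       ≤⟨ +-mono ≤-refl (partialSum-≤ (0≤f ∘ suc) m≤n) ⟩
    f 0 + partialSum (f ∘ suc) n       ≈⟨ partialSum-suc f n ⟨
    partialSum f (suc n)               ∎

  partialSum-∑ : {A : Set} → ∀ n xs (f : ℕ → A → ℝ) →
                 partialSum (λ i → ∑[ xs ] (f i)) n ≈ ∑[ xs ] (λ x → partialSum (λ i → f i x) n)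
  partialSum-∑ zero    xs f = sym (∑-0 xs)
  partialSum-∑ (suc n) xs f = trans (+-congʳ (partialSum-∑ n xs f)) (sym (∑-+ xs _ (f n)))

-- Limits of real sequences

module Limits (R : CompleteOrderedField) where
  open CompleteOrderedField R
  open Exponential.Convergence R
    using (+-mono; *-monoˡ; 0≤1; 0≤⌜⌝; ⌜⌝≉0; ⁻¹-inverseˡ; 0≤⁻¹; ≤0⇒0≤-; 0≤-⇒≤; ≤⇒0≤-; 1≰0)
  open Sums R
  open IntegerCoefficientSolver commutativeRing
  open PosetReasoning poset

  ≉-sym : ∀ {x y} → ¬ x ≈ y → ¬ y ≈ x
  ≉-sym x≉y y≈x = x≉y (sym y≈x)

  ⁻¹-pos : ∀ {x} → 0# < x → 0# < x ⁻¹
  ⁻¹-pos {x} (0≤x , 0≉x) = 0≤⁻¹ 0≤x (≉-sym 0≉x) , λ 0≈x⁻¹ → 0≉1 (begin-equality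
    0#         ≈⟨ zeroʳ x ⟨
    x * 0#     ≈⟨ *-congˡ 0≈x⁻¹ ⟩
    x * x ⁻¹   ≈⟨ ⁻¹-inverseʳ (≉-sym 0≉x) ⟩
    1#         ∎)

  *-cancelˡ-≤ : ∀ {z x y} → 0# < z → z * x ≤ z * y → x ≤ y
  *-cancelˡ-≤ {z} {x} {y} (0≤z , 0≉z) p = begin
    x                  ≈⟨ cancel x ⟨
    z ⁻¹ * (z * x)     ≤⟨ *-monoˡ (0≤⁻¹ 0≤z (≉-sym 0≉z)) p ⟩
    z ⁻¹ * (z * y)     ≈⟨ cancel y ⟩
    y                  ∎
    where
    cancel : ∀ a → z ⁻¹ * (z * a) ≈ a
    cancel a = trans (sym (*-assoc _ _ _)) (trans (*-congʳ (⁻¹-inverseˡ (≉-sym 0≉z))) (*-identityˡ a))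

  *-pos : ∀ {x y} → 0# < x → 0# < y → 0# < x * y
  *-pos {x} {y} 0<x@(0≤x , _) (0≤y , 0≉y) = *-nonNeg 0≤x 0≤y , λ 0≈xy → 0≉y (≤-antisym 0≤y
    (*-cancelˡ-≤ 0<x (≤-reflexive (trans (sym 0≈xy) (sym (zeroʳ x))))))

  0<⌜suc⌝ : ∀ n → 0# < ⌜ suc n ⌝
  0<⌜suc⌝ n = 0≤⌜⌝ (suc n) , ≉-sym (⌜⌝≉0 (suc n) (ℕ.s≤s ℕ.z≤n))

  half : ℝ → ℝ
  half x = ⌜ 2 ⌝ ⁻¹ * x

  half-pos : ∀ {x} → 0# < x → 0# < half x
  half-pos = *-pos (⁻¹-pos (0<⌜suc⌝ 1))

  half+half : ∀ x → half x + half x ≈ x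
  half+half x = begin-equality
    half x + half x              ≈⟨ double (⌜ 2 ⌝ ⁻¹) x ⟩
    (⌜ 2 ⌝ ⁻¹ * ⌜ 2 ⌝) * x       ≈⟨ *-congʳ (⁻¹-inverseˡ (⌜⌝≉0 2 (ℕ.s≤s ℕ.z≤n))) ⟩
    1# * x                       ≈⟨ *-identityˡ x ⟩
    x                            ∎
    where
    double : ∀ a b → a * b + a * b ≈ (a * ⌜ 2 ⌝) * b
    -- The nested `con`s repeat the way in which `⌜ 2 ⌝` unfolds.
    double a b = solve 3 (λ a b e → a :* b :+ a :* b := (a :* (con (+ 1) :+ (con (+ 1) :+ con (+ 0)))) :* b) refl a b a

  ≰⇒> : ∀ {x y} → ¬ x ≤ y → 0# < x - y
  ≰⇒> {x} {y} x≰y with ≤-total x y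
  ... | inj₁ x≤y = ⊥-elim (x≰y x≤y)
  ... | inj₂ y≤x = ≤⇒0≤- y≤x , λ 0≈x-y → x≰y (≤-reflexive (begin-equality
    x              ≈⟨ minus x y ⟨
    (x - y) + y    ≈⟨ +-congʳ 0≈x-y ⟨
    0# + y         ≈⟨ +-identityˡ y ⟩
    y              ∎))
    where
    minus : ∀ a b → (a - b) + b ≈ a
    minus = solve 2 (λ a b → (a :- b) :+ b := a) refl

  -- As the order is decidable, one may argue by contradiction: otherwise half of the gap `x - y`
  -- would be an admissible ε, and it would bound the whole gap.
  ≤-by-approximation : ∀ {x y} → (∀ ε → 0# < ε → x ≤ y + ε) → x ≤ y
  ≤-by-approximation {x} {y} p with x ≤? y
  ... | yes x≤y = x≤y
  ... | no  x≰y = ⊥-elim (proj₂ (half-pos 0<δ) (≤-antisym (proj₁ (half-pos 0<δ)) (+-cancelʳ-≤ (half δ) (begin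
      half δ + half δ       ≈⟨ half+half δ ⟩
      x - y                 ≤⟨ +-monoˡ-≤ (- y) (p (half δ) (half-pos 0<δ)) ⟩
      (y + half δ) - y      ≈⟨ solve 2 (λ a b → (a :+ b) :- a := b) refl y (half δ) ⟩
      half δ                ≈⟨ +-identityˡ _ ⟨
      0# + half δ           ∎))))
    where
    δ : ℝ
    δ = x - y
    0<δ : 0# < δ
    0<δ = ≰⇒> x≰y

  Converges-cong : ∀ {s t l m} → (∀ n → s n ≈ t n) → l ≈ m → Converges s l → Converges t m
  Converges-cong s≈t l≈m s→l ε 0<ε with s→l ε 0<ε
  ... | N , p = N , λ n N≤n →
    ≤-trans (≤-reflexive (sym (s≈t n))) (≤-trans (proj₁ (p n N≤n)) (≤-reflexive (+-congʳ l≈m))) ,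
    ≤-trans (≤-reflexive (sym l≈m)) (≤-trans (proj₂ (p n N≤n)) (≤-reflexive (+-congʳ (s≈t n))))

  Converges-eventually : ∀ {s l} N → (∀ n → N ℕ.≤ n → s n ≈ l) → Converges s l
  Converges-eventually N p ε (0≤ε , _) = N , λ n N≤n → weaken (≤-reflexive (p n N≤n)) , weaken (≤-reflexive (sym (p n N≤n)))
    where
    weaken : ∀ {x y} → x ≤ y → x ≤ y + ε
    weaken x≤y = ≤-trans (≤-reflexive (sym (+-identityʳ _))) (+-mono x≤y 0≤ε)

  Converges-const : ∀ l → Converges (λ _ → l) l
  Converges-const l = Converges-eventually 0 (λ _ _ → refl)

  Converges-suc : ∀ {s l} → Converges s l → Converges (s ∘ suc) l
  Converges-suc s→l ε 0<ε with s→l ε 0<ε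
  ... | N , p = N , λ n N≤n → p (suc n) (ℕₚ.m≤n⇒m≤1+n N≤n)

  Converges-pred : ∀ {s l} → Converges (s ∘ suc) l → Converges s l
  Converges-pred s→l ε 0<ε with s→l ε 0<ε
  ... | N , p = suc N , λ { (suc m) (ℕ.s≤s N≤m) → p m N≤m }

  limit-≤ : ∀ {s l b} → Converges s l → ∀ N → (∀ n → N ℕ.≤ n → s n ≤ b) → l ≤ b
  limit-≤ s→l N s≤b = ≤-by-approximation λ ε 0<ε → let (M , p) = s→l ε 0<ε in
    ≤-trans (proj₂ (p (N ℕ.⊔ M) (ℕₚ.m≤n⊔m N M))) (+-monoˡ-≤ ε (s≤b _ (ℕₚ.m≤m⊔n N M)))

  ≤-limit : ∀ {s l b} → Converges s l → ∀ N → (∀ n → N ℕ.≤ n → b ≤ s n) → b ≤ l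
  ≤-limit s→l N b≤s = ≤-by-approximation λ ε 0<ε → let (M , p) = s→l ε 0<ε in
    ≤-trans (b≤s _ (ℕₚ.m≤m⊔n N M)) (proj₁ (p (N ℕ.⊔ M) (ℕₚ.m≤n⊔m N M)))

  Converges-+ : ∀ {s t l m} → Converges s l → Converges t m → Converges (λ n → s n + t n) (l + m)
  Converges-+ s→l t→m ε 0<ε with s→l (half ε) (half-pos 0<ε) | t→m (half ε) (half-pos 0<ε)
  ... | M , p | N , q = M ℕ.⊔ N , λ n M⊔N≤n → let
      (p₁ , p₂) = p n (ℕₚ.≤-trans (ℕₚ.m≤m⊔n M N) M⊔N≤n)
      (q₁ , q₂) = q n (ℕₚ.≤-trans (ℕₚ.m≤n⊔m M N) M⊔N≤n)
    in add p₁ q₁ , add p₂ q₂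
    where
    add : ∀ {a b c d} → a ≤ c + half ε → b ≤ d + half ε → a + b ≤ (c + d) + ε
    add {a} {b} {c} {d} p q = begin
      a + b                              ≤⟨ +-mono p q ⟩
      (c + half ε) + (d + half ε)        ≈⟨ solve 3 (λ c d e → (c :+ e) :+ (d :+ e) := (c :+ d) :+ (e :+ e)) refl c d (half ε) ⟩
      (c + d) + (half ε + half ε)        ≈⟨ +-congˡ (half+half ε) ⟩
      (c + d) + ε                        ∎

  Converges-neg : ∀ {s l} → Converges s l → Converges (λ n → - s n) (- l)
  Converges-neg s→l ε 0<ε with s→l ε 0<ε
  ... | N , p = N , λ n N≤n → flip (proj₂ (p n N≤n)) , flip (proj₁ (p n N≤n))
    where
    flip : ∀ {a b} → a ≤ b + ε → - b ≤ - a + ε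
    flip {a} {b} a≤b+ε = begin
      - b                     ≈⟨ solve 2 (λ a b → :- b := a :+ (:- a :- b)) refl a b ⟩
      a + (- a - b)           ≤⟨ +-monoˡ-≤ _ a≤b+ε ⟩
      (b + ε) + (- a - b)     ≈⟨ solve 3 (λ a b e → (b :+ e) :+ (:- a :- b) := :- a :+ e) refl a b ε ⟩
      - a + ε                 ∎

  Converges-*ˡ⁺ : ∀ {s l c} → 0# ≤ c → Converges s l → Converges (λ n → c * s n) (c * l)
  Converges-*ˡ⁺ {c = c} 0≤c s→l ε 0<ε =
    let (N , p) = s→l (k ⁻¹ * ε) (*-pos (⁻¹-pos (0<⌜suc⌝ K)) 0<ε)
    in N , λ n N≤n → scale (proj₁ (p n N≤n)) , scale (proj₂ (p n N≤n))
    where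
    -- The factor `c` may be 0, so ε is divided by a positive integer that is at least `c`.
    K : ℕ
    K = proj₁ (archimedean c)
    k : ℝ
    k = ⌜ suc K ⌝
    scale : ∀ {a b} → a ≤ b + k ⁻¹ * ε → c * a ≤ c * b + ε
    scale {a} {b} p = begin
      c * a                      ≤⟨ *-monoˡ 0≤c p ⟩
      c * (b + k ⁻¹ * ε)         ≈⟨ distribˡ c b _ ⟩
      c * b + c * (k ⁻¹ * ε)     ≤⟨ +-mono ≤-refl (*-monoʳ (*-nonNeg (0≤⁻¹ (0≤⌜⌝ (suc K)) (⌜⌝≉0 (suc K) (ℕ.s≤s ℕ.z≤n))) (proj₁ 0<ε)) c≤k) ⟩
      c * b + k * (k ⁻¹ * ε)     ≈⟨ +-congˡ (trans (sym (*-assoc _ _ _)) (trans (*-congʳ (⁻¹-inverseʳ (⌜⌝≉0 (suc K) (ℕ.s≤s ℕ.z≤n)))) (*-identityˡ ε))) ⟩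
      c * b + ε                  ∎
      where
      c≤k : c ≤ k
      c≤k = ≤-trans (proj₂ (archimedean c)) (≤-trans (≤-reflexive (sym (+-identityˡ _))) (+-monoˡ-≤ ⌜ K ⌝ 0≤1))

  Converges-*ˡ : ∀ {s l} c → Converges s l → Converges (λ n → c * s n) (c * l)
  Converges-*ˡ {s} {l} c s→l with ≤-total 0# c
  ... | inj₁ 0≤c = Converges-*ˡ⁺ 0≤c s→l
  ... | inj₂ c≤0 = Converges-cong (λ n → negate c (s n)) (negate c l) (Converges-neg (Converges-*ˡ⁺ (≤0⇒0≤- c≤0) s→l))
    where
    negate : ∀ a b → - (- a * b) ≈ a * b
    negate = solve 2 (λ a b → :- (:- a :* b) := a :* b) refl

  limit-unique : ∀ {s l m} → Converges s l → Converges s m → l ≈ m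
  limit-unique s→l s→m = ≤-antisym (below s→l s→m) (below s→m s→l)
    where
    below : ∀ {s l m} → Converges s l → Converges s m → l ≤ m
    -- The sequence `s n - s n`, which is constantly 0, converges to `m - l`.
    below {s} {l} {m} s→l s→m = 0≤-⇒≤ (≤-limit
      (Converges-cong (λ n → -‿inverseʳ (s n)) refl (Converges-+ s→m (Converges-neg s→l))) 0 (λ _ _ → ≤-refl))

  partialSum-≤-sum : ∀ {f l} → (∀ i → 0# ≤ f i) → HasSum f l → ∀ n → partialSum f n ≤ l
  partialSum-≤-sum 0≤f f→l n = ≤-limit f→l n (λ m → partialSum-≤ 0≤f)

  -- A positive gap δ = x - y would satisfy (n + 1) δ ≤ z ≤ n δ for some n ≥ z / δ. This lets an
  -- inequality with an error of order 1/n, as obtained from a grid, become exact.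
  ≤-by-archimedes : ∀ {x y} z → (∀ n → ⌜ suc n ⌝ * (x - y) ≤ z) → x ≤ y
  ≤-by-archimedes {x} {y} z p with x ≤? y
  ... | yes x≤y = x≤y
  ... | no  x≰y = ⊥-elim (1≰0 (+-cancelʳ-≤ ⌜ n ⌝ (begin
      ⌜ suc n ⌝                          ≤⟨ *-cancelˡ-≤ 0<δ bound ⟩
      ⌜ n ⌝                              ≈⟨ +-identityˡ _ ⟨
      0# + ⌜ n ⌝                         ∎)))
    where
    δ : ℝ
    δ = x - y
    0<δ : 0# < δ
    0<δ = ≰⇒> x≰y
    n : ℕ
    n = proj₁ (archimedean (δ ⁻¹ * z))
    bound : δ * ⌜ suc n ⌝ ≤ δ * ⌜ n ⌝
    bound = begin
      δ * ⌜ suc n ⌝           ≈⟨ *-comm _ _ ⟩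
      ⌜ suc n ⌝ * δ           ≤⟨ p n ⟩
      z                       ≈⟨ *-identityˡ z ⟨
      1# * z                  ≈⟨ *-congʳ (⁻¹-inverseʳ (≉-sym (proj₂ 0<δ))) ⟨
      δ * δ ⁻¹ * z            ≈⟨ *-assoc _ _ _ ⟩
      δ * (δ ⁻¹ * z)          ≤⟨ *-monoˡ (proj₁ 0<δ) (proj₂ (archimedean (δ ⁻¹ * z))) ⟩
      δ * ⌜ n ⌝               ∎

-- Cauchy products of power series

module Convolution (R : CompleteOrderedField) where
  open CompleteOrderedField R
  open Exponential.Convergence R using (+-mono; *-monoˡ; ≤⇒0≤-; Bounded; bounded-*; bounded-≈)
  open SemiringMult semiring using (×-homo-+)
  open Sums R
  open IntegerCoefficientSolver commutativeRing
  open PosetReasoning poset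

  -- The Cauchy product, with terms of `a` peeled off from the front to avoid the index n - i.
  -- Inductions over it must therefore admit shifts of `a`.
  conv : (ℕ → ℝ) → (ℕ → ℝ) → ℕ → ℝ
  conv a b zero    = a 0 * b 0
  conv a b (suc n) = a 0 * b (suc n) + conv (a ∘ suc) b n

  conv-cong : ∀ {a a′ b b′} → (∀ i → a i ≈ a′ i) → (∀ i → b i ≈ b′ i) → ∀ n → conv a b n ≈ conv a′ b′ n
  conv-cong p q zero    = *-cong (p 0) (q 0)
  conv-cong p q (suc n) = +-cong (*-cong (p 0) (q (suc n))) (conv-cong (p ∘ suc) q n)

  conv-monoʳ : ∀ {a b b′} → (∀ i → 0# ≤ a i) → (∀ i → b i ≤ b′ i) → ∀ n → conv a b n ≤ conv a b′ n
  conv-monoʳ 0≤a p zero    = *-monoˡ (0≤a 0) (p 0)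
  conv-monoʳ 0≤a p (suc n) = +-mono (*-monoˡ (0≤a 0) (p (suc n))) (conv-monoʳ (0≤a ∘ suc) p n)

  conv-nonNeg : ∀ {a b} → (∀ i → 0# ≤ a i) → (∀ i → 0# ≤ b i) → ∀ n → 0# ≤ conv a b n
  conv-nonNeg 0≤a 0≤b zero    = *-nonNeg (0≤a 0) (0≤b 0)
  conv-nonNeg 0≤a 0≤b (suc n) = +-nonNeg (*-nonNeg (0≤a 0) (0≤b (suc n))) (conv-nonNeg (0≤a ∘ suc) 0≤b n)

  conv-0ʳ : ∀ a n → conv a (λ _ → 0#) n ≈ 0#
  conv-0ʳ a zero    = zeroʳ _
  conv-0ʳ a (suc n) = trans (+-cong (zeroʳ _) (conv-0ʳ (a ∘ suc) n)) (+-identityˡ 0#)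

  conv-+ʳ : ∀ a b c n → conv a (λ i → b i + c i) n ≈ conv a b n + conv a c n
  conv-+ʳ a b c zero    = distribˡ _ _ _
  conv-+ʳ a b c (suc n) = trans (+-cong (distribˡ _ _ _) (conv-+ʳ (a ∘ suc) b c n))
    (solve 4 (λ x y z w → (x :+ y) :+ (z :+ w) := (x :+ z) :+ (y :+ w)) refl _ _ _ _)

  conv-*ʳ : ∀ r a b n → conv a (λ i → r * b i) n ≈ r * conv a b n
  conv-*ʳ r a b zero    = solve 3 (λ r x y → x :* (r :* y) := r :* (x :* y)) refl r (a 0) (b 0)
  conv-*ʳ r a b (suc n) = trans (+-congˡ (conv-*ʳ r (a ∘ suc) b n))
    (solve 4 (λ r x y z → x :* (r :* y) :+ r :* z := r :* (x :* y :+ z)) refl r (a 0) (b (suc n)) _)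

  conv-*ˡ : ∀ r a b n → conv (λ i → r * a i) b n ≈ r * conv a b n
  conv-*ˡ r a b zero    = *-assoc r _ _
  conv-*ˡ r a b (suc n) = trans (+-cong (*-assoc r _ _) (conv-*ˡ r (a ∘ suc) b n)) (sym (distribˡ r _ _))

  conv-∑ʳ : {A : Set} → ∀ a xs (b : A → ℕ → ℝ) n →
            conv a (λ i → ∑[ xs ] (λ x → b x i)) n ≈ ∑[ xs ] (λ x → conv a (b x) n)
  conv-∑ʳ a []       b n = conv-0ʳ a n
  conv-∑ʳ a (x ∷ xs) b n = trans (conv-+ʳ a (b x) _ n) (+-congˡ (conv-∑ʳ a xs b n))

  conv-shiftʳ : ∀ a b n → b 0 ≈ 0# → conv a b (suc n) ≈ conv a (b ∘ suc) n
  conv-shiftʳ a b zero    b₀≈0 = trans (+-congˡ (trans (*-congˡ b₀≈0) (zeroʳ _))) (+-identityʳ _)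
  conv-shiftʳ a b (suc n) b₀≈0 = +-congˡ (conv-shiftʳ (a ∘ suc) b n b₀≈0)

  -- The weight of a product aᵢ bⱼ is split as (m + i) + j. The offset `m` counts how often `a` has
  -- been shifted by the recursion.
  conv-weight : ∀ m a b n →
    ⌜ m ℕ.+ n ⌝ * conv a b n ≈ conv (λ i → ⌜ m ℕ.+ i ⌝ * a i) b n + conv a (λ i → ⌜ i ⌝ * b i) n
  conv-weight m a b zero = solve 3 (λ k x y → k :* (x :* y) := (k :* x) :* y :+ x :* (con (+ 0) :* y)) refl _ (a 0) (b 0)
  conv-weight m a b (suc n) = begin-equality
    ⌜ m ℕ.+ suc n ⌝ * (a 0 * b (suc n) + conv (a ∘ suc) b n)
      ≈⟨ distribˡ _ _ _ ⟩
    ⌜ m ℕ.+ suc n ⌝ * (a 0 * b (suc n)) + ⌜ m ℕ.+ suc n ⌝ * conv (a ∘ suc) b n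
      ≈⟨ +-cong (*-congʳ (×-homo-+ 1# m (suc n))) (*-congʳ (⌜⌝-cong (ℕₚ.+-suc m n))) ⟩
    (⌜ m ⌝ + ⌜ suc n ⌝) * (a 0 * b (suc n)) + ⌜ suc m ℕ.+ n ⌝ * conv (a ∘ suc) b n
      ≈⟨ +-congˡ (conv-weight (suc m) (a ∘ suc) b n) ⟩
    (⌜ m ⌝ + ⌜ suc n ⌝) * (a 0 * b (suc n)) + (conv (λ i → ⌜ suc m ℕ.+ i ⌝ * a (suc i)) b n + y)
      ≈⟨ +-congˡ (+-congʳ (conv-cong (λ i → *-congʳ (⌜⌝-cong (≡.sym (ℕₚ.+-suc m i)))) (λ _ → refl) n)) ⟩
    (⌜ m ⌝ + ⌜ suc n ⌝) * (a 0 * b (suc n)) + (x + y)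
      ≈⟨ solve 6 (λ k l p q x y → (k :+ l) :* (p :* q) :+ (x :+ y) := ((k :* p) :* q :+ x) :+ (p :* (l :* q) :+ y)) refl ⌜ m ⌝ ⌜ suc n ⌝ (a 0) (b (suc n)) x y ⟩
    ((⌜ m ⌝ * a 0) * b (suc n) + x) + (a 0 * (⌜ suc n ⌝ * b (suc n)) + y)
      ≈⟨ +-congʳ (+-congʳ (*-congʳ (*-congʳ (⌜⌝-cong (ℕₚ.+-identityʳ m))))) ⟨
    ((⌜ m ℕ.+ 0 ⌝ * a 0) * b (suc n) + x) + (a 0 * (⌜ suc n ⌝ * b (suc n)) + y)
      ∎
    where
    x y : ℝ
    x = conv (λ i → ⌜ m ℕ.+ suc i ⌝ * a (suc i)) b n
    y = conv (a ∘ suc) (λ i → ⌜ i ⌝ * b i) n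

  -- The coefficients of the derivative of the power series ∑ aᵢ tⁱ.
  derivative : (ℕ → ℝ) → ℕ → ℝ
  derivative a i = ⌜ suc i ⌝ * a (suc i)

  leibniz : ∀ a b n → derivative (conv a b) n ≈ conv (derivative a) b n + conv a (derivative b) n
  leibniz a b n = begin-equality
    ⌜ suc n ⌝ * conv a b (suc n)
      ≈⟨ conv-weight 0 a b (suc n) ⟩
    ((0# * a 0) * b (suc n) + conv (derivative a) b n) + conv a (λ i → ⌜ i ⌝ * b i) (suc n)
      ≈⟨ +-cong (+-congʳ (trans (*-congʳ (zeroˡ _)) (zeroˡ _))) (conv-shiftʳ a _ n (zeroˡ _)) ⟩
    (0# + conv (derivative a) b n) + conv a (derivative b) n
      ≈⟨ +-congʳ (+-identityˡ _) ⟩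
    conv (derivative a) b n + conv a (derivative b) n
      ∎

  partialSum-conv-suc : ∀ a b n →
    partialSum (conv a b) (suc n) ≈ a 0 * partialSum b (suc n) + partialSum (conv (a ∘ suc) b) n
  partialSum-conv-suc a b zero    = solve 2 (λ x y → con (+ 0) :+ x :* y := x :* (con (+ 0) :+ y) :+ con (+ 0)) refl (a 0) (b 0)
  partialSum-conv-suc a b (suc n) = trans (+-congʳ (partialSum-conv-suc a b n))
    (solve 5 (λ x s c y d → (x :* s :+ c) :+ (x :* y :+ d) := x :* (s :+ y) :+ (c :+ d)) refl
      (a 0) (partialSum b (suc n)) (partialSum (conv (a ∘ suc) b) n) (b (suc n)) (conv (a ∘ suc) b n))

  partialSum-*-suc : ∀ a s m → partialSum a (suc m) * s ≈ a 0 * s + partialSum (a ∘ suc) m * s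
  partialSum-*-suc a s m = trans (*-congʳ (partialSum-suc a m)) (distribʳ s _ _)

  -- The index triangle i + j < m lies in the rectangle i < m, j < n.
  partialSum-conv-≤ : ∀ {a b} → (∀ i → 0# ≤ a i) → (∀ i → 0# ≤ b i) → ∀ {m n} → m ℕ.≤ n →
                      partialSum (conv a b) m ≤ partialSum a m * partialSum b n
  partialSum-conv-≤ 0≤a 0≤b {zero} _ = ≤-reflexive (sym (zeroˡ _))
  partialSum-conv-≤ {a} {b} 0≤a 0≤b {suc m} {n} m<n = begin
    partialSum (conv a b) (suc m)                                        ≈⟨ partialSum-conv-suc a b m ⟩
    a 0 * partialSum b (suc m) + partialSum (conv (a ∘ suc) b) m         ≤⟨ +-mono (*-monoˡ (0≤a 0) (partialSum-≤ 0≤b m<n)) (partialSum-conv-≤ (0≤a ∘ suc) 0≤b (ℕₚ.<⇒≤ m<n)) ⟩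
    a 0 * partialSum b n + partialSum (a ∘ suc) m * partialSum b n       ≈⟨ partialSum-*-suc a _ m ⟨
    partialSum a (suc m) * partialSum b n                                ∎

  -- The rectangle i < m, j < n lies in the index triangle i + j < m + n.
  ≤-partialSum-conv : ∀ {a b} → (∀ i → 0# ≤ a i) → (∀ i → 0# ≤ b i) → ∀ m n →
                      partialSum a m * partialSum b n ≤ partialSum (conv a b) (m ℕ.+ n)
  ≤-partialSum-conv 0≤a 0≤b zero n = ≤-trans (≤-reflexive (zeroˡ _)) (partialSum-nonNeg (conv-nonNeg 0≤a 0≤b) n)
  ≤-partialSum-conv {a} {b} 0≤a 0≤b (suc m) n = begin
    partialSum a (suc m) * partialSum b n                                             ≈⟨ partialSum-*-suc a _ m ⟩
    a 0 * partialSum b n + partialSum (a ∘ suc) m * partialSum b n                    ≤⟨ +-mono (*-monoˡ (0≤a 0) (partialSum-≤ 0≤b (ℕₚ.m≤n+m n (suc m)))) (≤-partialSum-conv (0≤a ∘ suc) 0≤b m n) ⟩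
    a 0 * partialSum b (suc m ℕ.+ n) + partialSum (conv (a ∘ suc) b) (m ℕ.+ n)        ≈⟨ partialSum-conv-suc a b (m ℕ.+ n) ⟨
    partialSum (conv a b) (suc m ℕ.+ n)                                               ∎

  Dominated : (ℕ → ℝ) → (ℕ → ℝ) → Set
  Dominated a A = ∀ i → Bounded (a i) (A i)

  bounded-+ : ∀ {x y a b} → Bounded x y → Bounded a b → Bounded (x + a) (y + b)
  bounded-+ {x} {a = a} (p , p⁻) (q , q⁻) = +-mono p q ,
    ≤-trans (≤-reflexive (solve 2 (λ x a → :- (x :+ a) := :- x :+ :- a) refl x a)) (+-mono p⁻ q⁻)

  partialSum-bounded : ∀ {a A} → Dominated a A → ∀ n → Bounded (partialSum a n) (partialSum A n)
  partialSum-bounded p zero    = ≤-refl , ≤-reflexive (solve 0 (:- con (+ 0) := con (+ 0)) refl)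
  partialSum-bounded p (suc n) = bounded-+ (partialSum-bounded p n) (p n)

  tail-bounded : ∀ {a A} → Dominated a A → ∀ {m n} → m ℕ.≤ n →
                 Bounded (partialSum a n - partialSum a m) (partialSum A n - partialSum A m)
  tail-bounded p {n = n} ℕ.z≤n = bounded-≈ minus-0 minus-0 (partialSum-bounded p n)
    where
    minus-0 : ∀ {x} → x - 0# ≈ x
    minus-0 {x} = solve 1 (λ x → x :- con (+ 0) := x) refl x
  tail-bounded {a} {A} p {suc m} {suc n} (ℕ.s≤s m≤n) =
    bounded-≈ (drop-first a) (drop-first A) (tail-bounded (p ∘ suc) m≤n)
    where
    drop-first : ∀ b → partialSum b (suc n) - partialSum b (suc m) ≈ partialSum (b ∘ suc) n - partialSum (b ∘ suc) m
    drop-first b = trans (+-cong (partialSum-suc b n) (-‿cong (partialSum-suc b m)))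
      (solve 3 (λ x y z → (x :+ y) :- (x :+ z) := y :- z) refl (b 0) _ _)

  -- The products aᵢ bⱼ with i < m and j < n that are missing from the first m
  -- terms of the convolution.
  excess : (ℕ → ℝ) → (ℕ → ℝ) → ℕ → ℕ → ℝ
  excess a b m n = partialSum a m * partialSum b n - partialSum (conv a b) m

  excess-suc : ∀ a b m n →
    excess a b (suc m) n ≈ a 0 * (partialSum b n - partialSum b (suc m)) + excess (a ∘ suc) b m n
  excess-suc a b m n = trans (+-cong (partialSum-*-suc a _ m) (-‿cong (partialSum-conv-suc a b m)))
    (solve 5 (λ x s u t c → (x :* s :+ u) :- (x :* t :+ c) := x :* (s :- t) :+ (u :- c)) refl
      (a 0) (partialSum b n) (partialSum (a ∘ suc) m * partialSum b n) (partialSum b (suc m)) _)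

  -- For m ≤ n the excess consists of the products aᵢ bⱼ with i < m and m - i ≤ j < n, each with
  -- coefficient 1, so the triangle inequality applies. Row by row, a 0 is multiplied by a segment
  -- of the series of `b`.
  excess-bounded : ∀ {a A b B} → (∀ i → 0# ≤ B i) → Dominated a A → Dominated b B →
                   ∀ {m n} → m ℕ.≤ n → Bounded (excess a b m n) (excess A B m n)
  excess-bounded {a} {A} {b} {B} 0≤B p q {zero} {n} _ =
    bounded-≈ (vanish (partialSum b n)) (vanish (partialSum B n)) (partialSum-bounded p 0)
    where
    vanish : ∀ s → 0# * s - 0# ≈ 0#
    vanish = solve 1 (λ s → con (+ 0) :* s :- con (+ 0) := con (+ 0)) refl
  excess-bounded {a} {A} {b} {B} 0≤B p q {suc m} {n} m<n =
    bounded-≈ (excess-suc a b m n) (excess-suc A B m n)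
      (bounded-+ (bounded-* (≤⇒0≤- (partialSum-≤ 0≤B m<n)) (p 0) (tail-bounded q m<n))
                 (excess-bounded 0≤B (p ∘ suc) q (ℕₚ.<⇒≤ m<n)))

-- The exponential function

module ExponentialProperties (R : CompleteOrderedField) where
  open CompleteOrderedField R
  open Exponential R
  open Exponential.Convergence R
    using (*-mono; ≤0⇒0≤-; 0≤-⇒≤; ≤⇒0≤-; ⌜⌝≉0; ⁻¹-unique; Bounded; bounded-≈;
           absolute; expTerm-suc; 0≤expTerm; bounded-expTerm)
  open Sums R
  open Limits R
  open Convolution R
  open IntegerCoefficientSolver commutativeRing
  open PosetReasoning poset

  ^-cong : ∀ {x y} → x ≈ y → ∀ n → x ^ n ≈ y ^ n
  ^-cong x≈y zero    = refl
  ^-cong x≈y (suc n) = *-cong x≈y (^-cong x≈y n)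

  expTerm-cong : ∀ {x y} → x ≈ y → ∀ j → expTerm x j ≈ expTerm y j
  expTerm-cong x≈y j = *-congʳ (^-cong x≈y j)

  exp-cong : ∀ {x y} → x ≈ y → exp x ≈ exp y
  exp-cong {x} {y} x≈y = limit-unique
    (Converges-cong (partialSum-cong (expTerm-cong x≈y)) refl (exp-hasSum x)) (exp-hasSum y)

  poisson-cong : ∀ {x y} → x ≈ y → ∀ j → poisson x j ≈ poisson y j
  poisson-cong x≈y j = *-cong (exp-cong (-‿cong x≈y)) (expTerm-cong x≈y j)

  ⌜1⌝⁻¹≈1 : ⌜ 1 ⌝ ⁻¹ ≈ 1#
  ⌜1⌝⁻¹≈1 = ⁻¹-unique (⌜⌝≉0 1 (ℕ.s≤s ℕ.z≤n)) (trans (*-identityʳ _) (+-identityʳ 1#))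

  expTerm-0 : ∀ x → expTerm x 0 ≈ 1#
  expTerm-0 x = trans (*-identityˡ _) ⌜1⌝⁻¹≈1

  expTerm-1 : ∀ x → expTerm x 1 ≈ x
  expTerm-1 x = trans (*-cong (*-identityʳ x) ⌜1⌝⁻¹≈1) (*-identityʳ x)

  ⌜suc⌝-cancel : ∀ n a → ⌜ suc n ⌝ * (⌜ suc n ⌝ ⁻¹ * a) ≈ a
  ⌜suc⌝-cancel n a = trans (sym (*-assoc _ _ _)) (trans (*-congʳ (⁻¹-inverseʳ (⌜⌝≉0 (suc n) (ℕ.s≤s ℕ.z≤n)))) (*-identityˡ a))

  *-cancel-⌜suc⌝ : ∀ n {a b} → ⌜ suc n ⌝ * a ≈ ⌜ suc n ⌝ * b → a ≈ b
  *-cancel-⌜suc⌝ n p = ≤-antisym (*-cancelˡ-≤ (0<⌜suc⌝ n) (≤-reflexive p)) (*-cancelˡ-≤ (0<⌜suc⌝ n) (≤-reflexive (sym p)))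

  derivative-expTerm : ∀ x j → derivative (expTerm x) j ≈ x * expTerm x j
  derivative-expTerm x j = begin-equality
    ⌜ suc j ⌝ * expTerm x (suc j)                         ≈⟨ *-congˡ (expTerm-suc x j) ⟩
    ⌜ suc j ⌝ * (x * ⌜ suc j ⌝ ⁻¹ * expTerm x j)          ≈⟨ *-congˡ (solve 3 (λ x k t → x :* k :* t := k :* (x :* t)) refl _ _ _) ⟩
    ⌜ suc j ⌝ * (⌜ suc j ⌝ ⁻¹ * (x * expTerm x j))        ≈⟨ ⌜suc⌝-cancel j _ ⟩
    x * expTerm x j                                       ∎

  -- Both sides solve the recursion (n + 1) c(n + 1) = (x + y) c(n) with c(0) = 1, the right side by
  -- the product rule. This replaces the binomial theorem.
  expTerm-+ : ∀ x y n → expTerm (x + y) n ≈ conv (expTerm x) (expTerm y) n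
  expTerm-+ x y zero = trans (expTerm-0 (x + y)) (sym (trans (*-cong (expTerm-0 x) (expTerm-0 y)) (*-identityˡ 1#)))
  expTerm-+ x y (suc n) = *-cancel-⌜suc⌝ n (begin-equality
    derivative (expTerm (x + y)) n                          ≈⟨ derivative-expTerm (x + y) n ⟩
    (x + y) * expTerm (x + y) n                             ≈⟨ *-congˡ (expTerm-+ x y n) ⟩
    (x + y) * conv (expTerm x) (expTerm y) n                ≈⟨ distribʳ _ _ _ ⟩
    x * conv (expTerm x) (expTerm y) n + y * conv (expTerm x) (expTerm y) n
      ≈⟨ +-cong (conv-*ˡ x _ _ n) (conv-*ʳ y _ _ n) ⟨
    conv (λ i → x * expTerm x i) (expTerm y) n + conv (expTerm x) (λ i → y * expTerm y i) n
      ≈⟨ +-cong (conv-cong (derivative-expTerm x) (λ _ → refl) n) (conv-cong (λ _ → refl) (derivative-expTerm y) n) ⟨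
    conv (derivative (expTerm x)) (expTerm y) n + conv (expTerm x) (derivative (expTerm y)) n
      ≈⟨ leibniz (expTerm x) (expTerm y) n ⟨
    derivative (conv (expTerm x) (expTerm y)) n             ∎)

  conv-hasSum : ∀ x y → HasSum (conv (expTerm x) (expTerm y)) (exp (x + y))
  conv-hasSum x y = Converges-cong (partialSum-cong (expTerm-+ x y)) refl (exp-hasSum (x + y))

  -- For nonnegative terms, the triangle and rectangle comparisons of partial sums enclose the limit
  -- from both sides.
  exp-+-nonNeg : ∀ {x y} → 0# ≤ x → 0# ≤ y → exp (x + y) ≈ exp x * exp y
  exp-+-nonNeg {x} {y} 0≤x 0≤y = ≤-antisym
    (limit-≤ (conv-hasSum x y) 0 λ m _ → ≤-trans (partialSum-conv-≤ (0≤expTerm 0≤x) (0≤expTerm 0≤y) (ℕₚ.≤-refl {m}))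
      (*-mono (partialSum-nonNeg (0≤expTerm 0≤x) m) (partialSum-≤-sum (0≤expTerm 0≤x) (exp-hasSum x) m)
        (partialSum-≤-sum (0≤expTerm 0≤y) (exp-hasSum y) m)
        (≤-trans (partialSum-nonNeg (0≤expTerm 0≤y) m) (partialSum-≤-sum (0≤expTerm 0≤y) (exp-hasSum y) m))))
    (≤-trans (≤-reflexive (*-comm _ _)) (limit-≤ (Converges-*ˡ (exp y) (exp-hasSum x)) 0 λ m _ →
      ≤-trans (≤-reflexive (*-comm _ _)) (limit-≤ (Converges-*ˡ _ (exp-hasSum y)) 0 λ n _ →
        ≤-trans (≤-partialSum-conv (0≤expTerm 0≤x) (0≤expTerm 0≤y) m n)
          (partialSum-≤-sum (conv-nonNeg (0≤expTerm 0≤x) (0≤expTerm 0≤y)) (conv-hasSum x y) (m ℕ.+ n)))))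

  -- Applied twice in `exp-+`, it takes the double limit one index at a time: first n with m fixed,
  -- where m ≤ n holds eventually, then m.
  bounded-limit : ∀ {s t l m} → Converges s l → Converges t m →
                  ∀ N → (∀ n → N ℕ.≤ n → Bounded (s n) (t n)) → Bounded l m
  bounded-limit s→l t→m N p =
    0≤-⇒≤ (≤-limit (Converges-+ t→m (Converges-neg s→l)) N λ n N≤n → ≤⇒0≤- (proj₁ (p n N≤n))) ,
    0≤-⇒≤ (≤-limit (Converges-+ t→m (Converges-neg (Converges-neg s→l))) N λ n N≤n → ≤⇒0≤- (proj₂ (p n N≤n)))

  -- For arguments of arbitrary sign, the difference of the two sides is dominated
  -- by the difference at the absolute values, which vanishes.
  exp-+ : ∀ x y → exp (x + y) ≈ exp x * exp y
  exp-+ x y with absolute x | absolute y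
  ... | X , 0≤X , x±X | Y , 0≤Y , y±Y = sym (begin-equality
    exp x * exp y                                     ≈⟨ solve 2 (λ a b → a := (a :- b) :+ b) refl _ _ ⟩
    (exp x * exp y - exp (x + y)) + exp (x + y)       ≈⟨ +-congʳ difference≈0 ⟩
    0# + exp (x + y)                                  ≈⟨ +-identityˡ _ ⟩
    exp (x + y)                                       ∎)
    where
    partial-excess : ∀ u v m → Converges (excess (expTerm u) (expTerm v) m)
                                         (partialSum (expTerm u) m * exp v - partialSum (conv (expTerm u) (expTerm v)) m)
    partial-excess u v m = Converges-+ (Converges-*ˡ _ (exp-hasSum v)) (Converges-const _)
    total-excess : ∀ u v → Converges (λ m → partialSum (expTerm u) m * exp v - partialSum (conv (expTerm u) (expTerm v)) m)
                                     (exp u * exp v - exp (u + v))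
    total-excess u v = Converges-+ (Converges-cong (λ _ → *-comm _ _) (*-comm _ _) (Converges-*ˡ (exp v) (exp-hasSum u)))
                                   (Converges-neg (conv-hasSum u v))
    difference-bounded : Bounded (exp x * exp y - exp (x + y)) (exp X * exp Y - exp (X + Y))
    difference-bounded = bounded-limit (total-excess x y) (total-excess X Y) 0 λ m _ →
      bounded-limit (partial-excess x y m) (partial-excess X Y m) m λ n m≤n →
        excess-bounded (0≤expTerm 0≤Y) (bounded-expTerm 0≤X x±X) (bounded-expTerm 0≤Y y±Y) m≤n
    bounded-0 : Bounded (exp x * exp y - exp (x + y)) 0#
    bounded-0 = bounded-≈ refl (sym (trans (+-congʳ (sym (exp-+-nonNeg 0≤X 0≤Y))) (-‿inverseʳ _))) difference-bounded
    difference≈0 : exp x * exp y - exp (x + y) ≈ 0#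
    difference≈0 = ≤-antisym (proj₁ bounded-0)
      (≤-trans (≤0⇒0≤- (proj₂ bounded-0)) (≤-reflexive (solve 1 (λ a → :- :- a := a) refl _)))

  exp-0 : exp 0# ≈ 1#
  exp-0 = limit-unique (exp-hasSum 0#) (Converges-eventually 1 λ { (suc n) _ → begin-equality
    partialSum (expTerm 0#) (suc n)                  ≈⟨ partialSum-suc (expTerm 0#) n ⟩
    expTerm 0# 0 + partialSum (expTerm 0# ∘ suc) n   ≈⟨ +-cong (expTerm-0 0#) (partialSum-cong (λ i → trans (*-congʳ (zeroˡ _)) (zeroˡ _)) n) ⟩
    1# + partialSum (λ _ → 0#) n                     ≈⟨ +-congˡ (trans (partialSum-cong (λ _ → sym (zeroˡ 0#)) n) (trans (partialSum-*ˡ 0# _ n) (zeroˡ _))) ⟩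
    1# + 0#                                          ≈⟨ +-identityʳ 1# ⟩
    1#                                               ∎ })

  exp-neg-* : ∀ x → exp (- x) * exp x ≈ 1#
  exp-neg-* x = trans (sym (exp-+ (- x) x)) (trans (exp-cong (-‿inverseˡ x)) exp-0)

  exp-nonNeg : ∀ x → 0# ≤ exp x
  exp-nonNeg x = begin
    0#                             ≤⟨ square-nonNeg (exp (half x)) ⟩
    exp (half x) * exp (half x)    ≈⟨ exp-+ (half x) (half x) ⟨
    exp (half x + half x)          ≈⟨ exp-cong (half+half x) ⟩
    exp x                          ∎
    where
    square-nonNeg : ∀ a → 0# ≤ a * a
    square-nonNeg a with ≤-total 0# a
    ... | inj₁ 0≤a = *-nonNeg 0≤a 0≤a
    ... | inj₂ a≤0 = ≤-trans (*-nonNeg (≤0⇒0≤- a≤0) (≤0⇒0≤- a≤0)) (≤-reflexive (solve 1 (λ a → :- a :* :- a := a :* a) refl a))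

  exp-∑ : {A : Set} → ∀ xs (f : A → ℝ) → ∏[ xs ] (exp ∘ f) ≈ exp (∑[ xs ] f)
  exp-∑ []       f = sym exp-0
  exp-∑ (x ∷ xs) f = trans (*-congˡ (exp-∑ xs f)) (sym (exp-+ (f x) _))

  exp-⌜⌝* : ∀ n x → exp x ^ n ≈ exp (⌜ n ⌝ * x)
  exp-⌜⌝* zero    x = trans (sym exp-0) (exp-cong (sym (zeroˡ x)))
  exp-⌜⌝* (suc n) x = begin-equality
    exp x * exp x ^ n               ≈⟨ *-congˡ (exp-⌜⌝* n x) ⟩
    exp x * exp (⌜ n ⌝ * x)         ≈⟨ exp-+ x _ ⟨
    exp (x + ⌜ n ⌝ * x)             ≈⟨ exp-cong (trans (distribʳ x 1# ⌜ n ⌝) (+-congʳ (*-identityˡ x))) ⟨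
    exp (⌜ suc n ⌝ * x)             ∎

-- Remaining capacities of bins and balls

sum-map-cong : {A : Set} (f g : A → ℕ) → ∀ xs → (∀ {x} → x ∈ xs → f x ≡ g x) → sum (map f xs) ≡ sum (map g xs)
sum-map-cong f g []       p = ≡.refl
sum-map-cong f g (x ∷ xs) p = ≡.cong₂ ℕ._+_ (p (here ≡.refl)) (sum-map-cong f g xs (p ∘ there))

sum-map-suc : {A : Set} (f g : A → ℕ) {v : A} → ∀ xs → Unique xs → v ∈ xs → f v ≡ suc (g v) →
              (∀ u → ¬ u ≡ v → f u ≡ g u) → sum (map f xs) ≡ suc (sum (map g xs))
sum-map-suc f g (x ∷ xs) (x∉xs ∷ _) (here ≡.refl) p q = ≡.cong₂ ℕ._+_ p
  (sum-map-cong f g xs λ {u} u∈xs → q u (λ { ≡.refl → All.lookup x∉xs u∈xs ≡.refl }))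
sum-map-suc f g (x ∷ xs) (x∉xs ∷ uxs) (there v∈xs) p q = ≡.trans
  (≡.cong₂ ℕ._+_ (q x (All.lookup x∉xs v∈xs)) (sum-map-suc f g xs uxs v∈xs p q))
  (ℕₚ.+-suc (g x) (sum (map g xs)))

sum-map-const : {A : Set} (a : ℕ) → ∀ (xs : List A) → sum (map (λ _ → a) xs) ≡ a ℕ.* length xs
sum-map-const a []       = ≡.sym (ℕₚ.*-zeroʳ a)
sum-map-const a (x ∷ xs) = ≡.trans (≡.cong (a ℕ.+_) (sum-map-const a xs)) (≡.sym (ℕₚ.*-suc a (length xs)))

filter-∈-suc : ∀ {n} s (e : Subset n) xs →
               length (filter (Subsetₚ._∈? (s ∷ e)) (map suc xs)) ≡ length (filter (Subsetₚ._∈? e) xs)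
filter-∈-suc s e []       = ≡.refl
filter-∈-suc s e (x ∷ xs) with does (x Subsetₚ.∈? e)
... | true  = ≡.cong suc (filter-∈-suc s e xs)
... | false = filter-∈-suc s e xs

length-filter-∈ : ∀ {n} (e : Subset n) → length (filter (Subsetₚ._∈? e) (allFin n)) ≡ ∣ e ∣
length-filter-∈ []            = ≡.refl
length-filter-∈ {suc n} (s ∷ e) = ≡.trans
  (≡.cong (λ xs → length (filter (Subsetₚ._∈? (s ∷ e)) (zero ∷ xs))) (≡.sym (Listₚ.map-tabulate (λ i → i) suc)))
  (size-∷ s)
  where
  size-∷ : ∀ s → length (filter (Subsetₚ._∈? (s ∷ e)) (zero ∷ map suc (allFin n))) ≡ ∣ s ∷ e ∣
  size-∷ inside  = ≡.cong suc (≡.trans (filter-∈-suc inside e (allFin n)) (length-filter-∈ e))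
  size-∷ outside = ≡.trans (filter-∈-suc outside e (allFin n)) (length-filter-∈ e)

⊓-concave : ∀ i j → (i ⊓ suc (suc j)) ℕ.+ (i ⊓ j) ℕ.≤ (i ⊓ suc j) ℕ.+ (i ⊓ suc j)
⊓-concave zero    j       = ℕ.z≤n
⊓-concave (suc i) zero    = ℕ.s≤s (ℕₚ.≤-trans (ℕₚ.≤-reflexive (ℕₚ.+-identityʳ (i ⊓ 1))) (ℕₚ.≤-trans (ℕₚ.m⊓n≤n i 1) (ℕₚ.≤-trans (ℕ.s≤s ℕ.z≤n) (ℕₚ.m≤n+m (suc (i ⊓ 0)) (i ⊓ 0)))))
⊓-concave (suc i) (suc j) = ℕ.s≤s (≡.subst₂ ℕ._≤_ (≡.sym (ℕₚ.+-suc _ _)) (≡.sym (ℕₚ.+-suc _ _)) (ℕ.s≤s (⊓-concave i j)))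

module States {n k : ℕ} where

  -- The remaining capacities of the bins.
  State : Set
  State = Fin n → ℕ

  size : State → Ball n k → ℕ
  size r e = sum (map r (filter (e ∋?_) (allFin n)))

  -- As r v = max{c - L_v, 0}, each summand is min{L_v, c}.
  value : ℕ → State → ℕ
  value c r = sum (map (λ v → c ∸ r v) (allFin n))

  decrement : Fin n → State → State
  decrement v r u = if does (u Finₚ.≟ v) then r u ∸ 1 else r u

  decrement-≡ : ∀ v r → decrement v r v ≡ r v ∸ 1
  decrement-≡ v r with v Finₚ.≟ v
  ... | yes _  = ≡.refl
  ... | no v≢v = ⊥-elim (v≢v ≡.refl)

  decrement-≢ : ∀ {u v} r → ¬ u ≡ v → decrement v r u ≡ r u
  decrement-≢ {u} {v} r u≢v with u Finₚ.≟ v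
  ... | yes u≡v = ⊥-elim (u≢v u≡v)
  ... | no _    = ≡.refl

  decrement-≤ : ∀ v r u → decrement v r u ℕ.≤ r u
  decrement-≤ v r u with u Finₚ.≟ v
  ... | yes _ = ℕₚ.m∸n≤m (r u) 1
  ... | no _  = ℕₚ.≤-refl

  size-decrement-∈ : ∀ {v s} r e → e ∋ v → r v ≡ suc s → size r e ≡ suc (size (decrement v r) e)
  size-decrement-∈ {v} r e v∈e rv≡1+s = sum-map-suc r (decrement v r) _
    (Uniqueₚ.filter⁺ (e ∋?_) (Uniqueₚ.allFin⁺ n)) (∈-filter⁺ (e ∋?_) (∈-allFin v) v∈e)
    (≡.trans rv≡1+s (≡.cong suc (≡.sym (≡.trans (decrement-≡ v r) (≡.cong (_∸ 1) rv≡1+s)))))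
    (λ u u≢v → ≡.sym (decrement-≢ r u≢v))

  size-decrement-∉ : ∀ {v} r e → ¬ e ∋ v → size (decrement v r) e ≡ size r e
  size-decrement-∉ {v} r e v∉e = sum-map-cong _ _ (filter (e ∋?_) (allFin n)) λ {u} u∈ →
    decrement-≢ r λ { ≡.refl → v∉e (proj₂ (∈-filter⁻ (e ∋?_) {xs = allFin n} u∈)) }

  -- The bound `r v ≤ c` keeps the truncated difference `c ∸ r v` exact; it is the reason for the
  -- bounds on states in the drift estimate.
  value-decrement : ∀ {c v s} r → r v ≡ suc s → r v ℕ.≤ c → value c (decrement v r) ≡ suc (value c r)
  value-decrement {c} {v} {s} r rv≡1+s rv≤c = sum-map-suc _ _ (allFin n) (Uniqueₚ.allFin⁺ n) (∈-allFin v)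
    (≡.trans (≡.cong (c ∸_) (≡.trans (decrement-≡ v r) (≡.cong (_∸ 1) rv≡1+s)))
      (≡.trans (∸-suc (≡.subst (ℕ._≤ c) rv≡1+s rv≤c)) (≡.cong (λ m → suc (c ∸ m)) (≡.sym rv≡1+s))))
    (λ u u≢v → ≡.cong (c ∸_) (decrement-≢ r u≢v))
    where
    ∸-suc : ∀ {s c} → suc s ℕ.≤ c → c ∸ s ≡ suc (c ∸ suc s)
    ∸-suc {zero}  (ℕ.s≤s _) = ≡.refl
    ∸-suc {suc s} (ℕ.s≤s p) = ∸-suc p

  size-const : ∀ c e → size (λ _ → c) e ≡ c ℕ.* k
  size-const c (e , ∣e∣≡k) = ≡.trans (sum-map-const c (filter (Subsetₚ._∈? e) (allFin n)))
    (≡.cong (c ℕ.*_) (≡.trans (length-filter-∈ e) ∣e∣≡k))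

  value-const : ∀ c → value c (λ _ → c) ≡ 0
  value-const c = ≡.trans (sum-map-cong _ (λ _ → 0) (allFin n) (λ _ → ℕₚ.n∸n≡0 c)) (sum-map-const 0 (allFin n))

-- The drift inequality for one coefficient of the potential

module _ (R : CompleteOrderedField) where
  open CompleteOrderedField R

  module Potential {n k : ℕ} (c : ℕ) (rate : Ball n k → ℝ) (0≤rate : ∀ e → 0# ≤ rate e) where
    open Exponential.Convergence R
      using (+-mono; *-monoˡ; 0≤1; 0≤⌜⌝; ⌜⌝-mono; ⌜⌝≉0; ⁻¹-inverseˡ; 0≤-⇒≤; ≤⇒0≤-; 0≤⌜suc⌝⁻¹)
    open Sums R
    open Limits R
    open Convolution R
    open ExponentialProperties R
    open States {n} {k}
    open IntegerCoefficientSolver commutativeRing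
    open PosetReasoning poset

    ∑ᴮ : (Ball n k → ℝ) → ℝ
    ∑ᴮ = ∑[ balls n k ]

    ∑ⱽ : (Fin n → ℝ) → ℝ
    ∑ⱽ = ∑[ allFin n ]

    Λ : ℝ
    Λ = ∑ᴮ rate

    incidence : Ball n k → Fin n → ℝ
    incidence e v = 𝟙 (e ∋? v)

    isZero : ℕ → ℝ
    isZero zero    = 1#
    isZero (suc _) = 0#

    -- The value at 0 is chosen so that the function is antitone.
    reciprocal : ℕ → ℝ
    reciprocal j = ⌜ suc (j ∸ 1) ⌝ ⁻¹

    reciprocal-* : ∀ j → isZero j + reciprocal j * ⌜ j ⌝ ≈ 1#
    reciprocal-* zero    = trans (+-congˡ (zeroʳ _)) (+-identityʳ 1#)
    reciprocal-* (suc j) = trans (+-identityˡ _) (⁻¹-inverseˡ (⌜⌝≉0 (suc j) (ℕ.s≤s ℕ.z≤n)))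

    -- The indicator of j > 0, in the form of the product that arises when the weights in `average`
    -- are summed; this saves case distinctions on `size r e`.
    nonZero : ℕ → ℝ
    nonZero j = reciprocal j * ⌜ j ⌝

    nonZero-0 : nonZero 0 ≈ 0#
    nonZero-0 = zeroʳ _

    nonZero-suc : ∀ j → nonZero (suc j) ≈ 1#
    nonZero-suc j = ⁻¹-inverseˡ (⌜⌝≉0 (suc j) (ℕ.s≤s ℕ.z≤n))

    0≤isZero : ∀ j → 0# ≤ isZero j
    0≤isZero zero    = 0≤1
    0≤isZero (suc _) = ≤-refl

    0≤reciprocal : ∀ j → 0# ≤ reciprocal j
    0≤reciprocal j = 0≤⌜suc⌝⁻¹ (j ∸ 1)

    reciprocal-antitone : ∀ {i j} → i ℕ.≤ j → reciprocal j ≤ reciprocal i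
    reciprocal-antitone {i} {j} i≤j = *-cancelˡ-≤ (0<⌜suc⌝ (j ∸ 1)) (*-cancelˡ-≤ (0<⌜suc⌝ (i ∸ 1)) (begin
      a * (b * b ⁻¹)     ≈⟨ *-congˡ (⁻¹-inverseʳ (⌜⌝≉0 (suc (j ∸ 1)) (ℕ.s≤s ℕ.z≤n))) ⟩
      a * 1#             ≤⟨ *-monoʳ 0≤1 (⌜⌝-mono (ℕ.s≤s (ℕₚ.∸-monoˡ-≤ 1 i≤j))) ⟩
      b * 1#             ≈⟨ *-congˡ (⁻¹-inverseʳ (⌜⌝≉0 (suc (i ∸ 1)) (ℕ.s≤s ℕ.z≤n))) ⟨
      b * (a * a ⁻¹)     ≈⟨ solve 3 (λ a b c → b :* (a :* c) := a :* (b :* c)) refl a b (a ⁻¹) ⟩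
      a * (b * a ⁻¹)     ∎))
      where
      a b : ℝ
      a = ⌜ suc (i ∸ 1) ⌝
      b = ⌜ suc (j ∸ 1) ⌝

    -- The expectation of g after a ball of type e has been allocated in state r;
    -- the state does not change when all bins of e are full.
    average : Ball n k → (State → ℝ) → State → ℝ
    average e g r =
      isZero (size r e) * g r + reciprocal (size r e) * ∑ⱽ (λ v → incidence e v * ⌜ r v ⌝ * g (decrement v r))

    0≤weight : ∀ e (r : State) v → 0# ≤ incidence e v * ⌜ r v ⌝
    0≤weight e r v = *-nonNeg (𝟙-nonNeg (e ∋? v)) (0≤⌜⌝ (r v))

    ⌜size⌝ : ∀ (r : State) e → ⌜ size r e ⌝ ≈ ∑ⱽ (λ v → incidence e v * ⌜ r v ⌝)
    ⌜size⌝ r e = trans (⌜⌝-sum (filter (e ∋?_) (allFin n)) r) (∑-filter (e ∋?_) (allFin n) (λ v → ⌜ r v ⌝))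

    average-nonNeg : ∀ e {g} r → (∀ s → 0# ≤ g s) → 0# ≤ average e g r
    average-nonNeg e r 0≤g = +-nonNeg (*-nonNeg (0≤isZero (size r e)) (0≤g r))
      (*-nonNeg (0≤reciprocal (size r e)) (∑-nonNeg (allFin n) λ v → *-nonNeg (0≤weight e r v) (0≤g (decrement v r))))

    average-mono : ∀ e {f g} r → f r ≤ g r → (∀ v → f (decrement v r) ≤ g (decrement v r)) → average e f r ≤ average e g r
    average-mono e r p q = +-mono (*-monoˡ (0≤isZero (size r e)) p)
      (*-monoˡ (0≤reciprocal (size r e)) (∑-mono (allFin n) λ v → *-monoˡ (0≤weight e r v) (q v)))

    average-cong : ∀ e {f g} r → (∀ s → f s ≈ g s) → average e f r ≈ average e g r
    average-cong e r p = +-cong (*-congˡ (p r)) (*-congˡ (∑-cong (allFin n) λ v → *-congˡ (p (decrement v r))))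

    average-+ : ∀ e f g r → average e (λ s → f s + g s) r ≈ average e f r + average e g r
    average-+ e f g r = begin-equality
      z * (f r + g r) + ρ * ∑ⱽ (λ v → w v * (f (r′ v) + g (r′ v)))
        ≈⟨ +-congˡ (*-congˡ (trans (∑-cong (allFin n) λ v → distribˡ _ _ _) (∑-+ (allFin n) _ _))) ⟩
      z * (f r + g r) + ρ * (∑ⱽ (λ v → w v * f (r′ v)) + ∑ⱽ (λ v → w v * g (r′ v)))
        ≈⟨ solve 6 (λ z ρ a b s t → z :* (a :+ b) :+ ρ :* (s :+ t) := (z :* a :+ ρ :* s) :+ (z :* b :+ ρ :* t)) refl z ρ (f r) (g r) _ _ ⟩
      average e f r + average e g r ∎
      where
      z ρ : ℝ
      z = isZero (size r e)
      ρ = reciprocal (size r e)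
      w : Fin n → ℝ
      w v = incidence e v * ⌜ r v ⌝
      r′ : Fin n → State
      r′ v = decrement v r

    average-*ˡ : ∀ e a g r → average e (λ s → a * g s) r ≈ a * average e g r
    average-*ˡ e a g r = trans
      (+-congˡ (*-congˡ (trans (∑-cong (allFin n) λ v → solve 3 (λ w a x → w :* (a :* x) := a :* (w :* x)) refl (incidence e v * ⌜ r v ⌝) a (g (decrement v r))) (∑-*ˡ (allFin n) a _))))
      (solve 5 (λ z a x ρ s → z :* (a :* x) :+ ρ :* (a :* s) := a :* (z :* x :+ ρ :* s)) refl (isZero (size r e)) a (g r) (reciprocal (size r e)) _)

    average-0 : ∀ e r → average e (λ _ → 0#) r ≈ 0#
    average-0 e r = trans (average-cong e {λ _ → 0#} {λ _ → 0# * 0#} r (λ _ → sym (zeroˡ 0#))) (trans (average-*ˡ e 0# (λ _ → 0#) r) (zeroˡ _))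

    average-∑ : {A : Set} → ∀ e xs (g : A → State → ℝ) r →
                average e (λ s → ∑[ xs ] (λ x → g x s)) r ≈ ∑[ xs ] (λ x → average e (g x) r)
    average-∑ e []       g r = average-0 e r
    average-∑ e (x ∷ xs) g r = trans (average-+ e (g x) (λ s → ∑[ xs ] (λ y → g y s)) r) (+-congˡ (average-∑ e xs g r))

    average-conv : ∀ e a (g : ℕ → State → ℝ) r N →
                   average e (λ s → conv a (λ i → g i s) N) r ≈ conv a (λ i → average e (g i) r) N
    average-conv e a g r zero    = average-*ˡ e (a 0) (g 0) r
    average-conv e a g r (suc N) = trans (average-+ e (λ s → a 0 * g (suc N) s) (λ s → conv (a ∘ suc) (λ i → g i s) N) r)
      (+-cong (average-*ˡ e (a 0) (g (suc N)) r) (average-conv e (a ∘ suc) g r N))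

    -- The last hypothesis is (p x - p y)(q x - q y) ≥ 0 multiplied out. Adding x to the list
    -- creates cross terms of x with every y, and each such pair is an instance of it.
    chebyshev : {A : Set} → ∀ xs (a p q : A → ℝ) → (∀ x → 0# ≤ a x) →
                (∀ x y → p x * q y + p y * q x ≤ p x * q x + p y * q y) →
                ∑[ xs ] (λ x → a x * p x) * ∑[ xs ] (λ x → a x * q x) ≤ ∑[ xs ] a * ∑[ xs ] (λ x → a x * (p x * q x))
    chebyshev []       a p q 0≤a similar = ≤-refl
    chebyshev (x ∷ xs) a p q 0≤a similar = begin
      (a x * p x + P) * (a x * q x + Q)
        ≈⟨ solve 5 (λ a p q P Q → (a :* p :+ P) :* (a :* q :+ Q) := a :* a :* (p :* q) :+ (a :* (p :* Q :+ q :* P) :+ P :* Q)) refl (a x) (p x) (q x) P Q ⟩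
      a x * a x * (p x * q x) + (a x * (p x * Q + q x * P) + P * Q)
        ≤⟨ +-mono ≤-refl (+-mono (*-monoˡ (0≤a x) cross) (chebyshev xs a p q 0≤a similar)) ⟩
      a x * a x * (p x * q x) + (a x * (p x * q x * S + PQ) + S * PQ)
        ≈⟨ solve 4 (λ a pq S PQ → a :* a :* pq :+ (a :* (pq :* S :+ PQ) :+ S :* PQ) := (a :+ S) :* (a :* pq :+ PQ)) refl (a x) (p x * q x) S PQ ⟩
      (a x + S) * (a x * (p x * q x) + PQ) ∎
      where
      P Q S PQ : ℝ
      P  = ∑[ xs ] (λ y → a y * p y)
      Q  = ∑[ xs ] (λ y → a y * q y)
      S  = ∑[ xs ] a
      PQ = ∑[ xs ] (λ y → a y * (p y * q y))
      cross : p x * Q + q x * P ≤ p x * q x * S + PQ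
      cross = begin
        p x * Q + q x * P
          ≈⟨ +-cong (∑-*ˡ xs (p x) _) (∑-*ˡ xs (q x) _) ⟨
        ∑[ xs ] (λ y → p x * (a y * q y)) + ∑[ xs ] (λ y → q x * (a y * p y))
          ≈⟨ ∑-+ xs _ _ ⟨
        ∑[ xs ] (λ y → p x * (a y * q y) + q x * (a y * p y))
          ≤⟨ ∑-mono xs (λ y → begin
            p x * (a y * q y) + q x * (a y * p y)
              ≈⟨ solve 5 (λ px qx a py qy → px :* (a :* qy) :+ qx :* (a :* py) := a :* (px :* qy :+ py :* qx)) refl (p x) (q x) (a y) (p y) (q y) ⟩
            a y * (p x * q y + p y * q x)          ≤⟨ *-monoˡ (0≤a y) (similar x y) ⟩
            a y * (p x * q x + p y * q y)          ≈⟨ solve 3 (λ a s t → a :* (s :+ t) := s :* a :+ a :* t) refl (a y) (p x * q x) (p y * q y) ⟩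
            p x * q x * a y + a y * (p y * q y)    ∎) ⟩
        ∑[ xs ] (λ y → p x * q x * a y + a y * (p y * q y))
          ≈⟨ trans (∑-+ xs _ _) (+-congʳ (∑-*ˡ xs (p x * q x) a)) ⟩
        p x * q x * S + PQ ∎

    -- In the application, `b j` is the coefficient of tᴺ in exp((Λ + x)t) 𝐄 min{Poisson(xt), j},
    -- and `T` is that of exp((Λ + x)t).
    module Step (b : ℕ → ℝ) (b₀≈0 : b 0 ≈ 0#) (b-mono : ∀ j → b j ≤ b (suc j))
                (b-concave : ∀ j → b (suc (suc j)) + b j ≤ b (suc j) + b (suc j))
                (x : ℝ) (0≤x : 0# ≤ x) (rate-bound : ∀ v → ∑ᴮ (λ e → rate e * incidence e v) ≤ x) (T : ℝ) where

      -- The value at 0 repeats the one at 1, as in `reciprocal`, so that both functions are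
      -- antitone on all of ℕ. Multiplication by `nonZero` removes the artificial value again.
      slope : ℕ → ℝ
      slope j = b (suc (j ∸ 1)) - b (j ∸ 1)

      0≤slope : ∀ j → 0# ≤ slope j
      0≤slope j = ≤⇒0≤- (b-mono (j ∸ 1))

      slope-antitone : ∀ {i j} → i ℕ.≤ j → slope j ≤ slope i
      slope-antitone i≤j = go (ℕₚ.≤⇒≤′ (ℕₚ.∸-monoˡ-≤ 1 i≤j))
        where
        go : ∀ {i j} → i ℕ.≤′ j → b (suc j) - b j ≤ b (suc i) - b i
        go ℕ.≤′-refl               = ≤-refl
        go {j = suc j} (ℕ.≤′-step p) = ≤-trans (+-cancelʳ-≤ (b (suc j) + b j) (begin
          (b (suc (suc j)) - b (suc j)) + (b (suc j) + b j)  ≈⟨ solve 3 (λ r s t → (r :- s) :+ (s :+ t) := r :+ t) refl (b (suc (suc j))) (b (suc j)) (b j) ⟩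
          b (suc (suc j)) + b j                              ≤⟨ b-concave j ⟩
          b (suc j) + b (suc j)                              ≈⟨ solve 2 (λ s t → s :+ s := (s :- t) :+ (s :+ t)) refl (b (suc j)) (b j) ⟩
          (b (suc j) - b j) + (b (suc j) + b j)              ∎)) (go p)

      nonZero-slope : ∀ j → nonZero j * slope j ≈ b j - b (j ∸ 1)
      nonZero-slope zero    = trans (*-congʳ nonZero-0) (trans (zeroˡ _) (sym (-‿inverseʳ (b 0))))
      nonZero-slope (suc j) = trans (*-congʳ (nonZero-suc j)) (*-identityˡ _)

      -- The coefficient of tᴺ of the potential with remaining time t, multiplied by exp((Λ + x)t)
      -- and also by x, which avoids the division in h.
      potential : State → ℝ
      potential r = x * ⌜ value c r ⌝ * T + ∑ᴮ (λ e → rate e * b (size r e))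

      -- `slopes r v` is what all ball types together lose when bin v loses one unit of capacity;
      -- `⌜ r v ⌝ * reciprocals r v` is the rate at which this happens.
      slopes reciprocals : State → Fin n → ℝ
      slopes r v      = ∑ᴮ (λ e → rate e * incidence e v * slope (size r e))
      reciprocals r v = ∑ᴮ (λ e → rate e * incidence e v * reciprocal (size r e))

      potential-decrement : ∀ {v s} r → r v ≡ suc s → r v ℕ.≤ c →
                            potential (decrement v r) ≈ potential r + x * T - slopes r v
      potential-decrement {v} {s} r rv≡1+s rv≤c = begin-equality
        x * ⌜ value c (decrement v r) ⌝ * T + ∑ᴮ (λ e → rate e * b (size (decrement v r) e))
          ≈⟨ +-cong (*-congʳ (*-congˡ (⌜⌝-cong (value-decrement r rv≡1+s rv≤c)))) (∑-cong (balls n k) λ e → term e (e ∋? v)) ⟩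
        x * (1# + V) * T + ∑ᴮ (λ e → rate e * b (size r e) + - 1# * (rate e * incidence e v * slope (size r e)))
          ≈⟨ +-congˡ (trans (∑-+ (balls n k) _ _) (+-congˡ (∑-*ˡ (balls n k) (- 1#) _))) ⟩
        x * (1# + V) * T + (S + - 1# * slopes r v)
          ≈⟨ solve 5 (λ x V T S D → x :* (con (+ 1) :+ V) :* T :+ (S :+ :- con (+ 1) :* D) := ((x :* V :* T :+ S) :+ x :* T) :- D) refl x V T S (slopes r v) ⟩
        potential r + x * T - slopes r v ∎
        where
        V S : ℝ
        V = ⌜ value c r ⌝
        S = ∑ᴮ (λ e → rate e * b (size r e))
        term : ∀ e (d : Dec (e ∋ v)) → rate e * b (size (decrement v r) e) ≈ rate e * b (size r e) + - 1# * (rate e * 𝟙 d * slope (size r e))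
        term e (yes v∈e) rewrite size-decrement-∈ r e v∈e rv≡1+s =
          solve 3 (λ l p q → l :* p := l :* q :+ :- con (+ 1) :* (l :* con (+ 1) :* (q :- p))) refl (rate e) (b (size (decrement v r) e)) (b (suc (size (decrement v r) e)))
        term e (no v∉e) rewrite size-decrement-∉ r e v∉e =
          solve 3 (λ l p q → l :* p := l :* p :+ :- con (+ 1) :* (l :* con (+ 0) :* q)) refl (rate e) (b (size r e)) (slope (size r e))

      -- `potential-decrement` needs a unit of capacity in v. A bin without one has weight 0, so the
      -- weighted equation holds for every bin.
      weighted-potential-decrement : ∀ f v r → r v ℕ.≤ c → incidence f v * ⌜ r v ⌝ * potential (decrement v r)
        ≈ (potential r + x * T) * (incidence f v * ⌜ r v ⌝) + - 1# * (incidence f v * ⌜ r v ⌝ * slopes r v)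
      weighted-potential-decrement f v r rv≤c = trans (step (r v) ≡.refl)
        (solve 3 (λ w p d → w :* (p :- d) := p :* w :+ :- con (+ 1) :* (w :* d)) refl (incidence f v * ⌜ r v ⌝) (potential r + x * T) (slopes r v))
        where
        step : ∀ j → r v ≡ j → incidence f v * ⌜ r v ⌝ * potential (decrement v r) ≈ incidence f v * ⌜ r v ⌝ * (potential r + x * T - slopes r v)
        step zero    rv≡0 = trans (vanish _) (sym (vanish _))
          where
          vanish : ∀ a → incidence f v * ⌜ r v ⌝ * a ≈ 0#
          vanish a = trans (*-congʳ (trans (*-congˡ (⌜⌝-cong rv≡0)) (zeroʳ _))) (zeroˡ a)
        step (suc s) rv≡1+s = *-congˡ (potential-decrement r rv≡1+s rv≤c)

      average-potential : ∀ f r → (∀ v → r v ℕ.≤ c) →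
        average f potential r ≈ potential r + nonZero (size r f) * (x * T)
          - reciprocal (size r f) * ∑ⱽ (λ v → incidence f v * ⌜ r v ⌝ * slopes r v)
      average-potential f r r≤c = begin-equality
        z * U + ρ * ∑ⱽ (λ v → w v * potential (decrement v r))
          ≈⟨ +-congˡ (*-congˡ (trans (∑-cong (allFin n) λ v → weighted-potential-decrement f v r (r≤c v))
               (trans (∑-+ (allFin n) _ _) (+-cong (∑-*ˡ (allFin n) (U + x * T) w) (∑-*ˡ (allFin n) (- 1#) _))))) ⟩
        z * U + ρ * ((U + x * T) * ∑ⱽ w + - 1# * D)
          ≈⟨ +-congˡ (*-congˡ (+-congʳ (*-congˡ (⌜size⌝ r f)))) ⟨
        z * U + ρ * ((U + x * T) * s + - 1# * D)
          ≈⟨ solve 6 (λ z U ρ t s D → z :* U :+ ρ :* ((U :+ t) :* s :+ :- con (+ 1) :* D) := ((z :+ ρ :* s) :* U :+ ρ :* s :* t) :- ρ :* D) refl z U ρ (x * T) s D ⟩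
        ((z + ρ * s) * U + ρ * s * (x * T)) - ρ * D
          ≈⟨ +-congʳ (+-congʳ (trans (*-congʳ (reciprocal-* (size r f))) (*-identityˡ U))) ⟩
        (U + ρ * s * (x * T)) - ρ * D ∎
        where
        z ρ s U D : ℝ
        z = isZero (size r f)
        ρ = reciprocal (size r f)
        s = ⌜ size r f ⌝
        U = potential r
        w : Fin n → ℝ
        w v = incidence f v * ⌜ r v ⌝
        D = ∑ⱽ (λ v → w v * slopes r v)

      -- Grouped by bins, the left side is a sum of products r_v (∑ λ_f / r_f)(∑ λ_e `slope`), the
      -- inner sums being over the balls at v. After `perBin` has made each product a single sum
      -- over balls, regrouping by balls and ∑_{v ∈ e} r_v = r_e cancel the reciprocals. What
      -- remains is the loss of each e caused by its own arrivals, as if they came at rate x.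
      collision-bound : ∀ r → ∑ᴮ (λ f → rate f * (reciprocal (size r f) * ∑ⱽ (λ v → incidence f v * ⌜ r v ⌝ * slopes r v)))
                              ≤ x * ∑ᴮ (λ e → rate e * (b (size r e) - b (size r e ∸ 1)))
      collision-bound r = begin
        ∑ᴮ (λ f → rate f * (ρ f * ∑ⱽ (λ v → incidence f v * ⌜ r v ⌝ * slopes r v)))
          ≈⟨ ∑-cong (balls n k) (λ f → trans (sym (*-assoc (rate f) (ρ f) _)) (sym (∑-*ˡ (allFin n) (rate f * ρ f) _))) ⟩
        ∑ᴮ (λ f → ∑ⱽ (λ v → rate f * ρ f * (incidence f v * ⌜ r v ⌝ * slopes r v)))
          ≈⟨ ∑-swap (balls n k) (allFin n) _ ⟩
        ∑ⱽ (λ v → ∑ᴮ (λ f → rate f * ρ f * (incidence f v * ⌜ r v ⌝ * slopes r v)))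
          ≈⟨ ∑-cong (allFin n) (λ v → trans (∑-cong (balls n k) λ f →
               solve 5 (λ l ρ i s d → l :* ρ :* (i :* s :* d) := l :* i :* ρ :* (s :* d)) refl (rate f) (ρ f) (incidence f v) ⌜ r v ⌝ (slopes r v))
               (∑-*ʳ (balls n k) (⌜ r v ⌝ * slopes r v) _)) ⟩
        ∑ⱽ (λ v → reciprocals r v * (⌜ r v ⌝ * slopes r v))
          ≤⟨ ∑-mono (allFin n) perBin ⟩
        ∑ⱽ (λ v → ∑ᴮ (λ e → x * (rate e * (ρ e * σ e)) * (incidence e v * ⌜ r v ⌝)))
          ≈⟨ ∑-swap (allFin n) (balls n k) _ ⟩
        ∑ᴮ (λ e → ∑ⱽ (λ v → x * (rate e * (ρ e * σ e)) * (incidence e v * ⌜ r v ⌝)))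
          ≈⟨ ∑-cong (balls n k) perBall ⟩
        ∑ᴮ (λ e → x * (rate e * (b (size r e) - b (size r e ∸ 1))))
          ≈⟨ ∑-*ˡ (balls n k) x _ ⟩
        x * ∑ᴮ (λ e → rate e * (b (size r e) - b (size r e ∸ 1))) ∎
        where
        ρ σ : Ball n k → ℝ
        ρ e = reciprocal (size r e)
        σ e = slope (size r e)
        -- Both factors decrease with the remaining capacity.
        similar : ∀ e f → ρ e * σ f + ρ f * σ e ≤ ρ e * σ e + ρ f * σ f
        similar e f with ℕₚ.≤-total (size r e) (size r f)
        ... | inj₁ e≤f = 0≤-⇒≤ (≤-trans (*-nonNeg (≤⇒0≤- (reciprocal-antitone e≤f)) (≤⇒0≤- (slope-antitone e≤f)))
          (≤-reflexive (solve 4 (λ p q s t → (p :- q) :* (s :- t) := (p :* s :+ q :* t) :- (p :* t :+ q :* s)) refl (ρ e) (ρ f) (σ e) (σ f))))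
        ... | inj₂ f≤e = 0≤-⇒≤ (≤-trans (*-nonNeg (≤⇒0≤- (reciprocal-antitone f≤e)) (≤⇒0≤- (slope-antitone f≤e)))
          (≤-reflexive (solve 4 (λ p q s t → (q :- p) :* (t :- s) := (p :* s :+ q :* t) :- (p :* t :+ q :* s)) refl (ρ e) (ρ f) (σ e) (σ f))))
        0≤ρσ : ∀ e → 0# ≤ ρ e * σ e
        0≤ρσ e = *-nonNeg (0≤reciprocal (size r e)) (0≤slope (size r e))
        perBin : ∀ v → reciprocals r v * (⌜ r v ⌝ * slopes r v) ≤ ∑ᴮ (λ e → x * (rate e * (ρ e * σ e)) * (incidence e v * ⌜ r v ⌝))
        perBin v = begin
          reciprocals r v * (⌜ r v ⌝ * slopes r v)
            ≈⟨ solve 3 (λ b s d → b :* (s :* d) := s :* (b :* d)) refl (reciprocals r v) ⌜ r v ⌝ (slopes r v) ⟩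
          ⌜ r v ⌝ * (reciprocals r v * slopes r v)
            ≤⟨ *-monoˡ (0≤⌜⌝ (r v)) (chebyshev (balls n k) a ρ σ 0≤a similar) ⟩
          ⌜ r v ⌝ * (∑ᴮ a * ∑ᴮ (λ e → a e * (ρ e * σ e)))
            ≤⟨ *-monoˡ (0≤⌜⌝ (r v)) (*-monoʳ (∑-nonNeg (balls n k) λ e → *-nonNeg (0≤a e) (0≤ρσ e)) (rate-bound v)) ⟩
          ⌜ r v ⌝ * (x * ∑ᴮ (λ e → a e * (ρ e * σ e)))
            ≈⟨ trans (sym (*-assoc _ _ _)) (sym (∑-*ˡ (balls n k) (⌜ r v ⌝ * x) _)) ⟩
          ∑ᴮ (λ e → ⌜ r v ⌝ * x * (a e * (ρ e * σ e)))
            ≈⟨ ∑-cong (balls n k) (λ e → solve 5 (λ s x l i t → s :* x :* (l :* i :* t) := x :* (l :* t) :* (i :* s)) refl ⌜ r v ⌝ x (rate e) (incidence e v) (ρ e * σ e)) ⟩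
          ∑ᴮ (λ e → x * (rate e * (ρ e * σ e)) * (incidence e v * ⌜ r v ⌝)) ∎
          where
          a : Ball n k → ℝ
          a e = rate e * incidence e v
          0≤a : ∀ e → 0# ≤ a e
          0≤a e = *-nonNeg (0≤rate e) (𝟙-nonNeg (e ∋? v))
        perBall : ∀ e → ∑ⱽ (λ v → x * (rate e * (ρ e * σ e)) * (incidence e v * ⌜ r v ⌝)) ≈ x * (rate e * (b (size r e) - b (size r e ∸ 1)))
        perBall e = begin-equality
          ∑ⱽ (λ v → x * (rate e * (ρ e * σ e)) * (incidence e v * ⌜ r v ⌝))
            ≈⟨ trans (∑-*ˡ (allFin n) _ _) (*-congˡ (sym (⌜size⌝ r e))) ⟩
          x * (rate e * (ρ e * σ e)) * ⌜ size r e ⌝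
            ≈⟨ solve 5 (λ x l ρ σ s → x :* (l :* (ρ :* σ)) :* s := x :* (l :* (ρ :* s :* σ))) refl x (rate e) (ρ e) (σ e) ⌜ size r e ⌝ ⟩
          x * (rate e * (nonZero (size r e) * σ e))
            ≈⟨ *-congˡ (*-congˡ (nonZero-slope (size r e))) ⟩
          x * (rate e * (b (size r e) - b (size r e ∸ 1))) ∎

      -- In the application the left side is N + 1 times the next coefficient of the potential, and
      -- the right side is the recursion of `series-suc` applied to the current one.
      potential-growth : ∀ r → (∀ v → r v ℕ.≤ c) →
        x * ⌜ value c r ⌝ * ((Λ + x) * T)
          + ∑ᴮ (λ e → rate e * (Λ * b (size r e) + x * (nonZero (size r e) * T + b (size r e ∸ 1))))
        ≤ x * potential r + ∑ᴮ (λ f → rate f * average f potential r)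
      potential-growth r r≤c = 0≤-⇒≤ (begin
        0#
          ≤⟨ ≤⇒0≤- (collision-bound r) ⟩
        x * ∑ᴮ (λ e → rate e * (b (size r e) - b (size r e ∸ 1))) - C
          ≈⟨ +-congʳ (*-congˡ (trans (∑-cong (balls n k) λ e → solve 3 (λ l s t → l :* (s :- t) := l :* s :+ :- con (+ 1) :* (l :* t)) refl (rate e) (b (size r e)) (b (size r e ∸ 1)))
               (trans (∑-+ (balls n k) _ _) (+-congˡ (∑-*ˡ (balls n k) (- 1#) _))))) ⟩
        x * (S + - 1# * S⁻) - C
          -- Apart from `collision-bound` this is an identity. The gain x T of a ball that finds
          -- capacity, on the right, equals the `nonZero` term on the left, and the Λ and V terms
          -- agree.
          ≈⟨ solve 8 (λ x S S⁻ C V T L H →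
               x :* (S :+ :- con (+ 1) :* S⁻) :- C :=
               (x :* (x :* V :* T :+ S) :+ (((x :* V :* T :+ S) :* L :+ x :* T :* H) :+ :- con (+ 1) :* C))
                 :- (x :* V :* ((L :+ x) :* T) :+ (L :* S :+ x :* (T :* H :+ S⁻)))) refl x S S⁻ C V T Λ H ⟩
        (x * U + ((U * Λ + x * T * H) + - 1# * C)) - (x * V * ((Λ + x) * T) + (Λ * S + x * (T * H + S⁻)))
          ≈⟨ +-cong (+-congˡ averages) (-‿cong (+-congˡ growths)) ⟨
        (x * U + ∑ᴮ (λ f → rate f * average f potential r))
          - (x * V * ((Λ + x) * T) + ∑ᴮ (λ e → rate e * (Λ * b (size r e) + x * (nonZero (size r e) * T + b (size r e ∸ 1))))) ∎)
        where
        C S S⁻ V U H : ℝ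
        C  = ∑ᴮ (λ f → rate f * (reciprocal (size r f) * ∑ⱽ (λ v → incidence f v * ⌜ r v ⌝ * slopes r v)))
        S  = ∑ᴮ (λ e → rate e * b (size r e))
        S⁻ = ∑ᴮ (λ e → rate e * b (size r e ∸ 1))
        V  = ⌜ value c r ⌝
        U  = potential r
        H  = ∑ᴮ (λ e → rate e * nonZero (size r e))
        averages : ∑ᴮ (λ f → rate f * average f potential r) ≈ (U * Λ + x * T * H) + - 1# * C
        averages = begin-equality
          ∑ᴮ (λ f → rate f * average f potential r)
            ≈⟨ ∑-cong (balls n k) (λ f → trans (*-congˡ (average-potential f r r≤c))
                 (solve 5 (λ l U h t d → l :* ((U :+ h :* t) :- d) := (U :* l :+ t :* (l :* h)) :+ :- con (+ 1) :* (l :* d)) refl (rate f) U (nonZero (size r f)) (x * T) _)) ⟩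
          ∑ᴮ (λ f → (U * rate f + x * T * (rate f * nonZero (size r f))) + - 1# * (rate f * (reciprocal (size r f) * ∑ⱽ (λ v → incidence f v * ⌜ r v ⌝ * slopes r v))))
            ≈⟨ trans (∑-+ (balls n k) _ _) (+-cong (trans (∑-+ (balls n k) _ _) (+-cong (∑-*ˡ (balls n k) U rate) (∑-*ˡ (balls n k) (x * T) _))) (∑-*ˡ (balls n k) (- 1#) _)) ⟩
          (U * Λ + x * T * H) + - 1# * C ∎
        growths : ∑ᴮ (λ e → rate e * (Λ * b (size r e) + x * (nonZero (size r e) * T + b (size r e ∸ 1)))) ≈ Λ * S + x * (T * H + S⁻)
        growths = begin-equality
          ∑ᴮ (λ e → rate e * (Λ * b (size r e) + x * (nonZero (size r e) * T + b (size r e ∸ 1))))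
            ≈⟨ ∑-cong (balls n k) (λ e → solve 7 (λ l L b x h T b⁻ → l :* (L :* b :+ x :* (h :* T :+ b⁻)) := L :* (l :* b) :+ x :* (T :* (l :* h) :+ l :* b⁻)) refl
                 (rate e) Λ (b (size r e)) x (nonZero (size r e)) T (b (size r e ∸ 1))) ⟩
          ∑ᴮ (λ e → Λ * (rate e * b (size r e)) + x * (T * (rate e * nonZero (size r e)) + rate e * b (size r e ∸ 1)))
            ≈⟨ trans (∑-+ (balls n k) _ _) (+-cong (∑-*ˡ (balls n k) Λ _) (trans (∑-*ˡ (balls n k) x _) (*-congˡ (trans (∑-+ (balls n k) _ _) (+-congʳ (∑-*ˡ (balls n k) T _)))))) ⟩
          Λ * S + x * (T * H + S⁻) ∎

-- The expected value as a power series in time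

module _ (R : CompleteOrderedField) where
  open CompleteOrderedField R

  module ExpectedValue {n k : ℕ} (c : ℕ) (rate : Ball n k → ℝ) (0≤rate : ∀ e → 0# ≤ rate e) where
    open Exponential R using (expTerm; exp; exp-hasSum)
    open Exponential.Convergence R using (+-mono; *-monoˡ; *-mono; 0≤⌜⌝; ⌜⌝-mono; 0≤expTerm; 0≤⌜suc⌝⁻¹)
    open SemiringMult semiring using (×-homo-+; ×1-homo-*)
    open Sums R
    open Limits R
    open Convolution R
    open ExponentialProperties R
    open States {n} {k}
    open Potential R c rate 0≤rate
    open IntegerCoefficientSolver commutativeRing
    open PosetReasoning poset

    valueAfter : List (Ball n k) → State → ℝ
    valueAfter []       r = ⌜ value c r ⌝
    valueAfter (e ∷ es) r = average e (valueAfter es) r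

    0≤valueAfter : ∀ es r → 0# ≤ valueAfter es r
    0≤valueAfter []       r = 0≤⌜⌝ (value c r)
    0≤valueAfter (e ∷ es) r = average-nonNeg e r (0≤valueAfter es)

    words : ℕ → List (List (Ball n k))
    words zero    = [] ∷ []
    words (suc N) = cartesianProductWith _∷_ (balls n k) (words N)

    -- The coefficient of tᴺ in exp(Λ t) times the expected value at time t.
    expectedValue : ℕ → State → ℝ
    expectedValue zero    r = ⌜ value c r ⌝
    expectedValue (suc N) r = ⌜ suc N ⌝ ⁻¹ * ∑ᴮ (λ e → rate e * average e (expectedValue N) r)

    0≤expectedValue : ∀ N r → 0# ≤ expectedValue N r
    0≤expectedValue zero    r = 0≤⌜⌝ (value c r)
    0≤expectedValue (suc N) r = *-nonNeg (0≤⌜suc⌝⁻¹ N)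
      (∑-nonNeg (balls n k) λ e → *-nonNeg (0≤rate e) (average-nonNeg e r (0≤expectedValue N)))

    ∑-cartesianProductWith : {A B C : Set} (f : A → B → C) → ∀ xs ys (g : C → ℝ) →
      ∑[ cartesianProductWith f xs ys ] g ≈ ∑[ xs ] (λ x → ∑[ ys ] (λ y → g (f x y)))
    ∑-cartesianProductWith f []       ys g = refl
    ∑-cartesianProductWith f (x ∷ xs) ys g = trans (∑-++ (map (f x) ys) _ g)
      (+-cong (∑-map (f x) ys g) (∑-cartesianProductWith f xs ys g))

    -- The law of the ball types weights a word w of length N by exp(-Λ) `∏[ w ] rate` / N!, so N!
    -- is the factor between sums over words and coefficients.
    ∑-words : ∀ N r → ∑[ words N ] (λ w → ∏[ w ] rate * valueAfter w r) ≈ ⌜ N ! ⌝ * expectedValue N r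
    ∑-words zero    r = trans (+-identityʳ _) (*-congʳ (sym (+-identityʳ 1#)))
    ∑-words (suc N) r = begin-equality
      ∑[ words (suc N) ] (λ w → ∏[ w ] rate * valueAfter w r)
        ≈⟨ ∑-cartesianProductWith _∷_ (balls n k) (words N) _ ⟩
      ∑ᴮ (λ e → ∑[ words N ] (λ w → rate e * ∏[ w ] rate * average e (valueAfter w) r))
        ≈⟨ ∑-cong (balls n k) perBall ⟩
      ∑ᴮ (λ e → ⌜ N ! ⌝ * (rate e * average e (expectedValue N) r))
        ≈⟨ ∑-*ˡ (balls n k) ⌜ N ! ⌝ _ ⟩
      ⌜ N ! ⌝ * ∑ᴮ (λ e → rate e * average e (expectedValue N) r)
        ≈⟨ *-congˡ (⌜suc⌝-cancel N _) ⟨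
      ⌜ N ! ⌝ * (⌜ suc N ⌝ * expectedValue (suc N) r)
        ≈⟨ solve 3 (λ a b c → a :* (b :* c) := (b :* a) :* c) refl ⌜ N ! ⌝ ⌜ suc N ⌝ _ ⟩
      (⌜ suc N ⌝ * ⌜ N ! ⌝) * expectedValue (suc N) r
        ≈⟨ *-congʳ (×1-homo-* (suc N) (N !)) ⟨
      ⌜ suc N ! ⌝ * expectedValue (suc N) r ∎
      where
      perBall : ∀ e → ∑[ words N ] (λ w → rate e * ∏[ w ] rate * average e (valueAfter w) r) ≈ ⌜ N ! ⌝ * (rate e * average e (expectedValue N) r)
      perBall e = begin-equality
        ∑[ words N ] (λ w → rate e * ∏[ w ] rate * average e (valueAfter w) r)
          ≈⟨ ∑-cong (words N) (λ w → trans (*-assoc (rate e) _ _) (*-congˡ (sym (average-*ˡ e (∏[ w ] rate) (valueAfter w) r)))) ⟩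
        ∑[ words N ] (λ w → rate e * average e (λ s → ∏[ w ] rate * valueAfter w s) r)
          ≈⟨ ∑-*ˡ (words N) (rate e) _ ⟩
        rate e * ∑[ words N ] (λ w → average e (λ s → ∏[ w ] rate * valueAfter w s) r)
          ≈⟨ *-congˡ (average-∑ e (words N) (λ w s → ∏[ w ] rate * valueAfter w s) r) ⟨
        rate e * average e (λ s → ∑[ words N ] (λ w → ∏[ w ] rate * valueAfter w s)) r
          ≈⟨ *-congˡ (average-cong e r (∑-words N)) ⟩
        rate e * average e (λ s → ⌜ N ! ⌝ * expectedValue N s) r
          ≈⟨ *-congˡ (average-*ˡ e ⌜ N ! ⌝ (expectedValue N) r) ⟩
        rate e * (⌜ N ! ⌝ * average e (expectedValue N) r)
          ≈⟨ solve 3 (λ a b c → a :* (b :* c) := b :* (a :* c)) refl (rate e) ⌜ N ! ⌝ _ ⟩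
        ⌜ N ! ⌝ * (rate e * average e (expectedValue N) r) ∎

    full : State
    full _ = c

    0≤Λ : 0# ≤ Λ
    0≤Λ = ∑-nonNeg (balls n k) 0≤rate

    -- Both sides are put on the common clock Λ + x: the process gets idle events
    -- at rate x, and the Poisson process of rate x gets idle events at rate Λ.
    module LowerBound (x : ℝ) (0≤x : 0# ≤ x) (rate-bound : ∀ v → ∑ᴮ (λ e → rate e * incidence e v) ≤ x) where

      -- The coefficient of tᴺ in exp((Λ + x)t) times the expected value after time t, starting from
      -- r.
      series : ℕ → State → ℝ
      series N r = conv (expTerm x) (λ i → expectedValue i r) N

      -- The coefficient of tⁱ in exp(xt) 𝐄 min{Poisson(xt), j}.
      capped : ℕ → ℕ → ℝ
      capped j i = expTerm x i * ⌜ i ⊓ j ⌝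

      cappedSeries : ℕ → ℕ → ℝ
      cappedSeries N j = conv (expTerm Λ) (capped j) N

      -- The backward equation: the first event of the common clock is idle at rate x or a ball of
      -- type e at rate λ_e.
      series-suc : ∀ N r → ⌜ suc N ⌝ * series (suc N) r ≈ x * series N r + ∑ᴮ (λ e → rate e * average e (series N) r)
      series-suc N r = begin-equality
        ⌜ suc N ⌝ * series (suc N) r
          ≈⟨ leibniz (expTerm x) (λ i → expectedValue i r) N ⟩
        conv (derivative (expTerm x)) (λ i → expectedValue i r) N + conv (expTerm x) (derivative (λ i → expectedValue i r)) N
          ≈⟨ +-cong (trans (conv-cong (derivative-expTerm x) (λ _ → refl) N) (conv-*ˡ x _ _ N))
                    (trans (conv-cong (λ _ → refl) (λ i → ⌜suc⌝-cancel i _) N) (conv-∑ʳ (expTerm x) (balls n k) (λ e i → rate e * average e (expectedValue i) r) N)) ⟩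
        x * series N r + ∑ᴮ (λ e → conv (expTerm x) (λ i → rate e * average e (expectedValue i) r) N)
          ≈⟨ +-congˡ (∑-cong (balls n k) λ e → trans (conv-*ʳ (rate e) (expTerm x) _ N) (*-congˡ (sym (average-conv e (expTerm x) expectedValue r N)))) ⟩
        x * series N r + ∑ᴮ (λ e → rate e * average e (series N) r) ∎

      -- For j > 0, min{i + 1, j} = 1 + min{i, j - 1}: the first event of the Poisson process uses
      -- one unit of the cap. For j = 0 everything vanishes.
      derivative-capped : ∀ j i → derivative (capped j) i ≈ x * (nonZero j * expTerm x i + capped (j ∸ 1) i)
      derivative-capped j i = trans (sym (*-assoc _ _ _)) (trans (*-congʳ (derivative-expTerm x i)) (step j))
        where
        step : ∀ j → x * expTerm x i * ⌜ suc i ⊓ j ⌝ ≈ x * (nonZero j * expTerm x i + capped (j ∸ 1) i)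
        step zero    = trans (solve 2 (λ x t → x :* t :* con (+ 0) := x :* (con (+ 0) :* t :+ t :* con (+ 0))) refl x (expTerm x i))
          (*-congˡ (+-cong (*-congʳ (sym nonZero-0)) (*-congˡ (⌜⌝-cong (≡.sym (ℕₚ.⊓-zeroʳ i))))))
        step (suc j) = trans (solve 3 (λ x t m → x :* t :* (con (+ 1) :+ m) := x :* (con (+ 1) :* t :+ t :* m)) refl x (expTerm x i) ⌜ i ⊓ j ⌝)
          (*-congˡ (+-congʳ (*-congʳ (sym (nonZero-suc j)))))

      cappedSeries-suc : ∀ N j →
        ⌜ suc N ⌝ * cappedSeries (suc N) j ≈ Λ * cappedSeries N j + x * (nonZero j * expTerm (Λ + x) N + cappedSeries N (j ∸ 1))
      cappedSeries-suc N j = begin-equality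
        ⌜ suc N ⌝ * cappedSeries (suc N) j
          ≈⟨ leibniz (expTerm Λ) (capped j) N ⟩
        conv (derivative (expTerm Λ)) (capped j) N + conv (expTerm Λ) (derivative (capped j)) N
          ≈⟨ +-cong (trans (conv-cong (derivative-expTerm Λ) (λ _ → refl) N) (conv-*ˡ Λ _ _ N))
                    (trans (conv-cong (λ _ → refl) (derivative-capped j) N) (conv-*ʳ x _ _ N)) ⟩
        Λ * cappedSeries N j + x * conv (expTerm Λ) (λ i → nonZero j * expTerm x i + capped (j ∸ 1) i) N
          ≈⟨ +-congˡ (*-congˡ (trans (conv-+ʳ (expTerm Λ) _ _ N) (+-congʳ (trans (conv-*ʳ (nonZero j) _ _ N) (*-congˡ (sym (expTerm-+ Λ x N))))))) ⟩
        Λ * cappedSeries N j + x * (nonZero j * expTerm (Λ + x) N + cappedSeries N (j ∸ 1)) ∎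

      cappedSeries-0 : ∀ N → cappedSeries N 0 ≈ 0#
      cappedSeries-0 N = trans (conv-cong (λ _ → refl) (λ i → trans (*-congˡ (⌜⌝-cong (ℕₚ.⊓-zeroʳ i))) (zeroʳ _)) N) (conv-0ʳ (expTerm Λ) N)

      cappedSeries-mono : ∀ N j → cappedSeries N j ≤ cappedSeries N (suc j)
      cappedSeries-mono N j = conv-monoʳ (0≤expTerm 0≤Λ)
        (λ i → *-monoˡ (0≤expTerm 0≤x i) (⌜⌝-mono (ℕₚ.⊓-monoʳ-≤ i (ℕₚ.n≤1+n j)))) N

      cappedSeries-concave : ∀ N j → cappedSeries N (suc (suc j)) + cappedSeries N j ≤ cappedSeries N (suc j) + cappedSeries N (suc j)
      cappedSeries-concave N j = begin
        cappedSeries N (suc (suc j)) + cappedSeries N j                        ≈⟨ conv-+ʳ (expTerm Λ) _ _ N ⟨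
        conv (expTerm Λ) (λ i → capped (suc (suc j)) i + capped j i) N         ≤⟨ conv-monoʳ (0≤expTerm 0≤Λ) concave N ⟩
        conv (expTerm Λ) (λ i → capped (suc j) i + capped (suc j) i) N         ≈⟨ conv-+ʳ (expTerm Λ) _ _ N ⟩
        cappedSeries N (suc j) + cappedSeries N (suc j)                        ∎
        where
        concave : ∀ i → capped (suc (suc j)) i + capped j i ≤ capped (suc j) i + capped (suc j) i
        concave i = begin
          t * ⌜ i ⊓ suc (suc j) ⌝ + t * ⌜ i ⊓ j ⌝        ≈⟨ merge (i ⊓ suc (suc j)) (i ⊓ j) ⟩
          t * ⌜ (i ⊓ suc (suc j)) ℕ.+ (i ⊓ j) ⌝          ≤⟨ *-monoˡ (0≤expTerm 0≤x i) (⌜⌝-mono (⊓-concave i j)) ⟩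
          t * ⌜ (i ⊓ suc j) ℕ.+ (i ⊓ suc j) ⌝            ≈⟨ merge (i ⊓ suc j) (i ⊓ suc j) ⟨
          t * ⌜ i ⊓ suc j ⌝ + t * ⌜ i ⊓ suc j ⌝          ∎
          where
          t : ℝ
          t = expTerm x i
          merge : ∀ p q → t * ⌜ p ⌝ + t * ⌜ q ⌝ ≈ t * ⌜ p ℕ.+ q ⌝
          merge p q = trans (sym (distribˡ t _ _)) (*-congˡ (sym (×-homo-+ 1# p q)))

      module StepAt (N : ℕ) = Step (cappedSeries N) (cappedSeries-0 N) (cappedSeries-mono N) (cappedSeries-concave N)
                                   x 0≤x rate-bound (expTerm (Λ + x) N)
      open StepAt using (potential; potential-growth)

      -- The coefficient at N = 0 is that of no remaining time, where `capped` vanishes and only the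
      -- value remains. The step is `potential-growth`; it refers to the states after one ball,
      -- hence the quantification over r.
      potential-≤-series : ∀ N r → (∀ v → r v ℕ.≤ c) → potential N r ≤ x * series N r
      potential-≤-series zero r r≤c = ≤-reflexive (begin-equality
        x * ⌜ value c r ⌝ * expTerm (Λ + x) 0 + ∑ᴮ (λ e → rate e * (expTerm Λ 0 * (expTerm x 0 * 0#)))
          ≈⟨ +-cong (trans (*-congˡ (expTerm-0 (Λ + x))) (*-identityʳ _))
               (trans (∑-cong (balls n k) λ e → solve 3 (λ a b c → a :* (b :* (c :* con (+ 0))) := con (+ 0)) refl (rate e) (expTerm Λ 0) (expTerm x 0)) (∑-0 (balls n k))) ⟩
        x * ⌜ value c r ⌝ + 0#
          ≈⟨ +-identityʳ _ ⟩
        x * ⌜ value c r ⌝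
          ≈⟨ *-congˡ (trans (*-congʳ (expTerm-0 x)) (*-identityˡ _)) ⟨
        x * series 0 r ∎)
      potential-≤-series (suc N) r r≤c = *-cancelˡ-≤ (0<⌜suc⌝ N) (begin
        ⌜ suc N ⌝ * (x * ⌜ value c r ⌝ * expTerm (Λ + x) (suc N) + ∑ᴮ (λ e → rate e * cappedSeries (suc N) (size r e)))
          ≈⟨ trans (distribˡ _ _ _) (+-cong
               (trans (solve 3 (λ m a t → m :* (a :* t) := a :* (m :* t)) refl ⌜ suc N ⌝ _ _) (*-congˡ (derivative-expTerm (Λ + x) N)))
               (trans (sym (∑-*ˡ (balls n k) ⌜ suc N ⌝ _)) (∑-cong (balls n k) λ e →
                 trans (solve 3 (λ m a t → m :* (a :* t) := a :* (m :* t)) refl ⌜ suc N ⌝ (rate e) _) (*-congˡ (cappedSeries-suc N (size r e)))))) ⟩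
        x * ⌜ value c r ⌝ * ((Λ + x) * expTerm (Λ + x) N)
          + ∑ᴮ (λ e → rate e * (Λ * cappedSeries N (size r e) + x * (nonZero (size r e) * expTerm (Λ + x) N + cappedSeries N (size r e ∸ 1))))
          ≤⟨ potential-growth N r r≤c ⟩
        x * potential N r + ∑ᴮ (λ e → rate e * average e (potential N) r)
          ≤⟨ +-mono (*-monoˡ 0≤x (potential-≤-series N r r≤c)) (∑-mono (balls n k) λ e → *-monoˡ (0≤rate e)
               (average-mono e {potential N} {λ s → x * series N s} r (potential-≤-series N r r≤c) λ v → potential-≤-series N (decrement v r) λ u → ℕₚ.≤-trans (decrement-≤ v r u) (r≤c u))) ⟩
        x * (x * series N r) + ∑ᴮ (λ e → rate e * average e (λ s → x * series N s) r)
          ≈⟨ +-congˡ (trans (∑-cong (balls n k) λ e → trans (*-congˡ (average-*ˡ e x (series N) r)) (solve 3 (λ a b c → a :* (b :* c) := b :* (a :* c)) refl (rate e) x _)) (∑-*ˡ (balls n k) x _)) ⟩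
        x * (x * series N r) + x * ∑ᴮ (λ e → rate e * average e (series N) r)
          ≈⟨ distribˡ x _ _ ⟨
        x * (x * series N r + ∑ᴮ (λ e → rate e * average e (series N) r))
          ≈⟨ *-congˡ (series-suc N r) ⟨
        x * (⌜ suc N ⌝ * series (suc N) r)
          ≈⟨ solve 3 (λ a b c → a :* (b :* c) := b :* (a :* c)) refl x ⌜ suc N ⌝ _ ⟩
        ⌜ suc N ⌝ * (x * series (suc N) r) ∎)

      -- Initially the value is 0 and every ball type sees the capacity ck.
      Λ*cappedSeries-≤ : ∀ N → Λ * cappedSeries N (c ℕ.* k) ≤ x * series N full
      Λ*cappedSeries-≤ N = begin
        Λ * cappedSeries N (c ℕ.* k)
          ≈⟨ ∑-*ʳ (balls n k) (cappedSeries N (c ℕ.* k)) rate ⟨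
        ∑ᴮ (λ e → rate e * cappedSeries N (c ℕ.* k))
          ≈⟨ ∑-cong (balls n k) (λ e → *-congˡ (reflexive (≡.cong (cappedSeries N) (≡.sym (size-const c e))))) ⟩
        ∑ᴮ (λ e → rate e * cappedSeries N (size full e))
          ≈⟨ +-identityˡ _ ⟨
        0# + ∑ᴮ (λ e → rate e * cappedSeries N (size full e))
          ≈⟨ +-congʳ (trans (*-congʳ (trans (*-congˡ (⌜⌝-cong (value-const c))) (zeroʳ x))) (zeroˡ _)) ⟨
        potential N full
          ≤⟨ potential-≤-series N full (λ _ → ℕₚ.≤-refl) ⟩
        x * series N full ∎

      -- The inequality between coefficients is summed over N, that is, taken at t = 1. On the left
      -- a rectangle of products is fitted into the triangle of the Cauchy product, on the right a
      -- triangle into a square, so only partial sums are compared. The factors exp Λ and exp x of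
      -- the common clock cancel at the end.
      lower-bound : ∀ {μ Q} → (∀ M → exp (- Λ) * partialSum (λ N → expectedValue N full) M ≤ μ) →
                    HasSum (capped (c ℕ.* k)) Q → (exp (- x) * Q) * Λ ≤ x * μ
      lower-bound {μ} {Q} partial-≤-μ hasSum = begin
        (exp (- x) * Q) * Λ
          ≈⟨ solve 3 (λ a q l → (a :* q) :* l := a :* (con (+ 1) :* (q :* l))) refl (exp (- x)) Q Λ ⟩
        exp (- x) * (1# * (Q * Λ))
          ≈⟨ *-congˡ (*-congʳ (exp-neg-* Λ)) ⟨
        exp (- x) * (exp (- Λ) * exp Λ * (Q * Λ))
          ≈⟨ *-congˡ (solve 4 (λ a b q l → a :* b :* (q :* l) := a :* ((q :* l) :* b)) refl (exp (- Λ)) (exp Λ) Q Λ) ⟩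
        exp (- x) * (exp (- Λ) * (Q * Λ * exp Λ))
          ≤⟨ *-monoˡ (exp-nonNeg (- x)) (*-monoˡ (exp-nonNeg (- Λ)) limits) ⟩
        exp (- x) * (exp (- Λ) * (x * (exp x * (exp Λ * μ))))
          ≈⟨ solve 6 (λ a b x c d m → a :* (b :* (x :* (c :* (d :* m)))) := (a :* c) :* ((b :* d) :* (x :* m))) refl (exp (- x)) (exp (- Λ)) x (exp x) (exp Λ) μ ⟩
        (exp (- x) * exp x) * ((exp (- Λ) * exp Λ) * (x * μ))
          ≈⟨ trans (*-cong (exp-neg-* x) (*-congʳ (exp-neg-* Λ))) (trans (*-identityˡ _) (*-identityˡ _)) ⟩
        x * μ ∎
        where
        S : ℝ → ℕ → ℝ
        S y = partialSum (expTerm y)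
        0≤capped : ∀ i → 0# ≤ capped (c ℕ.* k) i
        0≤capped i = *-nonNeg (0≤expTerm 0≤x i) (0≤⌜⌝ (i ⊓ (c ℕ.* k)))
        values-≤ : ∀ M → partialSum (λ N → expectedValue N full) M ≤ exp Λ * μ
        values-≤ M = begin
          partialSum (λ N → expectedValue N full) M
            ≈⟨ trans (*-congʳ (trans (*-comm _ _) (exp-neg-* Λ))) (*-identityˡ _) ⟨
          exp Λ * exp (- Λ) * partialSum (λ N → expectedValue N full) M
            ≈⟨ *-assoc _ _ _ ⟩
          exp Λ * (exp (- Λ) * partialSum (λ N → expectedValue N full) M)
            ≤⟨ *-monoˡ (exp-nonNeg Λ) (partial-≤-μ M) ⟩
          exp Λ * μ ∎
        truncated : ∀ M L → Λ * S Λ M * partialSum (capped (c ℕ.* k)) L ≤ x * (exp x * (exp Λ * μ))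
        truncated M L = begin
          Λ * S Λ M * partialSum (capped (c ℕ.* k)) L
            ≈⟨ *-assoc _ _ _ ⟩
          Λ * (S Λ M * partialSum (capped (c ℕ.* k)) L)
            ≤⟨ *-monoˡ 0≤Λ (≤-partialSum-conv (0≤expTerm 0≤Λ) 0≤capped M L) ⟩
          Λ * partialSum (λ N → cappedSeries N (c ℕ.* k)) (M ℕ.+ L)
            ≈⟨ partialSum-*ˡ Λ _ (M ℕ.+ L) ⟨
          partialSum (λ N → Λ * cappedSeries N (c ℕ.* k)) (M ℕ.+ L)
            ≤⟨ partialSum-mono Λ*cappedSeries-≤ (M ℕ.+ L) ⟩
          partialSum (λ N → x * series N full) (M ℕ.+ L)
            ≈⟨ partialSum-*ˡ x _ (M ℕ.+ L) ⟩
          x * partialSum (λ N → series N full) (M ℕ.+ L)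
            ≤⟨ *-monoˡ 0≤x (partialSum-conv-≤ (0≤expTerm 0≤x) (λ N → 0≤expectedValue N full) (ℕₚ.≤-refl {M ℕ.+ L})) ⟩
          x * (S x (M ℕ.+ L) * partialSum (λ N → expectedValue N full) (M ℕ.+ L))
            ≤⟨ *-monoˡ 0≤x (*-mono (partialSum-nonNeg (0≤expTerm 0≤x) (M ℕ.+ L)) (partialSum-≤-sum (0≤expTerm 0≤x) (exp-hasSum x) (M ℕ.+ L))
                 (values-≤ (M ℕ.+ L)) (≤-trans (partialSum-nonNeg (λ N → 0≤expectedValue N full) (M ℕ.+ L)) (values-≤ (M ℕ.+ L)))) ⟩
          x * (exp x * (exp Λ * μ)) ∎
        limits : Q * Λ * exp Λ ≤ x * (exp x * (exp Λ * μ))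
        limits = limit-≤ (Converges-*ˡ (Q * Λ) (exp-hasSum Λ)) 0 λ M _ → begin
          Q * Λ * S Λ M        ≈⟨ solve 3 (λ q l s → q :* l :* s := l :* s :* q) refl Q Λ (S Λ M) ⟩
          Λ * S Λ M * Q        ≤⟨ limit-≤ (Converges-*ˡ (Λ * S Λ M) hasSum) 0 (λ L _ → truncated M L) ⟩
          x * (exp x * (exp Λ * μ)) ∎

-- Finite additivity and its consequences

module ProbabilityProperties (R : CompleteOrderedField) (𝓟 : Probability.ProbabilitySpace R) where
  open CompleteOrderedField R
  open Probability.ProbabilitySpace 𝓟
  open Sums R
  open Limits R
  open Exponential.Convergence R using (+-mono)
  open PosetReasoning poset

  -- The countable union of copies of a null event A is A itself.
  ℙ-∅ : ∀ {A} (mA : Measurable A) → (∀ ω → ¬ A ω) → ℙ mA ≈ 0#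
  ℙ-∅ {A} mA ¬A = begin-equality
    ℙ mA                      ≈⟨ +-identityˡ _ ⟨
    0# + ℙ mA                 ≈⟨ +-congʳ (-‿inverseˡ l) ⟨
    (- l + l) + ℙ mA          ≈⟨ +-assoc _ _ _ ⟩
    - l + (l + ℙ mA)          ≈⟨ +-congˡ (limit-unique (Converges-+ sums (Converges-const (ℙ mA))) (Converges-suc sums)) ⟩
    - l + l                   ≈⟨ -‿inverseˡ l ⟩
    0#                        ∎
    where
    l : ℝ
    l = ℙ (measurable-⋃ (λ _ → mA))
    sums : HasSum (λ _ → ℙ mA) l
    sums = ℙ-⋃ (λ _ → mA) (λ _ ω (Aω , _) → ¬A ω Aω)

  ∅-measurable : Measurable (λ _ → ⊥)
  ∅-measurable = measurable-resp ((λ ¬⊤ → ¬⊤ _) , λ ()) (measurable-∁ measurable-U)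

  ℙ-∪ : ∀ {A B C} (mA : Measurable A) (mB : Measurable B) (mC : Measurable C) →
        (∀ ω → A ω → ¬ B ω) → (∀ ω → C ω → A ω ⊎ B ω) → (∀ ω → A ω → C ω) → (∀ ω → B ω → C ω) →
        ℙ mC ≈ ℙ mA + ℙ mB
  ℙ-∪ {A} {B} {C} mA mB mC disjoint C⊆A∪B A⊆C B⊆C = begin-equality
    ℙ mC                     ≈⟨ ℙ-cong mC (measurable-⋃ mEvents) ((λ {ω} → into ω) , λ {ω} → out ω) ⟩
    ℙ (measurable-⋃ mEvents) ≈⟨ limit-unique (ℙ-⋃ mEvents events-disjoint) (Converges-eventually 2 finite) ⟩
    ℙ mA + ℙ mB              ∎
    where
    events : ℕ → Pred Ω 0ℓ
    events 0             = A
    events 1             = B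
    events (suc (suc _)) = λ _ → ⊥
    mEvents : ∀ i → Measurable (events i)
    mEvents 0             = mA
    mEvents 1             = mB
    mEvents (suc (suc _)) = ∅-measurable
    into : ∀ ω → C ω → ⋃ ℕ events ω
    into ω Cω with C⊆A∪B ω Cω
    ... | inj₁ Aω = 0 , Aω
    ... | inj₂ Bω = 1 , Bω
    out : ∀ ω → ⋃ ℕ events ω → C ω
    out ω (0 , Aω) = A⊆C ω Aω
    out ω (1 , Bω) = B⊆C ω Bω
    events-disjoint : ∀ {i j} → ¬ i ≡ j → events i ⊥′ events j
    events-disjoint {0}           {0}           i≢j ω _         = i≢j ≡.refl
    events-disjoint {0}           {1}           i≢j ω (Aω , Bω) = disjoint ω Aω Bω
    events-disjoint {1}           {0}           i≢j ω (Bω , Aω) = disjoint ω Aω Bω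
    events-disjoint {1}           {1}           i≢j ω _         = i≢j ≡.refl
    events-disjoint {0}           {suc (suc _)} i≢j ω (_ , ())
    events-disjoint {1}           {suc (suc _)} i≢j ω (_ , ())
    events-disjoint {suc (suc _)} {_}           i≢j ω (() , _)
    finite : ∀ m → 2 ℕ.≤ m → partialSum (λ i → ℙ (mEvents i)) m ≈ ℙ mA + ℙ mB
    finite (suc zero)          (ℕ.s≤s ())
    finite (suc (suc zero))    _ = +-congʳ (+-identityˡ _)
    finite (suc (suc (suc m))) (ℕ.s≤s (ℕ.s≤s _)) =
      trans (+-cong (finite (suc (suc m)) (ℕ.s≤s (ℕ.s≤s ℕ.z≤n))) (ℙ-∅ ∅-measurable (λ _ ()))) (+-identityʳ _)

  ∩-measurable : ∀ {A B} → Measurable A → Measurable B → Measurable (λ ω → A ω × B ω)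
  ∩-measurable {A} {B} mA mB = measurable-resp ((λ p → p 0 , p 1) , λ (Aω , Bω) → λ { zero → Aω ; (suc _) → Bω }) (measurable-⋂ mEvents)
    where
    events : ℕ → Pred Ω 0ℓ
    events zero    = A
    events (suc _) = B
    mEvents : ∀ i → Measurable (events i)
    mEvents zero    = mA
    mEvents (suc _) = mB

  ∖-measurable : ∀ {A B} → Measurable A → Measurable B → Measurable (λ ω → B ω × ¬ A ω)
  ∖-measurable mA mB = ∩-measurable mB (measurable-∁ mA)

  -- The decision procedure for A takes the place of excluded middle when B is split; this is why
  -- the events below come with one.
  ℙ-∖ : ∀ {A B} (mA : Measurable A) (mB : Measurable B) → Decidable A → (∀ ω → A ω → B ω) →
        ℙ mB ≈ ℙ mA + ℙ (∖-measurable mA mB)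
  ℙ-∖ {A} {B} mA mB A? A⊆B = ℙ-∪ mA (∖-measurable mA mB) mB (λ ω Aω (_ , ¬Aω) → ¬Aω Aω) cover A⊆B (λ ω → proj₁)
    where
    cover : ∀ ω → B ω → A ω ⊎ (B ω × ¬ A ω)
    cover ω Bω with A? ω
    ... | yes Aω = inj₁ Aω
    ... | no ¬Aω = inj₂ (Bω , ¬Aω)

  ℙ-mono : ∀ {A B} (mA : Measurable A) (mB : Measurable B) → Decidable A → (∀ ω → A ω → B ω) → ℙ mA ≤ ℙ mB
  ℙ-mono mA mB A? A⊆B = begin
    ℙ mA                                ≈⟨ +-identityʳ _ ⟨
    ℙ mA + 0#                           ≤⟨ +-mono ≤-refl (ℙ-nonNeg _) ⟩
    ℙ mA + ℙ (∖-measurable mA mB)       ≈⟨ ℙ-∖ mA mB A? A⊆B ⟨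
    ℙ mB                                ∎

  module _ {I : Set} {A : I → Pred Ω 0ℓ} (mA : ∀ i → Measurable (A i)) (A? : ∀ i → Decidable (A i)) where

    ∑ℙ-≤ : ∀ {xs} → Unique xs → (∀ {i j} ω → A i ω → A j ω → i ≡ j) →
           ∀ {B} (mB : Measurable B) → (∀ {i} → i ∈ xs → ∀ ω → A i ω → B ω) → ∑[ xs ] (λ i → ℙ (mA i)) ≤ ℙ mB
    ∑ℙ-≤ []          disjoint mB A⊆B = ℙ-nonNeg mB
    ∑ℙ-≤ {x ∷ xs} (x∉xs ∷ uxs) disjoint mB A⊆B = begin
      ℙ (mA x) + ∑[ xs ] (λ i → ℙ (mA i))
        ≤⟨ +-mono ≤-refl (∑ℙ-≤ uxs disjoint (∖-measurable (mA x) mB) λ i∈xs ω Aᵢω →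
             A⊆B (there i∈xs) ω Aᵢω , λ Aₓω → All.lookup x∉xs i∈xs (disjoint ω Aₓω Aᵢω)) ⟩
      ℙ (mA x) + ℙ (∖-measurable (mA x) mB)
        ≈⟨ ℙ-∖ (mA x) mB (A? x) (A⊆B (here ≡.refl)) ⟨
      ℙ mB ∎

    ℙ-≤∑ : ∀ xs {B} (mB : Measurable B) → Decidable B → (∀ ω → B ω → ∃ λ i → i ∈ xs × A i ω) → ℙ mB ≤ ∑[ xs ] (λ i → ℙ (mA i))
    ℙ-≤∑ [] mB B? B⊆A = ≤-reflexive (ℙ-∅ mB λ ω Bω → case-∅ (B⊆A ω Bω))
      where
      case-∅ : ∀ {ω} → (∃ λ i → i ∈ [] × A i ω) → ⊥
      case-∅ (_ , () , _)
    ℙ-≤∑ (x ∷ xs) {B} mB B? B⊆A = begin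
      ℙ mB
        ≈⟨ ℙ-∪ (∩-measurable mB (mA x)) (∖-measurable (mA x) mB) mB (λ ω (_ , Aω) (_ , ¬Aω) → ¬Aω Aω) cover (λ _ → proj₁) (λ _ → proj₁) ⟩
      ℙ (∩-measurable mB (mA x)) + ℙ (∖-measurable (mA x) mB)
        ≤⟨ +-mono (ℙ-mono _ (mA x) (λ ω → B? ω ×-dec A? x ω) (λ _ → proj₂))
                  (ℙ-≤∑ xs (∖-measurable (mA x) mB) (λ ω → B? ω ×-dec ¬? (A? x ω)) λ ω (Bω , ¬Aₓω) → rest ω ¬Aₓω (B⊆A ω Bω)) ⟩
      ℙ (mA x) + ∑[ xs ] (λ i → ℙ (mA i)) ∎
      where
      cover : ∀ ω → B ω → (B ω × A x ω) ⊎ (B ω × ¬ A x ω)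
      cover ω Bω with A? x ω
      ... | yes Aω = inj₁ (Bω , Aω)
      ... | no ¬Aω = inj₂ (Bω , ¬Aω)
      rest : ∀ ω → ¬ A x ω → (∃ λ i → i ∈ x ∷ xs × A i ω) → ∃ λ i → i ∈ xs × A i ω
      rest ω ¬Aₓω (i , here ≡.refl , Aᵢω)  = ⊥-elim (¬Aₓω Aᵢω)
      rest ω ¬Aₓω (i , there i∈xs , Aᵢω)   = i , i∈xs , Aᵢω

-- Expected value along the histories of Proportional Greedy

Ball-≡ : ∀ {n k} {e f : Ball n k} → proj₁ e ≡ proj₁ f → e ≡ f
Ball-≡ {e = _ , p} {f = _ , q} ≡.refl = ≡.cong (_ ,_) (ℕₚ.≡-irrelevant p q)

_≟ᵉ_ : ∀ {n k} (e f : Ball n k) → Dec (e ≡ f)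
e ≟ᵉ f = Dec.map′ Ball-≡ (≡.cong proj₁) (e ≟ᴮ f)

drop-length-++ : {A : Set} (xs ys : List A) → drop (length xs) (xs ++ ys) ≡ ys
drop-length-++ []       ys = ≡.refl
drop-length-++ (x ∷ xs) ys = drop-length-++ xs ys

load-∷ʳ-≡ : ∀ {n k} (h : History n k) e v → load v (h ++ (e , v) ∷ []) ≡ suc (load v h)
load-∷ʳ-≡ []            e v with v Finₚ.≟ v
... | yes _  = ≡.refl
... | no v≢v = ⊥-elim (v≢v ≡.refl)
load-∷ʳ-≡ ((_ , u) ∷ h) e v with does (u Finₚ.≟ v)
... | true  = ≡.cong suc (load-∷ʳ-≡ h e v)
... | false = load-∷ʳ-≡ h e v

load-∷ʳ-≢ : ∀ {n k} (h : History n k) e {u v} → ¬ v ≡ u → load u (h ++ (e , v) ∷ []) ≡ load u h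
load-∷ʳ-≢ []            e {u} {v} v≢u with v Finₚ.≟ u
... | yes v≡u = ⊥-elim (v≢u v≡u)
... | no _    = ≡.refl
load-∷ʳ-≢ ((_ , w) ∷ h) e {u} v≢u with does (w Finₚ.≟ u)
... | true  = ≡.cong suc (load-∷ʳ-≢ h e v≢u)
... | false = load-∷ʳ-≢ h e v≢u

remaining-∷ʳ : ∀ {n k} c (h : History n k) e v u →
               remaining c u (h ++ (e , v) ∷ []) ≡ States.decrement {n} {k} v (λ w → remaining c w h) u
remaining-∷ʳ c h e v u with u Finₚ.≟ v
... | yes ≡.refl = ≡.trans (≡.cong (c ∸_) (≡.trans (load-∷ʳ-≡ h e v) (ℕₚ.+-comm 1 (load v h)))) (≡.sym (ℕₚ.∸-+-assoc c (load v h) 1))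
... | no u≢v     = ≡.cong (c ∸_) (load-∷ʳ-≢ h e (λ v≡u → u≢v (≡.sym v≡u)))

⊓≡∸∸ : ∀ l c → l ⊓ c ≡ c ∸ (c ∸ l)
⊓≡∸∸ l c = ≡.trans (≡.sym (ℕₚ.m+n∸n≡m (l ⊓ c) (c ∸ l))) (≡.cong (_∸ (c ∸ l)) (ℕₚ.m⊓n+n∸m≡n l c))

module _ (R : CompleteOrderedField) (n k : ℕ) where
  open CompleteOrderedField R
  open BallsIntoBins R n k

  module GreedyValue (c : ℕ) (rate : Rates) (0≤rate : ∀ e → 0# ≤ rate e)
                     (𝓟 : Probability.ProbabilitySpace R) (process : Process 𝓟 rate)
                     (greedy : ProportionalGreedy c process) where
    open Probability.ProbabilitySpace 𝓟
    open Process process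
    open ProbabilityProperties R 𝓟
    open Sums R
    open Limits R
    open States {n} {k}
    open Potential R c rate 0≤rate
    open ExpectedValue R c rate 0≤rate
    open Exponential.Convergence R using (+-mono; *-monoˡ; 0≤⌜⌝; ⌜⌝≉0)
    open IntegerCoefficientSolver commutativeRing
    open PosetReasoning poset

    outcome : Ω → History n k
    outcome ω = history (arrivals ω)

    total : History n k → ℕ
    total h = sum (map (λ v → load v h ⊓ c) (allFin n))

    total-≤ : ∀ h → total h ℕ.≤ c ℕ.* n
    total-≤ h = ≡.subst (λ m → total h ℕ.≤ c ℕ.* m) (Listₚ.length-tabulate (λ (v : Fin n) → v)) (bound (allFin n))
      where
      bound : ∀ vs → sum (map (λ v → load v h ⊓ c) vs) ℕ.≤ c ℕ.* length vs
      bound []       = ℕ.z≤n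
      bound (v ∷ vs) = ℕₚ.≤-trans (ℕₚ.+-mono-≤ (ℕₚ.m⊓n≤n (load v h) c) (bound vs)) (ℕₚ.≤-reflexive (≡.sym (ℕₚ.*-suc c (length vs))))

    total-value : ∀ {h r} → (∀ v → remaining c v h ≡ r v) → total h ≡ value c r
    total-value {h} rem = sum-map-cong _ _ (allFin n) λ {v} _ → ≡.trans (⊓≡∸∸ (load v h) c) (≡.cong (c ∸_) (rem v))

    -- The expectation of `total` restricted to the event S, a finite sum because `total` never
    -- exceeds c n.
    expectationOn : Pred (History n k) 0ℓ → ℝ
    expectationOn S = partialSum (λ j → ⌜ j ⌝ * probability (λ h → total h ≡ j × S h)) (suc (c ℕ.* n))

    expectation : ℝ
    expectation = partialSum (λ j → ⌜ j ⌝ * probability (λ h → total h ≡ j)) (suc (c ℕ.* n))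

    hasExpectation : HasExpectation (λ ω → total (outcome ω)) expectation
    hasExpectation = (λ j → measurable (λ h → total h ≡ j)) , Converges-eventually (suc (c ℕ.* n)) constant
      where
      f : ℕ → ℝ
      f j = ⌜ j ⌝ * probability (λ h → total h ≡ j)
      constant′ : ∀ {m} → suc (c ℕ.* n) ℕ.≤′ m → partialSum f m ≈ expectation
      constant′ ℕ.≤′-refl = refl
      constant′ (ℕ.≤′-step {m} p) = trans (+-cong (constant′ p) (trans (*-congˡ null) (zeroʳ _))) (+-identityʳ _)
        where
        null : probability (λ h → total h ≡ m) ≈ 0#
        null = ℙ-∅ _ λ ω eq → ℕₚ.<-irrefl ≡.refl (ℕₚ.≤-trans (ℕₚ.≤′⇒≤ p) (≡.subst (ℕ._≤ c ℕ.* n) eq (total-≤ (outcome ω))))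
      constant : ∀ m → suc (c ℕ.* n) ℕ.≤ m → partialSum f m ≈ expectation
      constant m p = constant′ (ℕₚ.≤⇒≤′ p)

    expectationOn-≤ : ∀ {S} → Decidable S → expectationOn S ≤ expectation
    expectationOn-≤ S? = partialSum-mono (λ j → *-monoˡ (0≤⌜⌝ j)
      (ℙ-mono _ _ (λ ω → (total (outcome ω) ℕ.≟ j) ×-dec S? (outcome ω)) (λ _ → proj₁))) (suc (c ℕ.* n))

    module _ {I : Set} {S : I → Pred (History n k) 0ℓ} (S? : ∀ i → Decidable (S i))
             (disjoint : ∀ {i j} h → S i h → S j h → i ≡ j) {xs : List I} (uxs : Unique xs) where

      ∑-expectationOn-≤ : ∀ {T} → (∀ {i} → i ∈ xs → ∀ h → S i h → T h) → ∑[ xs ] (λ i → expectationOn (S i)) ≤ expectationOn T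
      ∑-expectationOn-≤ {T} S⊆T = begin
        ∑[ xs ] (λ i → expectationOn (S i))
          ≈⟨ partialSum-∑ (suc (c ℕ.* n)) xs _ ⟨
        partialSum (λ j → ∑[ xs ] (λ i → ⌜ j ⌝ * probability (λ h → total h ≡ j × S i h))) (suc (c ℕ.* n))
          ≤⟨ partialSum-mono (λ j → ≤-trans (≤-reflexive (∑-*ˡ xs ⌜ j ⌝ _)) (*-monoˡ (0≤⌜⌝ j)
               (∑ℙ-≤ (λ i → measurable (λ h → total h ≡ j × S i h)) (λ i ω → (total (outcome ω) ℕ.≟ j) ×-dec S? i (outcome ω)) uxs
                 (λ ω (_ , p) (_ , q) → disjoint (outcome ω) p q) (measurable (λ h → total h ≡ j × T h))
                 (λ i∈xs ω (p , q) → p , S⊆T i∈xs (outcome ω) q)))) (suc (c ℕ.* n)) ⟩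
        expectationOn T ∎

    ≤-expectationOn : ∀ {S j} → Decidable S → (∀ h → S h → total h ≡ j) → j ℕ.≤ c ℕ.* n → probability S * ⌜ j ⌝ ≤ expectationOn S
    ≤-expectationOn {S} {j} S? total≡j j≤ = begin
      probability S * ⌜ j ⌝
        ≈⟨ *-comm _ _ ⟩
      ⌜ j ⌝ * probability S
        ≤⟨ *-monoˡ (0≤⌜⌝ j) (ℙ-mono _ _ (λ ω → S? (outcome ω)) λ ω Sω → total≡j (outcome ω) Sω , Sω) ⟩
      f j
        ≈⟨ +-identityˡ _ ⟨
      0# + f j
        ≤⟨ +-monoˡ-≤ (f j) (partialSum-nonNeg 0≤f j) ⟩
      partialSum f (suc j)
        ≤⟨ partialSum-≤ 0≤f (ℕ.s≤s j≤) ⟩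
      expectationOn S ∎
      where
      f : ℕ → ℝ
      f j = ⌜ j ⌝ * probability (λ h → total h ≡ j × S h)
      0≤f : ∀ j → 0# ≤ f j
      0≤f j = *-nonNeg (0≤⌜⌝ j) (ℙ-nonNeg _)

    -- The only candidate for the unknown rest is `drop (length h) full`.
    Situation? : ∀ h es → Decidable (Situation h es)
    Situation? h es full = Dec.map′ (λ (p , q) → drop (length h) full , p , q) from
      (Listₚ.≡-dec (Productₚ.≡-dec _≟ᵉ_ Finₚ._≟_) full (h ++ drop (length h) full) ×-dec
       Listₚ.≡-dec _≟ᵉ_ (map proj₁ (drop (length h) full)) es)
      where
      from : Situation h es full → full ≡ h ++ drop (length h) full × map proj₁ (drop (length h) full) ≡ es
      from (rest , ≡.refl , types) = ≡.cong (h ++_) (≡.sym (drop-length-++ h rest)) ,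
        ≡.trans (≡.cong (map proj₁) (drop-length-++ h rest)) types

    0≤probability : ∀ S → 0# ≤ probability S
    0≤probability S = ℙ-nonNeg (measurable S)

    outcome-valid : ∀ as → All (λ (e , v) → e ∋ v) (history as)
    outcome-valid as = Allₚ.map⁺ (All.universal Arrival.bin∈ball as)

    bins : Ball n k → List (Fin n)
    bins e = filter (e ∋?_) (allFin n)

    next : History n k → Ball n k → List (Ball n k) → Fin n → Pred (History n k) 0ℓ
    next h e es v = Situation (h ++ (e , v) ∷ []) es

    next-⊆ : ∀ h e es v full → next h e es v full → Situation h (e ∷ es) full
    next-⊆ h e es v full (rest , ≡.refl , types) = (e , v) ∷ rest , Listₚ.++-assoc h _ rest , ≡.cong (e ∷_) types

    next-disjoint : ∀ h e es {u v} full → next h e es u full → next h e es v full → u ≡ v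
    next-disjoint h e es {u} {v} full (r , p , _) (s , q , _) = Productₚ.,-injectiveʳ (Listₚ.∷-injectiveˡ
      (Listₚ.++-cancelˡ h _ _ (≡.trans (≡.sym (Listₚ.++-assoc h _ r)) (≡.trans (≡.trans (≡.sym p) q) (Listₚ.++-assoc h _ s)))))

    -- By `bin∈ball`, every recorded bin belongs to its ball, whatever the allocation rule does when
    -- all bins are full.
    next-cover : ∀ h e es ω → Situation h (e ∷ es) (outcome ω) → ∃ λ v → v ∈ bins e × next h e es v (outcome ω)
    next-cover h e es ω ((.e , v) ∷ rest , p , ≡.refl) = v , ∈-filter⁺ (e ∋?_) (∈-allFin v) e∋v , rest , ≡.trans p (≡.sym (Listₚ.++-assoc h _ rest)) , ≡.refl
      where
      e∋v : e ∋ v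
      e∋v = All.head (Allₚ.++⁻ʳ h (≡.subst (All _) p (outcome-valid (arrivals ω))))

    -- Induction on the ball types to come. The state is tied to h only pointwise, since functions
    -- in `State` cannot be identified by `≡` from their values. The events `next h e es v` are
    -- disjoint parts of the situation, so their expectations add up to at most its own.
    expectationOn-Situation : ∀ es h r → (∀ v → remaining c v h ≡ r v) →
                              probability (Situation h es) * valueAfter es r ≤ expectationOn (Situation h es)
    expectationOn-Situation [] h r rem = ≤-trans (≤-reflexive (*-congˡ (⌜⌝-cong (≡.sym (total-value {h} {r} rem)))))
      (≤-expectationOn (Situation? h []) (λ { full ([] , ≡.refl , _) → ≡.cong total (Listₚ.++-identityʳ h) }) (total-≤ h))
    expectationOn-Situation (e ∷ es) h r rem = begin
      p * (isZero (size r e) * g r + reciprocal (size r e) * ∑ⱽ (λ v → incidence e v * ⌜ r v ⌝ * g (decrement v r)))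
        ≈⟨ *-congˡ (+-congˡ (*-congˡ (trans (∑-cong (allFin n) λ v → *-assoc _ _ _) (sym (∑-filter (e ∋?_) (allFin n) _))))) ⟩
      p * (isZero (size r e) * g r + reciprocal (size r e) * ∑[ bins e ] (λ v → ⌜ r v ⌝ * g (decrement v r)))
        ≤⟨ branches (size r e) ≡.refl ⟩
      ∑[ bins e ] (λ v → expectationOn (next h e es v))
        ≤⟨ ∑-expectationOn-≤ (λ v → Situation? (h ++ (e , v) ∷ []) es) (next-disjoint h e es)
             (Uniqueₚ.filter⁺ (e ∋?_) (Uniqueₚ.allFin⁺ n)) (λ {v} _ → next-⊆ h e es v) ⟩
      expectationOn (Situation h (e ∷ es)) ∎
      where
      g : State → ℝ
      g = valueAfter es
      p : ℝ
      p = probability (Situation h (e ∷ es))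
      branches : ∀ s → size r e ≡ s →
        p * (isZero s * g r + reciprocal s * ∑[ bins e ] (λ v → ⌜ r v ⌝ * g (decrement v r))) ≤ ∑[ bins e ] (λ v → expectationOn (next h e es v))
      -- All bins of e are full: whichever bin is chosen, the truncated remaining capacities stay as
      -- they are, and it is enough that some bin of e is chosen.
      branches zero size≡0 = begin
        p * (1# * g r + reciprocal 0 * ∑[ bins e ] (λ v → ⌜ r v ⌝ * g (decrement v r)))
          ≤⟨ *-monoˡ (0≤probability _) (+-mono ≤-refl (*-monoˡ (0≤reciprocal 0) (∑-mono-∈ (bins e) λ v∈e →
               ≤-reflexive (trans (*-congʳ (⌜⌝-cong (empty v∈e))) (zeroˡ _))))) ⟩
        p * (1# * g r + reciprocal 0 * ∑[ bins e ] (λ v → 0#))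
          ≈⟨ *-congˡ (trans (+-cong (*-identityˡ _) (trans (*-congˡ (∑-0 (bins e))) (zeroʳ _))) (+-identityʳ _)) ⟩
        p * g r
          ≤⟨ *-monoʳ (0≤valueAfter es r) (ℙ-≤∑ (λ v → measurable (next h e es v)) (λ v ω → Situation? (h ++ (e , v) ∷ []) es (outcome ω)) (bins e)
               _ (λ ω → Situation? h (e ∷ es) (outcome ω)) (next-cover h e es)) ⟩
        ∑[ bins e ] (λ v → probability (next h e es v)) * g r
          ≈⟨ ∑-*ʳ (bins e) (g r) _ ⟨
        ∑[ bins e ] (λ v → probability (next h e es v) * g r)
          ≤⟨ ∑-mono-∈ (bins e) (λ {v} v∈e → expectationOn-Situation es (h ++ (e , v) ∷ []) r (unchanged v∈e)) ⟩
        ∑[ bins e ] (λ v → expectationOn (next h e es v)) ∎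
        where
        empty : ∀ {v} → v ∈ bins e → r v ≡ 0
        empty {v} v∈e with r v in eq
        ... | zero  = ≡.refl
        ... | suc s with ≡.trans (≡.sym size≡0) (size-decrement-∈ r e (proj₂ (∈-filter⁻ (e ∋?_) {xs = allFin n} v∈e)) eq)
        ... | ()
        unchanged : ∀ {v} → v ∈ bins e → ∀ u → remaining c u (h ++ (e , v) ∷ []) ≡ r u
        unchanged {v} v∈e u with u Finₚ.≟ v | remaining-∷ʳ c h e v u
        ... | yes ≡.refl | eq = ≡.trans eq (≡.trans (≡.cong (_∸ 1) (≡.trans (rem v) (empty v∈e))) (≡.sym (empty v∈e)))
        ... | no _       | eq = ≡.trans eq (rem u)
      branches (suc s) size≡1+s = begin
        p * (0# * g r + ρ * ∑[ bins e ] (λ v → ⌜ r v ⌝ * g (decrement v r)))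
          ≈⟨ solve 4 (λ p a ρ s → p :* (con (+ 0) :* a :+ ρ :* s) := (p :* ρ) :* s) refl p (g r) ρ _ ⟩
        (p * ρ) * ∑[ bins e ] (λ v → ⌜ r v ⌝ * g (decrement v r))
          ≈⟨ ∑-*ˡ (bins e) (p * ρ) _ ⟨
        ∑[ bins e ] (λ v → (p * ρ) * (⌜ r v ⌝ * g (decrement v r)))
          ≤⟨ ∑-mono-∈ (bins e) branch ⟩
        ∑[ bins e ] (λ v → expectationOn (next h e es v)) ∎
        where
        ρ : ℝ
        ρ = reciprocal (suc s)
        size≡ : remainingIn c e h ≡ suc s
        size≡ = ≡.trans (sum-map-cong _ r (bins e) (λ {v} _ → rem v)) size≡1+s
        -- The defining equation of the algorithm, divided by the positive remaining capacity of e.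
        choice : ∀ {v} → v ∈ bins e → p * ⌜ r v ⌝ * ρ ≈ probability (next h e es v)
        choice {v} v∈e = begin-equality
          p * ⌜ r v ⌝ * ρ
            ≈⟨ *-congʳ (*-congˡ (⌜⌝-cong (rem v))) ⟨
          p * ⌜ remaining c v h ⌝ * ρ
            ≈⟨ *-congʳ (greedy h e es v (proj₂ (∈-filter⁻ (e ∋?_) {xs = allFin n} v∈e))) ⟨
          probability (next h e es v) * ⌜ remainingIn c e h ⌝ * ρ
            ≈⟨ trans (*-assoc _ _ _) (*-congˡ (*-congʳ (⌜⌝-cong size≡))) ⟩
          probability (next h e es v) * (⌜ suc s ⌝ * ρ)
            ≈⟨ trans (*-congˡ (⁻¹-inverseʳ (⌜⌝≉0 (suc s) (ℕ.s≤s ℕ.z≤n)))) (*-identityʳ _) ⟩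
          probability (next h e es v) ∎
        branch : ∀ {v} → v ∈ bins e → (p * ρ) * (⌜ r v ⌝ * g (decrement v r)) ≤ expectationOn (next h e es v)
        branch {v} v∈e = begin
          (p * ρ) * (⌜ r v ⌝ * g (decrement v r))        ≈⟨ solve 4 (λ p ρ s a → (p :* ρ) :* (s :* a) := (p :* s :* ρ) :* a) refl p ρ ⌜ r v ⌝ (g (decrement v r)) ⟩
          p * ⌜ r v ⌝ * ρ * g (decrement v r)            ≈⟨ *-congʳ (choice v∈e) ⟩
          probability (next h e es v) * g (decrement v r) ≤⟨ expectationOn-Situation es (h ++ (e , v) ∷ []) (decrement v r) decremented ⟩
          expectationOn (next h e es v)                  ∎
          where
          decremented : ∀ u → remaining c u (h ++ (e , v) ∷ []) ≡ decrement v r u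
          decremented u with u Finₚ.≟ v | remaining-∷ʳ c h e v u
          ... | yes ≡.refl | eq = ≡.trans eq (≡.cong (_∸ 1) (rem v))
          ... | no _       | eq = ≡.trans eq (rem u)

-- Placing a word of ball types into the cells of a grid

module _ {B : Set} where

  placed : ∀ {m} → Vec (Maybe B) m → List B
  placed []            = []
  placed (nothing ∷ σ) = placed σ
  placed (just e ∷ σ)  = e ∷ placed σ

  -- The placements of the word into m cells in order, at most one letter per cell; their number is
  -- the binomial coefficient of m over the length of the word.
  placements : ∀ m → List B → List (Vec (Maybe B) m)
  placements zero    []       = [] ∷ []
  placements zero    (_ ∷ _)  = []
  placements (suc m) []       = map (nothing ∷_) (placements m [])
  placements (suc m) (e ∷ es) = map (nothing ∷_) (placements m (e ∷ es)) ++ map (just e ∷_) (placements m es)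

  placements-unique : ∀ m es → Unique (placements m es)
  placements-unique zero    []       = [] ∷ []
  placements-unique zero    (e ∷ es) = []
  placements-unique (suc m) []       = Uniqueₚ.map⁺ Vecₚ.∷-injectiveʳ (placements-unique m [])
  placements-unique (suc m) (e ∷ es) = Uniqueₚ.++⁺
    (Uniqueₚ.map⁺ Vecₚ.∷-injectiveʳ (placements-unique m (e ∷ es)))
    (Uniqueₚ.map⁺ Vecₚ.∷-injectiveʳ (placements-unique m es))
    λ (p , q) → let (_ , _ , σ≡) = ∈-map⁻ (nothing ∷_) p
                    (_ , _ , τ≡) = ∈-map⁻ (just e ∷_) q
                in case Vecₚ.∷-injectiveˡ (≡.trans (≡.sym σ≡) τ≡) of λ ()

  placements-placed : ∀ m es {σ} → σ ∈ placements m es → placed σ ≡ es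
  placements-placed zero    []       {[]} _ = ≡.refl
  placements-placed (suc m) []       σ∈ with ∈-map⁻ (nothing ∷_) σ∈
  ... | τ , τ∈ , ≡.refl = placements-placed m [] τ∈
  placements-placed (suc m) (e ∷ es) σ∈ with ∈-++⁻ (map (nothing ∷_) (placements m (e ∷ es))) σ∈
  ... | inj₁ σ∈ˡ with ∈-map⁻ (nothing ∷_) σ∈ˡ
  ...   | τ , τ∈ , ≡.refl = placements-placed m (e ∷ es) τ∈
  placements-placed (suc m) (e ∷ es) σ∈ | inj₂ σ∈ʳ with ∈-map⁻ (just e ∷_) σ∈ʳ
  ...   | τ , τ∈ , ≡.refl = ≡.cong (e ∷_) (placements-placed m es τ∈)

  #placements : ℕ → List B → ℕ
  #placements m es = length (placements m es)

  #placements-[] : ∀ m → #placements (suc m) [] ≡ #placements m []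
  #placements-[] m = Listₚ.length-map (nothing ∷_) (placements m [])

  #placements-∷ : ∀ m e es → #placements (suc m) (e ∷ es) ≡ #placements m (e ∷ es) ℕ.+ #placements m es
  #placements-∷ m e es = ≡.trans (Listₚ.length-++ (map (nothing ∷_) (placements m (e ∷ es))))
    (≡.cong₂ ℕ._+_ (Listₚ.length-map (nothing ∷_) (placements m (e ∷ es))) (Listₚ.length-map (just e ∷_) (placements m es)))

  -- The absorption identity of binomial coefficients.
  #placements-absorb : ∀ m e es → suc (length es) ℕ.* #placements (suc m) (e ∷ es) ≡ suc m ℕ.* #placements m es
  #placements-absorb zero    e []       = ≡.refl
  #placements-absorb zero    e (f ∷ es) = ℕₚ.*-zeroʳ (length es)
  #placements-absorb (suc m) e es = begin
    suc l ℕ.* #placements (suc (suc m)) (e ∷ es)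
      ≡⟨ ≡.cong (suc l ℕ.*_) (#placements-∷ (suc m) e es) ⟩
    suc l ℕ.* (#placements (suc m) (e ∷ es) ℕ.+ a)
      ≡⟨ ℕₚ.*-distribˡ-+ (suc l) _ a ⟩
    suc l ℕ.* #placements (suc m) (e ∷ es) ℕ.+ suc l ℕ.* a
      ≡⟨ ≡.cong (ℕ._+ suc l ℕ.* a) (#placements-absorb m e es) ⟩
    suc m ℕ.* #placements m es ℕ.+ (a ℕ.+ l ℕ.* a)
      ≡⟨ rearrange (suc m ℕ.* #placements m es) a (l ℕ.* a) ⟩
    a ℕ.+ (suc m ℕ.* #placements m es ℕ.+ l ℕ.* a)
      ≡⟨ ≡.cong (a ℕ.+_) (rest es) ⟩
    a ℕ.+ suc m ℕ.* a ∎
    where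
    open ≡.≡-Reasoning
    l a : ℕ
    l = length es
    a = #placements (suc m) es
    rearrange : ∀ p q r → p ℕ.+ (q ℕ.+ r) ≡ q ℕ.+ (p ℕ.+ r)
    rearrange p q r = ≡.trans (≡.sym (ℕₚ.+-assoc p q r)) (≡.trans (≡.cong (ℕ._+ r) (ℕₚ.+-comm p q)) (ℕₚ.+-assoc q p r))
    rest : ∀ es → suc m ℕ.* #placements m es ℕ.+ length es ℕ.* #placements (suc m) es ≡ suc m ℕ.* #placements (suc m) es
    rest []       = ≡.trans (ℕₚ.+-identityʳ _) (≡.cong (suc m ℕ.*_) (≡.sym (#placements-[] m)))
    rest (f ∷ es) = ≡.trans (≡.cong (suc m ℕ.* #placements m (f ∷ es) ℕ.+_) (#placements-absorb m f es))
      (≡.trans (≡.sym (ℕₚ.*-distribˡ-+ (suc m) (#placements m (f ∷ es)) (#placements m es)))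
        (≡.cong (suc m ℕ.*_) (≡.sym (#placements-∷ m f es))))

  -- With l the length of the word, the right side is the falling factorial (l + m)(l + m - 1)⋯(m +
  -- 1), whose l factors are all at least m.
  ^-≤-#placements : ∀ m es → m ℕ.^ length es ℕ.≤ length es ! ℕ.* #placements (length es ℕ.+ m) es
  ^-≤-#placements m [] = ℕₚ.≤-reflexive (≡.sym (≡.trans (ℕₚ.+-identityʳ _) (one m)))
    where
    one : ∀ m → #placements m [] ≡ 1
    one zero    = ≡.refl
    one (suc m) = ≡.trans (#placements-[] m) (one m)
  ^-≤-#placements m (e ∷ es) = begin
    m ℕ.* m ℕ.^ l
      ≤⟨ ℕₚ.*-mono-≤ (ℕₚ.m≤n⇒m≤1+n (ℕₚ.m≤n+m m l)) (^-≤-#placements m es) ⟩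
    suc (l ℕ.+ m) ℕ.* (l ! ℕ.* a)
      ≡⟨ swap (suc (l ℕ.+ m)) (l !) a ⟩
    l ! ℕ.* (suc (l ℕ.+ m) ℕ.* a)
      ≡⟨ ≡.cong (l ! ℕ.*_) (#placements-absorb (l ℕ.+ m) e es) ⟨
    l ! ℕ.* (suc l ℕ.* #placements (suc (l ℕ.+ m)) (e ∷ es))
      ≡⟨ ≡.trans (swap (l !) (suc l) _) (≡.sym (ℕₚ.*-assoc (suc l) (l !) _)) ⟩
    suc l ! ℕ.* #placements (suc (l ℕ.+ m)) (e ∷ es) ∎
    where
    open ℕₚ.≤-Reasoning
    l a : ℕ
    l = length es
    a = #placements (l ℕ.+ m) es
    swap : ∀ p q r → p ℕ.* (q ℕ.* r) ≡ q ℕ.* (p ℕ.* r)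
    swap p q r = ≡.trans (≡.sym (ℕₚ.*-assoc p q r)) (≡.trans (≡.cong (ℕ._* r) (ℕₚ.*-comm p q)) (ℕₚ.*-assoc q p r))

-- The numbers of arrivals of each type in a cell with the given content, in the form in which
-- `increments` takes them.
mark : ∀ {n k} → Maybe (Ball n k) → Ball n k → ℕ
mark nothing  e = 0
mark (just f) e = if does (f ≟ᵉ e) then 1 else 0

mark-≡ : ∀ {n k} (e : Ball n k) → mark (just e) e ≡ 1
mark-≡ e = ≡.cong (if_then 1 else 0) (Dec.dec-true (e ≟ᵉ e) ≡.refl)

mark-≢ : ∀ {n k} {e f : Ball n k} → ¬ f ≡ e → mark (just f) e ≡ 0
mark-≢ {e = e} {f} f≢e = ≡.cong (if_then 1 else 0) (Dec.dec-false (f ≟ᵉ e) f≢e)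

mark-injective : ∀ {n k} (s t : Maybe (Ball n k)) → (∀ e → mark s e ≡ mark t e) → s ≡ t
mark-injective nothing  nothing  p = ≡.refl
mark-injective nothing  (just f) p = case ≡.trans (p f) (mark-≡ f) of λ ()
mark-injective (just e) nothing  p = case ≡.trans (≡.sym (mark-≡ e)) (p e) of λ ()
mark-injective (just e) (just f) p with e ≟ᵉ f
... | yes e≡f = ≡.cong just e≡f
... | no e≢f  = case ≡.trans (≡.trans (≡.sym (mark-≡ f)) (≡.sym (p f))) (mark-≢ e≢f) of λ ()

lookup-injective : {A : Set} → ∀ {m} (σ τ : Vec A m) → (∀ i → lookup σ i ≡ lookup τ i) → σ ≡ τ
lookup-injective []      []      p = ≡.refl
lookup-injective (s ∷ σ) (t ∷ τ) p = ≡.cong₂ _∷_ (p zero) (lookup-injective σ τ (p ∘ suc))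

∈-balls : ∀ {n k} (e : Ball n k) → e ∈ balls n k
∈-balls {zero}  {zero}  ([] , ≡.refl)       = here ≡.refl
∈-balls {suc n} {zero}  (outside ∷ e , p)   = ∈-map⁺ _ (∈-balls (e , p))
∈-balls {suc n} {suc k} (outside ∷ e , p)   = ∈-++⁺ʳ _ (∈-map⁺ _ (∈-balls (e , p)))
∈-balls {suc n} {suc k} (inside ∷ e , p)    = ≡.subst (_∈ balls (suc n) (suc k)) (Ball-≡ ≡.refl)
  (∈-++⁺ˡ (∈-map⁺ (λ (e , p) → inside ∷ e , ≡.cong suc p) (∈-balls (e , ℕₚ.suc-injective p))))

balls-unique : ∀ n k → Unique (balls n k)
balls-unique zero    zero    = [] ∷ []
balls-unique zero    (suc k) = []
balls-unique (suc n) zero    = Uniqueₚ.map⁺ (λ eq → Ball-≡ (Vecₚ.∷-injectiveʳ (≡.cong proj₁ eq))) (balls-unique n zero)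
balls-unique (suc n) (suc k) = Uniqueₚ.++⁺
  (Uniqueₚ.map⁺ (λ eq → Ball-≡ (Vecₚ.∷-injectiveʳ (≡.cong proj₁ eq))) (balls-unique n k))
  (Uniqueₚ.map⁺ (λ eq → Ball-≡ (Vecₚ.∷-injectiveʳ (≡.cong proj₁ eq))) (balls-unique n (suc k)))
  λ (p , q) → let (_ , _ , e≡) = ∈-map⁻ _ p
                  (_ , _ , f≡) = ∈-map⁻ _ q
              in case Vecₚ.∷-injectiveˡ (≡.cong proj₁ (≡.trans (≡.sym e≡) f≡)) of λ ()

-- Recovering the ball types from the counts on a grid

module Grid (R : CompleteOrderedField) (n k : ℕ) where
  open CompleteOrderedField R
  open BallsIntoBins R n k
  open Arrival

  InWindow : Ball n k → ℝ → ℝ → Arrival → Set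
  InWindow e s t a = proj₁ (ball a) ≡ proj₁ e × (¬ time a ≤ s × time a ≤ t)

  inWindow? : ∀ e s t → Decidable (InWindow e s t)
  inWindow? e s t a = (ball a ≟ᴮ e) ×-dec (¬? (time a ≤? s) ×-dec (time a ≤? t))

  count-accept : ∀ e s t a as → InWindow e s t a → count e s t (a ∷ as) ≡ suc (count e s t as)
  count-accept e s t a as p = ≡.cong length (Listₚ.filter-accept (inWindow? e s t) {a} {as} p)

  count-reject : ∀ e s t a as → ¬ InWindow e s t a → count e s t (a ∷ as) ≡ count e s t as
  count-reject e s t a as ¬p = ≡.cong length (Listₚ.filter-reject (inWindow? e s t) {a} {as} ¬p)

  count-late : ∀ e s t as → All (λ a → ¬ time a ≤ t) as → count e s t as ≡ 0
  count-late e s t []       []         = ≡.refl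
  count-late e s t (a ∷ as) (a≰t ∷ ps) = ≡.trans (count-reject e s t a as (λ (_ , _ , a≤t) → a≰t a≤t)) (count-late e s t as ps)

  -- An arrival in the cell (s, t] would make the count of its own type positive.
  late-of-count : ∀ {s t} as → All (λ a → ¬ time a ≤ s) as → (∀ e → count e s t as ≡ 0) → All (λ a → ¬ time a ≤ t) as
  late-of-count []       []         counts = []
  late-of-count {s} {t} (a ∷ as) (a≰s ∷ ps) counts = a≰t ∷ late-of-count as ps λ e →
    ≡.trans (≡.sym (count-reject e s t a as (λ (_ , _ , a≤t) → a≰t a≤t))) (counts e)
    where
    a≰t : ¬ time a ≤ t
    a≰t a≤t = case ≡.trans (≡.sym (counts (ball a))) (count-accept (ball a) s t a as (≡.refl , a≰s , a≤t)) of λ ()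

  grid-≤ : ∀ {m} (t : Fin (suc m) → ℝ) → (∀ i → t (inject₁ i) ≤ t (suc i)) → ∀ i → t zero ≤ t i
  grid-≤ t t-mono zero            = ≤-refl
  grid-≤ {suc m} t t-mono (suc i) = ≤-trans (t-mono zero) (grid-≤ (t ∘ suc) (t-mono ∘ suc) i)

  -- If no cell of the grid contains more than one arrival, then the numbers of
  -- arrivals in the cells determine the order of the ball types.
  types-from-counts : ∀ {m} (t : Fin (suc m) → ℝ) → (∀ i → t (inject₁ i) ≤ t (suc i)) →
    ∀ (σ : Vec (Maybe (Ball n k)) m) as → AllPairs (λ a b → time a ≤ time b) as →
    All (λ a → ¬ time a ≤ t zero) as → All (λ a → time a ≤ t (fromℕ m)) as →
    (∀ e i → count e (t (inject₁ i)) (t (suc i)) as ≡ mark (lookup σ i) e) → map ball as ≡ placed σ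
  types-from-counts t t-mono []      []       _ _ _ _ = ≡.refl
  types-from-counts t t-mono []      (a ∷ as) _ (a≰t ∷ _) (a≤t ∷ _) _ = ⊥-elim (a≰t a≤t)
  types-from-counts {suc m} t t-mono (s ∷ σ) as sorted early late counts = cases s as sorted early late counts
    where
    skip : ∀ s as → AllPairs (λ a b → time a ≤ time b) as → All (λ a → ¬ time a ≤ t (suc zero)) as → All (λ a → time a ≤ t (fromℕ (suc m))) as →
      (∀ e i → count e (t (inject₁ i)) (t (suc i)) as ≡ mark (lookup (s ∷ σ) i) e) → map ball as ≡ placed (s ∷ σ)
    skip nothing  as sorted after late counts = types-from-counts (t ∘ suc) (t-mono ∘ suc) σ as sorted after late (λ e → counts e ∘ suc)
    skip (just f) as sorted after late counts = case ≡.trans (≡.sym (count-late f (t zero) (t (suc zero)) as after)) (≡.trans (counts f zero) (mark-≡ f)) of λ ()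
    cases : ∀ s as → AllPairs (λ a b → time a ≤ time b) as → All (λ a → ¬ time a ≤ t zero) as → All (λ a → time a ≤ t (fromℕ (suc m))) as →
      (∀ e i → count e (t (inject₁ i)) (t (suc i)) as ≡ mark (lookup (s ∷ σ) i) e) → map ball as ≡ placed (s ∷ σ)
    first : ∀ s a as → AllPairs (λ a b → time a ≤ time b) as → All (λ a → ¬ time a ≤ t zero) (a ∷ as) → All (λ a → time a ≤ t (fromℕ (suc m))) as →
      (∀ e i → count e (t (inject₁ i)) (t (suc i)) (a ∷ as) ≡ mark (lookup (s ∷ σ) i) e) → time a ≤ t (suc zero) → map ball (a ∷ as) ≡ placed (s ∷ σ)
    cases s []       sorted early late counts = skip s [] [] [] [] counts
    cases s (a ∷ as) sorted@(a≤as ∷ sorted′) early late@(_ ∷ late′) counts = case time a ≤? t (suc zero) of λ where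
      (no a≰t)  → skip s (a ∷ as) sorted (a≰t ∷ All.map (λ a≤b b≤t → a≰t (≤-trans a≤b b≤t)) a≤as) late counts
      (yes a≤t) → first s a as sorted′ early late′ counts a≤t
    first nothing a as sorted (a≰t ∷ early) late counts a≤t =
      case ≡.trans (≡.sym (counts (ball a) zero)) (count-accept (ball a) (t zero) (t (suc zero)) a as (≡.refl , a≰t , a≤t)) of λ ()
    first (just f) a as sorted (a≰t ∷ early) late counts a≤t = ≡.cong₂ _∷_ a≡f
      (types-from-counts (t ∘ suc) (t-mono ∘ suc) σ as sorted (late-of-count as early none) late λ e i →
        ≡.trans (≡.sym (count-reject e (t (suc (inject₁ i))) (t (suc (suc i))) a as λ (_ , a≰s , _) → a≰s (≤-trans a≤t (grid-≤ (t ∘ suc) (t-mono ∘ suc) (inject₁ i))))) (counts e (suc i)))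
      where
      accepted : mark (just f) (ball a) ≡ suc (count (ball a) (t zero) (t (suc zero)) as)
      accepted = ≡.trans (≡.sym (counts (ball a) zero)) (count-accept (ball a) (t zero) (t (suc zero)) a as (≡.refl , a≰t , a≤t))
      a≡f : ball a ≡ f
      a≡f = case f ≟ᵉ ball a of λ where
        (yes f≡a) → ≡.sym f≡a
        (no f≢a)  → case ≡.trans (≡.sym (mark-≢ f≢a)) accepted of λ ()
      -- The head of the list accounts for the whole content of the first cell, so all other
      -- arrivals lie beyond that cell and the recursion can move to the next one.
      none : ∀ e → count e (t zero) (t (suc zero)) as ≡ 0
      none e = case f ≟ᵉ e of λ where
        (yes ≡.refl) → ≡.subst (λ e → count e (t zero) (t (suc zero)) as ≡ 0) a≡f
          (ℕₚ.suc-injective (≡.trans (≡.sym accepted) (≡.trans (≡.cong (mark (just f)) a≡f) (mark-≡ f))))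
        (no f≢e) → ≡.trans (≡.sym (count-reject e (t zero) (t (suc zero)) a as (λ (p , _) → f≢e (≡.trans (≡.sym a≡f) (Ball-≡ p))))) (≡.trans (counts e zero) (mark-≢ f≢e))

-- A lower bound on the law of the ball types

module _ (R : CompleteOrderedField) (n k : ℕ) where
  open CompleteOrderedField R
  open BallsIntoBins R n k

  module TypeProbability (rate : Rates) (0≤rate : ∀ e → 0# ≤ rate e)
                         (𝓟 : Probability.ProbabilitySpace R) (process : Process 𝓟 rate) where
    open Exponential R using (exp; expTerm; poisson)
    open Exponential.Convergence R using (+-mono; *-monoˡ; 0≤1; 0≤⌜⌝; ⌜⌝-mono; ⌜⌝≉0; 0≤⁻¹)
    open Probability.ProbabilitySpace 𝓟
    open Process process
    open SemiringMult semiring using (×-homo-+; ×1-homo-*)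
    open CommutativeSemiringExp commutativeSemiring using (^-distrib-*)
    open RingProperties ring using (-‿distribʳ-*)
    open ProbabilityProperties R 𝓟
    open Sums R
    open Limits R
    open ExponentialProperties R
    open Grid R n k
    open IntegerCoefficientSolver commutativeRing
    open PosetReasoning poset

    ∏-cong : {A : Set} → ∀ xs {f g : A → ℝ} → (∀ x → f x ≈ g x) → ∏[ xs ] f ≈ ∏[ xs ] g
    ∏-cong []       f≈g = refl
    ∏-cong (x ∷ xs) f≈g = *-cong (f≈g x) (∏-cong xs f≈g)

    ∏-* : {A : Set} → ∀ xs (f g : A → ℝ) → ∏[ xs ] (λ x → f x * g x) ≈ ∏[ xs ] f * ∏[ xs ] g
    ∏-* []       f g = sym (*-identityˡ 1#)
    ∏-* (x ∷ xs) f g = trans (*-congˡ (∏-* xs f g))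
      (solve 4 (λ a b c d → (a :* b) :* (c :* d) := (a :* c) :* (b :* d)) refl (f x) (g x) _ _)

    ∏-nonNeg : {A : Set} → ∀ xs {f : A → ℝ} → (∀ x → 0# ≤ f x) → 0# ≤ ∏[ xs ] f
    ∏-nonNeg []       0≤f = 0≤1
    ∏-nonNeg (x ∷ xs) 0≤f = *-nonNeg (0≤f x) (∏-nonNeg xs 0≤f)

    ∏-1-∈ : {A : Set} → ∀ xs {f : A → ℝ} → (∀ {x} → x ∈ xs → f x ≈ 1#) → ∏[ xs ] f ≈ 1#
    ∏-1-∈ []       f≈1 = refl
    ∏-1-∈ (x ∷ xs) f≈1 = trans (*-cong (f≈1 (here ≡.refl)) (∏-1-∈ xs (f≈1 ∘ there))) (*-identityˡ 1#)

    ∏-single : {A : Set} → ∀ {xs} {f : A → ℝ} {y} → Unique xs → y ∈ xs → (∀ x → ¬ y ≡ x → f x ≈ 1#) → ∏[ xs ] f ≈ f y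
    ∏-single {xs = x ∷ xs} (x∉xs ∷ _) (here ≡.refl) p =
      trans (*-congˡ (∏-1-∈ xs λ {z} z∈ → p z (All.lookup x∉xs z∈))) (*-identityʳ _)
    ∏-single {xs = x ∷ xs} (x∉xs ∷ uxs) (there y∈xs) p =
      trans (*-cong (p x λ { ≡.refl → All.lookup x∉xs y∈xs ≡.refl }) (∏-single uxs y∈xs p)) (*-identityˡ _)

    ∑-const : {A : Set} → ∀ (xs : List A) a → ∑[ xs ] (λ _ → a) ≈ ⌜ length xs ⌝ * a
    ∑-const []       a = sym (zeroˡ a)
    ∑-const (x ∷ xs) a = trans (+-congˡ (∑-const xs a)) (solve 2 (λ l a → a :+ l :* a := (con (+ 1) :+ l) :* a) refl ⌜ length xs ⌝ a)

    ⌜⌝-^ : ∀ m j → ⌜ m ℕ.^ j ⌝ ≈ ⌜ m ⌝ ^ j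
    ⌜⌝-^ m zero    = +-identityʳ 1#
    ⌜⌝-^ m (suc j) = trans (×1-homo-* m (m ℕ.^ j)) (*-congˡ (⌜⌝-^ m j))

    bernoulli : ∀ {y a} → 0# ≤ y → 0# ≤ a → y + a ≈ 1# → ∀ j → 1# ≤ y ^ j + ⌜ j ⌝ * a
    bernoulli {y} {a} 0≤y 0≤a y+a≈1 zero    = ≤-reflexive (sym (trans (+-congˡ (zeroˡ a)) (+-identityʳ 1#)))
    bernoulli {y} {a} 0≤y 0≤a y+a≈1 (suc j) = begin
      1#                                      ≈⟨ y+a≈1 ⟨
      y + a                                   ≈⟨ +-congʳ (*-identityʳ y) ⟨
      y * 1# + a                              ≤⟨ +-monoˡ-≤ a (*-monoˡ 0≤y (bernoulli 0≤y 0≤a y+a≈1 j)) ⟩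
      y * (y ^ j + ⌜ j ⌝ * a) + a             ≈⟨ solve 4 (λ y t l a → y :* (t :+ l :* a) :+ a := y :* t :+ (a :+ (l :* a) :* y)) refl y (y ^ j) ⌜ j ⌝ a ⟩
      y * y ^ j + (a + ⌜ j ⌝ * a * y)         ≤⟨ +-mono ≤-refl (+-mono ≤-refl (*-monoˡ (*-nonNeg (0≤⌜⌝ j) 0≤a) y≤1)) ⟩
      y * y ^ j + (a + ⌜ j ⌝ * a * 1#)        ≈⟨ +-congˡ (trans (+-cong (sym (*-identityˡ a)) (*-identityʳ _)) (sym (distribʳ a 1# ⌜ j ⌝))) ⟩
      y * y ^ j + ⌜ suc j ⌝ * a               ∎
      where
      y≤1 : y ≤ 1#
      y≤1 = ≤-trans (≤-reflexive (sym (+-identityʳ y))) (≤-trans (+-mono ≤-refl 0≤a) (≤-reflexive y+a≈1))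

    Λ : ℝ
    Λ = ∑[ balls n k ] rate

    typesAre : List (Ball n k) → Pred (History n k) 0ℓ
    typesAre = Situation []

    module Cells (M : ℕ) (1≤M : 1 ℕ.≤ M) where

      δ : ℝ
      δ = ⌜ M ⌝ ⁻¹

      0≤δ : 0# ≤ δ
      0≤δ = 0≤⁻¹ (0≤⌜⌝ M) (⌜⌝≉0 M 1≤M)

      ⌜M⌝*δ : ⌜ M ⌝ * δ ≈ 1#
      ⌜M⌝*δ = ⁻¹-inverseʳ (⌜⌝≉0 M 1≤M)

      E : ℝ
      E = exp (- (Λ * δ))

      E^M : E ^ M ≈ exp (- Λ)
      E^M = trans (exp-⌜⌝* M _) (exp-cong (begin-equality
        ⌜ M ⌝ * - (Λ * δ)     ≈⟨ solve 3 (λ m l d → m :* :- (l :* d) := :- (l :* (m :* d))) refl ⌜ M ⌝ Λ δ ⟩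
        - (Λ * (⌜ M ⌝ * δ))   ≈⟨ -‿cong (trans (*-congˡ ⌜M⌝*δ) (*-identityʳ Λ)) ⟩
        - Λ                   ∎))

      factor : Maybe (Ball n k) → Ball n k → ℝ
      factor s e = poisson (rate e * δ) (mark s e)

      ∏-exp : ∏[ balls n k ] (λ e → exp (- (rate e * δ))) ≈ E
      ∏-exp = trans (exp-∑ (balls n k) (λ e → - (rate e * δ))) (exp-cong (begin-equality
        ∑[ balls n k ] (λ e → - (rate e * δ))        ≈⟨ ∑-cong (balls n k) (λ e → -‿distribʳ-* (rate e) δ) ⟩
        ∑[ balls n k ] (λ e → rate e * - δ)          ≈⟨ ∑-*ʳ (balls n k) (- δ) rate ⟩
        Λ * - δ                                      ≈⟨ -‿distribʳ-* Λ δ ⟨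
        - (Λ * δ)                                    ∎))

      ∏-factor-nothing : ∏[ balls n k ] (factor nothing) ≈ E
      ∏-factor-nothing = trans (∏-cong (balls n k) λ e → trans (*-congˡ (expTerm-0 (rate e * δ))) (*-identityʳ _)) ∏-exp

      ∏-factor-just : ∀ f → ∏[ balls n k ] (factor (just f)) ≈ E * (rate f * δ)
      ∏-factor-just f = trans (∏-* (balls n k) _ _) (*-cong ∏-exp (trans
        (∏-single {f = λ e → expTerm (rate e * δ) (mark (just f) e)} (balls-unique n k) (∈-balls f)
          λ e f≢e → trans (reflexive (≡.cong (expTerm _) (mark-≢ f≢e))) (expTerm-0 (rate e * δ)))
        (trans (reflexive (≡.cong (expTerm _) (mark-≡ f))) (expTerm-1 _))))

      -- The probability of the cell contents σ when all cells have width δ. The number m of cells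
      -- varies while δ stays 1/M, so that cells can be removed one by one: an empty cell
      -- contributes `E`, and a cell with f contributes `E * (rate f * δ)`.
      weight : ∀ {m} → Vec (Maybe (Ball n k)) m → ℝ
      weight {m} σ = ∏[ balls n k ] λ e → product {m} λ i → factor (lookup σ i) e

      weight-placed : ∀ {m} (σ : Vec (Maybe (Ball n k)) m) → weight σ ≈ E ^ m * (∏[ placed σ ] rate * δ ^ length (placed σ))
      weight-placed []            = trans (∏-1-∈ (balls n k) (λ _ → refl)) (sym (trans (*-identityˡ _) (*-identityˡ _)))
      weight-placed (nothing ∷ σ) = trans (∏-* (balls n k) (factor nothing) _)
        (trans (*-cong ∏-factor-nothing (weight-placed σ)) (sym (*-assoc _ _ _)))
      weight-placed (just f ∷ σ)  = trans (∏-* (balls n k) (factor (just f)) _)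
        (trans (*-cong (∏-factor-just f) (weight-placed σ))
          (solve 6 (λ e r d t p q → (e :* (r :* d)) :* (t :* (p :* q)) := (e :* t) :* ((r :* p) :* (d :* q))) refl
            E (rate f) δ _ (∏[ placed σ ] rate) _))

      grid : Fin (suc M) → ℝ
      grid i = ⌜ toℕ i ⌝ * δ

      grid-width : ∀ i → grid (suc i) - grid (inject₁ i) ≈ δ
      grid-width i = trans (+-congˡ (-‿cong (*-congʳ (⌜⌝-cong (Finₚ.toℕ-inject₁ i)))))
        (solve 2 (λ l d → (con (+ 1) :+ l) :* d :- l :* d := d) refl ⌜ toℕ i ⌝ δ)

      grid-mono : ∀ i → grid (inject₁ i) ≤ grid (suc i)
      grid-mono i = *-monoʳ 0≤δ (⌜⌝-mono (≡.subst (ℕ._≤ suc (toℕ i)) (≡.sym (Finₚ.toℕ-inject₁ i)) (ℕₚ.n≤1+n _)))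

      grid-end : grid (fromℕ M) ≈ 1#
      grid-end = trans (*-congʳ (⌜⌝-cong (Finₚ.toℕ-fromℕ M))) ⌜M⌝*δ

      Marked : Vec (Maybe (Ball n k)) M → Pred Ω 0ℓ
      Marked σ ω = ∀ e i → count e (grid (inject₁ i)) (grid (suc i)) (arrivals ω) ≡ mark (lookup σ i) e

      marked-probability : ∀ σ → HasProbability (Marked σ) (∏[ balls n k ] λ e → product λ i →
        poisson (rate e * (grid (suc i) - grid (inject₁ i))) (mark (lookup σ i) e))
      marked-probability σ = increments grid (≤-reflexive (sym (zeroˡ δ))) grid-mono (≤-reflexive grid-end) (λ e i → mark (lookup σ i) e)

      marked-measurable : ∀ σ → Measurable (Marked σ)
      marked-measurable σ = proj₁ (marked-probability σ)

      product-cong : ∀ {m} {f g : Fin m → ℝ} → (∀ i → f i ≈ g i) → product f ≈ product g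
      product-cong {zero}  f≈g = refl
      product-cong {suc m} f≈g = *-cong (f≈g zero) (product-cong (f≈g ∘ suc))

      ℙ-marked : ∀ σ → ℙ (marked-measurable σ) ≈ exp (- Λ) * (∏[ placed σ ] rate * δ ^ length (placed σ))
      ℙ-marked σ = trans (proj₂ (marked-probability σ)) (trans
        (∏-cong (balls n k) λ e → product-cong λ i → poisson-cong (*-congˡ (grid-width i)) (mark (lookup σ i) e))
        (trans (weight-placed σ) (*-congʳ E^M)))

      marked? : ∀ σ → Decidable (Marked σ)
      marked? σ ω = Dec.map′ (λ p e → All.lookup p (∈-balls e)) (λ p → All.universal p (balls n k))
        (All.all? (λ e → Finₚ.all? λ i → count e (grid (inject₁ i)) (grid (suc i)) (arrivals ω) ℕ.≟ mark (lookup σ i) e) (balls n k))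

      marked-types : ∀ σ ω → Marked σ ω → typesAre (placed σ) (history (arrivals ω))
      marked-types σ ω counts = history (arrivals ω) , ≡.refl , ≡.trans (≡.sym (Listₚ.map-∘ (arrivals ω)))
        (types-from-counts grid grid-mono σ (arrivals ω) (AllPairsₚ.map⁻ (Sortedₚ.Sorted⇒AllPairs totalOrder (sorted ω)))
          -- The cells are open on the left, but no arrival happens at time 0.
          (All.map (λ ((0≤t , 0≉t) , _) t≤0 → 0≉t (≤-antisym 0≤t (≤-trans t≤0 (≤-reflexive (zeroˡ δ))))) (horizon ω))
          (All.map (λ (_ , t≤1) → ≤-trans t≤1 (≤-reflexive (sym grid-end))) (horizon ω)) counts)

      marked-disjoint : ∀ {σ τ} ω → Marked σ ω → Marked τ ω → σ ≡ τ
      marked-disjoint {σ} {τ} ω p q = lookup-injective σ τ λ i → mark-injective _ _ λ e → ≡.trans (≡.sym (p e i)) (q e i)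

      -- The placements describe disjoint events of equal probability, and each of them forces the
      -- sequence of types to be `es`.
      placements-≤-probability : ∀ es → ⌜ #placements M es ⌝ * (exp (- Λ) * (∏[ es ] rate * δ ^ length es)) ≤ probability (typesAre es)
      placements-≤-probability es = begin
        ⌜ #placements M es ⌝ * (exp (- Λ) * (∏[ es ] rate * δ ^ length es))
          ≈⟨ ∑-const (placements M es) _ ⟨
        ∑[ placements M es ] (λ _ → exp (- Λ) * (∏[ es ] rate * δ ^ length es))
          ≤⟨ ∑-mono-∈ (placements M es) (λ {σ} σ∈ → ≤-reflexive (sym (trans (ℙ-marked σ)
               (reflexive (≡.cong (λ es → exp (- Λ) * (∏[ es ] rate * δ ^ length es)) (placements-placed M es σ∈)))))) ⟩
        ∑[ placements M es ] (λ σ → ℙ (marked-measurable σ))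
          ≤⟨ ∑ℙ-≤ marked-measurable marked? (placements-unique M es) marked-disjoint (measurable (typesAre es))
               (λ {σ} σ∈ ω p → ≡.subst (λ es → typesAre es (history (arrivals ω))) (placements-placed M es σ∈) (marked-types σ ω p)) ⟩
        probability (typesAre es) ∎

    -- As the grid gets finer, the arrivals are in distinct cells with probability
    -- tending to 1; for a bound from below no other outcome matters.
    types-probability : ∀ es → exp (- Λ) * ∏[ es ] rate ≤ ⌜ length es ! ⌝ * probability (typesAre es)
    types-probability es = ≤-by-archimedes (Q * (⌜ l ⌝ * ⌜ l ⌝)) λ L → refine L
      where
      l : ℕ
      l = length es
      Q p : ℝ
      Q = exp (- Λ) * ∏[ es ] rate
      p = ⌜ l ! ⌝ * probability (typesAre es)
      0≤Q : 0# ≤ Q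
      0≤Q = *-nonNeg (exp-nonNeg (- Λ)) (∏-nonNeg es 0≤rate)
      refine : ∀ L → ⌜ suc L ⌝ * (Q - p) ≤ Q * (⌜ l ⌝ * ⌜ l ⌝)
      refine L = begin
        ⌜ suc L ⌝ * (Q - p)
          ≤⟨ *-monoˡ (0≤⌜⌝ (suc L)) defect ⟩
        ⌜ suc L ⌝ * (Q * (⌜ l ⌝ * a))
          ≈⟨ solve 4 (λ m q l d → m :* (q :* (l :* (l :* d))) := q :* (l :* l) :* (m :* d)) refl ⌜ suc L ⌝ Q ⌜ l ⌝ δ ⟩
        Q * (⌜ l ⌝ * ⌜ l ⌝) * y
          ≤⟨ *-monoˡ (*-nonNeg 0≤Q (*-nonNeg (0≤⌜⌝ l) (0≤⌜⌝ l))) y≤1 ⟩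
        Q * (⌜ l ⌝ * ⌜ l ⌝) * 1#
          ≈⟨ *-identityʳ _ ⟩
        Q * (⌜ l ⌝ * ⌜ l ⌝) ∎
        where
        -- With l + (L + 1) cells, l! times the number of placements is at least (L + 1)ˡ. Hence the
        -- loss factor is yˡ with y = (L + 1)/M = 1 - l/M. By Bernoulli's inequality at most Q l²/M
        -- is lost, and L + 1 times this is at most Q l².
        M : ℕ
        M = l ℕ.+ suc L
        open Cells M (ℕₚ.≤-trans (ℕ.s≤s ℕ.z≤n) (ℕₚ.m≤n+m (suc L) l))
        y a : ℝ
        y = ⌜ suc L ⌝ * δ
        a = ⌜ l ⌝ * δ
        0≤a : 0# ≤ a
        0≤a = *-nonNeg (0≤⌜⌝ l) 0≤δ
        y+a≈1 : y + a ≈ 1#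
        y+a≈1 = trans (solve 3 (λ m l d → m :* d :+ l :* d := (l :+ m) :* d) refl ⌜ suc L ⌝ ⌜ l ⌝ δ)
          (trans (*-congʳ (sym (×-homo-+ 1# l (suc L)))) ⌜M⌝*δ)
        y≤1 : y ≤ 1#
        y≤1 = ≤-trans (≤-reflexive (sym (+-identityʳ y))) (≤-trans (+-mono ≤-refl 0≤a) (≤-reflexive y+a≈1))
        Q*y^l≤p : Q * y ^ l ≤ p
        Q*y^l≤p = begin
          Q * y ^ l
            ≈⟨ *-congˡ (trans (^-distrib-* ⌜ suc L ⌝ δ l) (*-congʳ (sym (⌜⌝-^ (suc L) l)))) ⟩
          Q * (⌜ suc L ℕ.^ l ⌝ * δ ^ l)
            ≤⟨ *-monoˡ 0≤Q (*-monoʳ (^-nonNeg 0≤δ l) (⌜⌝-mono (^-≤-#placements (suc L) es))) ⟩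
          Q * (⌜ l ! ℕ.* #placements M es ⌝ * δ ^ l)
            ≈⟨ *-congˡ (*-congʳ (×1-homo-* (l !) (#placements M es))) ⟩
          exp (- Λ) * ∏[ es ] rate * (⌜ l ! ⌝ * ⌜ #placements M es ⌝ * δ ^ l)
            ≈⟨ solve 5 (λ e r f c d → e :* r :* (f :* c :* d) := f :* (c :* (e :* (r :* d)))) refl (exp (- Λ)) (∏[ es ] rate) ⌜ l ! ⌝ ⌜ #placements M es ⌝ (δ ^ l) ⟩
          ⌜ l ! ⌝ * (⌜ #placements M es ⌝ * (exp (- Λ) * (∏[ es ] rate * δ ^ l)))
            ≤⟨ *-monoˡ (0≤⌜⌝ (l !)) (placements-≤-probability es) ⟩
          p ∎
        defect : Q - p ≤ Q * (⌜ l ⌝ * a)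
        defect = +-cancelʳ-≤ p (begin
          (Q - p) + p                        ≈⟨ solve 2 (λ q p → (q :- p) :+ p := q :* con (+ 1)) refl Q p ⟩
          Q * 1#                             ≤⟨ *-monoˡ 0≤Q (bernoulli (*-nonNeg (0≤⌜⌝ (suc L)) 0≤δ) 0≤a y+a≈1 l) ⟩
          Q * (y ^ l + ⌜ l ⌝ * a)            ≈⟨ trans (distribˡ Q _ _) (+-comm _ _) ⟩
          Q * (⌜ l ⌝ * a) + Q * y ^ l        ≤⟨ +-mono ≤-refl Q*y^l≤p ⟩
          Q * (⌜ l ⌝ * a) + p                ∎)

-- From coefficients to the amortized bound

module _ (R : CompleteOrderedField) (n k : ℕ) where
  open CompleteOrderedField R
  open BallsIntoBins R n k

  module Conclusion (c : ℕ) (1≤k : 1 ℕ.≤ k) (d : ℝ) (0<d : 0# < d)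
                    (rate : Rates) (0≤rate : ∀ e → 0# ≤ rate e) (degree-≤ : ∀ v → degree rate v ≤ d)
                    (𝓟 : Probability.ProbabilitySpace R) (process : Process 𝓟 rate)
                    (greedy : ProportionalGreedy c process) where
    open Exponential R using (exp; expTerm; exp-hasSum)
    open Exponential.Convergence R using (*-monoˡ; 0≤⌜⌝; ⌜⌝≉0; ⁻¹-inverseˡ)
    open Process process
    open Sums R
    open Limits R
    open ExponentialProperties R
    open States {n} {k}
    open Potential R c rate 0≤rate hiding (Λ)
    open ExpectedValue R c rate 0≤rate
    open GreedyValue R n k c rate 0≤rate 𝓟 process greedy
    open TypeProbability R n k rate 0≤rate 𝓟 process using (Λ; types-probability)
    open IntegerCoefficientSolver commutativeRing
    open PosetReasoning poset

    words-length : ∀ N {w} → w ∈ words N → length w ≡ N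
    words-length zero    (here ≡.refl) = ≡.refl
    words-length (suc N) w∈ with ∈-cartesianProductWith⁻ _∷_ (balls n k) (words N) w∈
    ... | _ , _ , _ , w′∈ , ≡.refl = ≡.cong suc (words-length N w′∈)

    words-unique : ∀ N → Unique (words N)
    words-unique zero    = [] ∷ []
    words-unique (suc N) = Uniqueₚ.cartesianProductWith⁺ _∷_ Listₚ.∷-injective (balls-unique n k) (words-unique N)

    0<⌜!⌝ : ∀ N → 0# < ⌜ N ! ⌝
    0<⌜!⌝ N = 0≤⌜⌝ (N !) , ≉-sym (⌜⌝≉0 (N !) (ℕₚ.1≤n! N))

    -- Different words of length N give disjoint sets of histories of that length. Each word
    -- contributes its probability bound times its `valueAfter`, and `∑-words` collects these into
    -- the coefficient.
    expectedValue-≤ : ∀ N → exp (- Λ) * expectedValue N full ≤ expectationOn (λ h → length h ≡ N)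
    expectedValue-≤ N = *-cancelˡ-≤ (0<⌜!⌝ N) (begin
      ⌜ N ! ⌝ * (exp (- Λ) * expectedValue N full)
        ≈⟨ solve 3 (λ a b c → a :* (b :* c) := b :* (a :* c)) refl ⌜ N ! ⌝ (exp (- Λ)) _ ⟩
      exp (- Λ) * (⌜ N ! ⌝ * expectedValue N full)
        ≈⟨ trans (*-congˡ (sym (∑-words N full))) (sym (∑-*ˡ (words N) (exp (- Λ)) _)) ⟩
      ∑[ words N ] (λ w → exp (- Λ) * (∏[ w ] rate * valueAfter w full))
        ≤⟨ ∑-mono-∈ (words N) perWord ⟩
      ∑[ words N ] (λ w → ⌜ N ! ⌝ * expectationOn (Situation [] w))
        ≈⟨ ∑-*ˡ (words N) ⌜ N ! ⌝ _ ⟩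
      ⌜ N ! ⌝ * ∑[ words N ] (λ w → expectationOn (Situation [] w))
        ≤⟨ *-monoˡ (0≤⌜⌝ (N !)) (∑-expectationOn-≤ (Situation? []) same-types (words-unique N) (λ w∈ h p → ≡.trans (same-length h p) (words-length N w∈))) ⟩
      ⌜ N ! ⌝ * expectationOn (λ h → length h ≡ N) ∎)
      where
      perWord : ∀ {w} → w ∈ words N → exp (- Λ) * (∏[ w ] rate * valueAfter w full) ≤ ⌜ N ! ⌝ * expectationOn (Situation [] w)
      perWord {w} w∈ = begin
        exp (- Λ) * (∏[ w ] rate * valueAfter w full)
          ≈⟨ *-assoc _ _ _ ⟨
        exp (- Λ) * ∏[ w ] rate * valueAfter w full
          ≤⟨ *-monoʳ (0≤valueAfter w full) (types-probability w) ⟩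
        ⌜ length w ! ⌝ * probability (Situation [] w) * valueAfter w full
          ≈⟨ trans (*-assoc _ _ _) (*-congʳ (⌜⌝-cong (≡.cong _! (words-length N w∈)))) ⟩
        ⌜ N ! ⌝ * (probability (Situation [] w) * valueAfter w full)
          ≤⟨ *-monoˡ (0≤⌜⌝ (N !)) (expectationOn-Situation w [] full (λ _ → ≡.refl)) ⟩
        ⌜ N ! ⌝ * expectationOn (Situation [] w) ∎
      same-types : ∀ {w w′} h → Situation [] w h → Situation [] w′ h → w ≡ w′
      same-types h (_ , p , q) (_ , p′ , q′) = ≡.trans (≡.sym q) (≡.trans (≡.cong (map proj₁) (≡.trans (≡.sym p) p′)) q′)
      same-length : ∀ {w} h → Situation [] w h → length h ≡ length w
      same-length h (rest , p , q) = ≡.trans (≡.cong length p) (≡.trans (≡.sym (Listₚ.length-map proj₁ rest)) (≡.cong length q))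

    -- A sum over a list without duplicates is the form in which the disjointness of histories of
    -- different lengths can be used.
    ∑-downFrom : ∀ f M → ∑[ downFrom M ] f ≈ partialSum f M
    ∑-downFrom f zero    = refl
    ∑-downFrom f (suc M) = trans (+-comm (f M) _) (+-congʳ (∑-downFrom f M))

    partial-≤-expectation : ∀ M → exp (- Λ) * partialSum (λ N → expectedValue N full) M ≤ expectation
    partial-≤-expectation M = begin
      exp (- Λ) * partialSum (λ N → expectedValue N full) M
        ≈⟨ partialSum-*ˡ (exp (- Λ)) _ M ⟨
      partialSum (λ N → exp (- Λ) * expectedValue N full) M
        ≤⟨ partialSum-mono expectedValue-≤ M ⟩
      partialSum (λ N → expectationOn (λ h → length h ≡ N)) M
        ≈⟨ ∑-downFrom _ M ⟨
      ∑[ downFrom M ] (λ N → expectationOn (λ h → length h ≡ N))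
        ≤⟨ ∑-expectationOn-≤ (λ N h → length h ℕ.≟ N) (λ h p q → ≡.trans (≡.sym p) q) (Uniqueₚ.downFrom⁺ M) {T = λ _ → ⊤} (λ _ _ _ → tt) ⟩
      expectationOn (λ _ → ⊤)
        ≤⟨ expectationOn-≤ (λ _ → yes tt) ⟩
      expectation ∎

    hasSum-suc : ∀ {f l} → HasSum f l → HasSum (f ∘ suc) (- f 0 + l)
    hasSum-suc {f} f→l = Converges-cong
      (λ m → trans (+-congˡ (partialSum-suc f m)) (solve 2 (λ a b → :- a :+ (a :+ b) := b) refl (f 0) _)) refl
      (Converges-+ (Converges-const (- f 0)) (Converges-suc f→l))

    hasSum-pred : ∀ {f l} → HasSum (f ∘ suc) l → HasSum f (f 0 + l)
    hasSum-pred {f} f→l = Converges-pred (Converges-cong (λ m → sym (partialSum-suc f m)) refl (Converges-+ (Converges-const (f 0)) f→l))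

    -- As min{i + 1, J + 1} = 1 + min{i, J}, the capped series is, up to its vanishing first term,
    -- the tail of f plus the series of the shifted f with cap J. Induction on J thus yields the
    -- limit without a Cauchy estimate.
    hasSum-⊓ : ∀ {f l} → HasSum f l → ∀ J → ∃ (HasSum (λ i → f i * ⌜ i ⊓ J ⌝))
    hasSum-⊓ f→l zero = 0# , Converges-eventually 0 λ m _ → trans
      (partialSum-cong (λ i → trans (*-congˡ (⌜⌝-cong (ℕₚ.⊓-zeroʳ i))) (trans (zeroʳ _) (sym (zeroˡ 0#)))) m)
      (trans (partialSum-*ˡ 0# (λ _ → 0#) m) (zeroˡ _))
    hasSum-⊓ {f} {l} f→l (suc J) with hasSum-⊓ (hasSum-suc f→l) J
    ... | s , p = _ , hasSum-pred (Converges-cong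
      (λ m → trans (sym (partialSum-+ (f ∘ suc) (λ i → f (suc i) * ⌜ i ⊓ J ⌝) m))
        (partialSum-cong (λ i → solve 2 (λ a b → a :+ a :* b := a :* (con (+ 1) :+ b)) refl (f (suc i)) ⌜ i ⊓ J ⌝) m))
      refl (Converges-+ (hasSum-suc f→l) p))

    x : ℝ
    x = d * ⌜ k ⌝

    0<⌜k⌝ : 0# < ⌜ k ⌝
    0<⌜k⌝ = 0≤⌜⌝ k , ≉-sym (⌜⌝≉0 k 1≤k)

    0<x : 0# < x
    0<x = *-pos 0<d 0<⌜k⌝

    degree-incidence : ∀ v → degree rate v ≈ ⌜ k ⌝ ⁻¹ * ∑ᴮ (λ e → rate e * incidence e v)
    degree-incidence v = *-congˡ (trans (∑-filter (_∋? v) (balls n k) rate) (∑-cong (balls n k) λ e → *-comm _ _))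

    rate-bound : ∀ v → ∑ᴮ (λ e → rate e * incidence e v) ≤ x
    rate-bound v = begin
      ∑ᴮ (λ e → rate e * incidence e v)
        ≈⟨ trans (*-congʳ (⁻¹-inverseʳ (⌜⌝≉0 k 1≤k))) (*-identityˡ _) ⟨
      ⌜ k ⌝ * ⌜ k ⌝ ⁻¹ * ∑ᴮ (λ e → rate e * incidence e v)
        ≈⟨ trans (*-assoc _ _ _) (*-congˡ (sym (degree-incidence v))) ⟩
      ⌜ k ⌝ * degree rate v
        ≤⟨ *-monoˡ (0≤⌜⌝ k) (degree-≤ v) ⟩
      ⌜ k ⌝ * d
        ≈⟨ *-comm _ _ ⟩
      x ∎

    -- When every capacity is 1, the `size` of e is its number of bins.
    ∑-incidence : ∀ e → ∑ⱽ (incidence e) ≈ ⌜ k ⌝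
    ∑-incidence e = begin-equality
      ∑ⱽ (incidence e)                        ≈⟨ ∑-cong (allFin n) (λ v → trans (*-congˡ (+-identityʳ 1#)) (*-identityʳ _)) ⟨
      ∑ⱽ (λ v → incidence e v * ⌜ 1 ⌝)        ≈⟨ ⌜size⌝ (λ _ → 1) e ⟨
      ⌜ size (λ _ → 1) e ⌝                    ≈⟨ ⌜⌝-cong (≡.trans (size-const 1 e) (ℕₚ.+-identityʳ k)) ⟩
      ⌜ k ⌝                                   ∎

    -- Double counting: every ball type is counted at k bins, which the factor 1/k in `degree`
    -- undoes.
    ∑-degree : ∑ⱽ (degree rate) ≈ Λ
    ∑-degree = begin-equality
      ∑ⱽ (degree rate)
        ≈⟨ trans (∑-cong (allFin n) degree-incidence) (∑-*ˡ (allFin n) (⌜ k ⌝ ⁻¹) _) ⟩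
      ⌜ k ⌝ ⁻¹ * ∑ⱽ (λ v → ∑ᴮ (λ e → rate e * incidence e v))
        ≈⟨ *-congˡ (trans (∑-swap (allFin n) (balls n k) _) (∑-cong (balls n k) λ e →
             trans (∑-*ˡ (allFin n) (rate e) _) (*-congˡ (∑-incidence e)))) ⟩
      ⌜ k ⌝ ⁻¹ * ∑ᴮ (λ e → rate e * ⌜ k ⌝)
        ≈⟨ *-congˡ (trans (∑-*ʳ (balls n k) ⌜ k ⌝ rate) (*-comm _ _)) ⟩
      ⌜ k ⌝ ⁻¹ * (⌜ k ⌝ * Λ)
        ≈⟨ trans (sym (*-assoc _ _ _)) (trans (*-congʳ (⁻¹-inverseˡ (⌜⌝≉0 k 1≤k))) (*-identityˡ Λ)) ⟩
      Λ ∎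

    cappedSum : ∃ (HasSum (λ i → expTerm x i * ⌜ i ⊓ (c ℕ.* k) ⌝))
    cappedSum = hasSum-⊓ (exp-hasSum x) (c ℕ.* k)

    m : ℝ
    m = exp (- x) * proj₁ cappedSum

    poisson-expectation : Probability.HasPoissonExpectation R x (λ j → j ⊓ (c ℕ.* k)) m
    poisson-expectation = Converges-cong
      (λ N → trans (sym (partialSum-*ˡ (exp (- x)) _ N)) (partialSum-cong (λ i → solve 3 (λ e t l → e :* (t :* l) := l :* (e :* t)) refl (exp (- x)) (expTerm x i) ⌜ i ⊓ (c ℕ.* k) ⌝) N))
      refl (Converges-*ˡ (exp (- x)) (proj₂ cappedSum))

    guarantee : (m / x) * ∑ⱽ (degree rate) ≤ expectation
    guarantee = *-cancelˡ-≤ 0<x (begin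
      x * (m * x ⁻¹ * ∑ⱽ (degree rate))
        ≈⟨ solve 4 (λ x m i l → x :* (m :* i :* l) := (x :* i) :* (m :* l)) refl x m (x ⁻¹) _ ⟩
      (x * x ⁻¹) * (m * ∑ⱽ (degree rate))
        ≈⟨ trans (*-congʳ (⁻¹-inverseʳ (≉-sym (proj₂ 0<x)))) (*-identityˡ _) ⟩
      m * ∑ⱽ (degree rate)
        ≈⟨ *-congˡ ∑-degree ⟩
      m * Λ
        ≤⟨ LowerBound.lower-bound x (proj₁ 0<x) rate-bound partial-≤-expectation (proj₂ cappedSum) ⟩
      x * expectation ∎)

    amortized : ∑ⱽ (λ v → (m / x) * degree rate v) ≤ expectation
    amortized = ≤-trans (≤-reflexive (∑-*ˡ (allFin n) (m / x) (degree rate))) guarantee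

corollary7p2 :
  (R : CompleteOrderedField) (n k c : ℕ) →
  let open CompleteOrderedField R
      open Probability R
      open BallsIntoBins R n k
  in
  1 ℕ.≤ k → 1 ℕ.≤ c →
  (d : ℝ) → 0# < d →
  (rate : Rates) → (∀ e → 0# ≤ rate e) →
  (∀ v → degree rate v ≤ d) →
  (𝓟 : ProbabilitySpace) (process : Process 𝓟 rate) →
  ProportionalGreedy c process →
  let open ProbabilitySpace 𝓟
      open Process process
      x = d * ⌜ k ⌝
  in
  ∃[ m ] HasPoissonExpectation x (λ j → j ⊓ (c ℕ.* k)) m
    × (∃[ μ ] HasExpectation (λ ω → sum (map (λ v → finalLoad v ω ⊓ c) (allFin n))) μ
             × ((m / x) * ∑[ allFin n ] (degree rate) ≤ μ))
    × AmortizedBound (λ l → l ⊓ c) (λ y → (m / x) * y)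
corollary7p2 R n k c 1≤k 1≤c d 0<d rate 0≤rate degree-≤ 𝓟 process greedy =
  m , poisson-expectation , (expectation , hasExpectation , guarantee) , (expectation , hasExpectation , amortized)
  where
  open Conclusion R n k c 1≤k d 0<d rate 0≤rate degree-≤ 𝓟 process greedy
  open GreedyValue R n k c rate 0≤rate 𝓟 process greedy using (expectation; hasExpectation)
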